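{- Assume $\mathrm{BQP}\subsetneq\mathrm{QMA}$. Then, given a QMA-machine, it is undecidable whether its extremal problem is in $\mathrm{BQP}$; that is, there is no deterministic Turing machine which, on input the Gödel number of any QMA-machine $M$, outputs $1$ if $P(M)\in\mathrm{BQP}$ and $0$ if $P(M)\notin\mathrm{BQP}$.
   Context: Let $\Sigma=\{0,1\}$. A promise problem is a pair $A=(A_{\text{yes}},A_{\text{no}})$ of disjoint subsets of $\Sigma^*$. A deterministic Turing machine (DTM) has polynomial runtime if for some polynomial $p$ it halts on every $x\in\Sigma^*$ within $p(|x|)$ steps. The Gödel number of a DTM is a binary encoding of its transition function and final states. A machine "is given" by its Gödel number (for a quantum circuit family: the Gödel number of the DTM generating it). A function $f:\mathbb{N}_0\to\mathbb{N}_0$ is in $\mathrm{poly}$ iff it is polynomially bounded and some DTM outputs the binary representation of $f(n)$ on all inputs of length $n$ in polynomial time. Quantum circuits consist of the gates $H=\frac1{\sqrt2}\begin{pmatrix}1&1\\1&-1\end{pmatrix}$, $T=\mathrm{diag}(1,e^{i\pi/4})$ and $\mathrm{CNOT}$, with acceptance projector $\Pi_{\text{acc}}=|1\rangle\langle1|$ on a designated output qubit. A polynomial-time generated circuit family is given by a polynomial-runtime DTM that on input $x$ outputs a (sensible, efficient, non-compressive) gate-by-gate encoding of a circuit $U_x$; invalid outputs encode the never-accepting circuit. - BQP-machine $M$: a polynomial-time generated circuit family, $U_x$ acting on $k$ qubits; put $v_M(x)=\langle0^k|U_x^\dagger\Pi_{\text{acc}}U_x|0^k\rangle$. - QMA-machine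 $M$: a polynomial-time generated circuit family on $k+m$ qubits, $k+m\in\mathrm{poly}$, the generating DTM also outputting the number $m=m(|x|)$ of witness qubits; put $v_M(x)=\max_{|\psi\rangle}(\langle\psi|\otimes\langle0^k|)U_x^\dagger\Pi_{\text{acc}}U_x(|\psi\rangle\otimes|0^k\rangle)$ over unit vectors $|\psi\rangle\in\mathbb{C}^{2^{m}}$. A machine $M$ decides $A$ iff $v_M(x)\ge\frac23$ for all $x\in A_{\text{yes}}$ and $v_M(x)\le\frac13$ for all $x\in A_{\text{no}}$. BQP (QMA) is the set of promise problems decided by some BQP-machine (QMA-machine). The extremal problem $P(M)$ is the promise problem with the largest promise decided by $M$: $P(M)_{\text{yes}}=\{x: v_M(x)\ge\frac23\}$, $P(M)_{\text{no}}=\{x: v_M(x)\le\frac13\}$. -}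

module Defs where

open import Data.Bool.Base using (Bool; true; false; if_then_else_; _xor_)
open import Data.Fin.Base as Fin using (Fin; zero; suc; toℕ; fromℕ<)
import Data.Fin.Properties as Fin
open import Data.List.Base as List using (List; []; _∷_; _++_; length; map; concatMap; replicate)
open import Data.Maybe.Base as Maybe using (Maybe; just; nothing)
open import Data.Nat.Base as ℕ using (ℕ; zero; suc)
import Data.Nat.Properties as ℕ
open import Data.Digit using (toNatDigits)
open import Data.Integer.Base as ℤ using (+_; +[1+_])
open import Data.Product.Base using (Σ; ∃; _×_; _,_; proj₁; proj₂)
open import Data.Rational.Base as ℚ using (ℚ; 0ℚ; 1ℚ; ½; _/_; Positive; mkℚ)
import Data.Rational.Properties as ℚ
import Data.Rational.Unnormalised.Base as ℚᵘ
import Data.Rational.Unnormalised.Properties as ℚᵘ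
open import Data.Rational.Solver using (module +-*-Solver)
open import Data.Sum.Base using (inj₁; inj₂)
open import Data.Vec.Base as Vec using (Vec; []; _∷_; lookup; _[_]≔_; _[_]%=_)
open import Level using (0ℓ)
open import Function.Base using (_∘_; _$_)
open import Relation.Binary.PropositionalEquality
open import Relation.Nullary using (¬_; yes; no)
open import Relation.Nullary.Decidable using (from-no)
open import Relation.Unary using (Pred; _∈_; _⊆_)

------------------------------------------------------------------------
-- Real numbers: Cauchy sequences of rationals

record ℝ : Set where
  field
    seq    : ℕ → ℚ
    cauchy : ∀ ε → .{{Positive ε}} → ∃ λ N → ∀ m n → N ℕ.≤ m → N ℕ.≤ n →
             ℚ.∣ seq m ℚ.- seq n ∣ ℚ.≤ ε

open ℝ

infix 4 _≤ℝ_ _≈ℝ_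

_≤ℝ_ : ℝ → ℝ → Set
x ≤ℝ y = ∀ ε → .{{Positive ε}} → ∃ λ N → ∀ n → N ℕ.≤ n → seq x n ℚ.≤ seq y n ℚ.+ ε

_≈ℝ_ : ℝ → ℝ → Set
x ≈ℝ y = x ≤ℝ y × y ≤ℝ x

private
  +-pos : ∀ p q → .{{Positive p}} → .{{Positive q}} → Positive (p ℚ.+ q)
  +-pos p q = ℚ.positive (ℚ.+-mono-< (ℚ.positive⁻¹ p) (ℚ.positive⁻¹ q))

  *-pos : ∀ p q → .{{Positive p}} → .{{Positive q}} → Positive (p ℚ.* q)
  *-pos p q = ℚ.positive (subst (ℚ._< p ℚ.* q) (ℚ.*-zeroʳ p) (ℚ.*-monoʳ-<-pos p (ℚ.positive⁻¹ q)))

  halves : ∀ ε → ½ ℚ.* ε ℚ.+ ½ ℚ.* ε ≡ ε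
  halves ε = trans (sym (ℚ.*-distribʳ-+ ε ½ ½)) (ℚ.*-identityˡ ε)

  ∣p-p∣≡0 : ∀ p → ℚ.∣ p ℚ.- p ∣ ≡ 0ℚ
  ∣p-p∣≡0 p = cong ℚ.∣_∣ (ℚ.+-inverseʳ p)

  bounded : ∀ x → ∃ λ B → Positive B × ∃ λ N → ∀ n → N ℕ.≤ n → ℚ.∣ seq x n ∣ ℚ.≤ B
  bounded x with cauchy x 1ℚ
  ... | N , close = ℚ.∣ seq x N ∣ ℚ.+ 1ℚ
      , ℚ.positive (ℚ.+-mono-≤-< (ℚ.0≤∣p∣ (seq x N)) (ℚ.positive⁻¹ 1ℚ))
      , N , λ n N≤n → begin
        ℚ.∣ seq x n ∣                                ≡⟨ cong ℚ.∣_∣ (solve 2 (λ a b → b := a :+ (b :- a)) refl (seq x N) (seq x n)) ⟩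
        ℚ.∣ seq x N ℚ.+ (seq x n ℚ.- seq x N) ∣      ≤⟨ ℚ.∣p+q∣≤∣p∣+∣q∣ (seq x N) (seq x n ℚ.- seq x N) ⟩
        ℚ.∣ seq x N ∣ ℚ.+ ℚ.∣ seq x n ℚ.- seq x N ∣  ≤⟨ ℚ.+-monoʳ-≤ ℚ.∣ seq x N ∣ (close n N N≤n ℕ.≤-refl) ⟩
        ℚ.∣ seq x N ∣ ℚ.+ 1ℚ                         ∎
    where open ℚ.≤-Reasoning
          open +-*-Solver

fromℚ : ℚ → ℝ
fromℚ q .seq _ = q
fromℚ q .cauchy ε = 0 , λ _ _ _ _ → subst (ℚ._≤ ε) (sym (∣p-p∣≡0 q)) (ℚ.<⇒≤ (ℚ.positive⁻¹ ε))

infixl 6 _+ℝ_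
infixl 7 _*ℝ_
infix  8 -ℝ_

_+ℝ_ : ℝ → ℝ → ℝ
(x +ℝ y) .seq n = seq x n ℚ.+ seq y n
(x +ℝ y) .cauchy ε = N₁ ℕ.⊔ N₂ , λ m n N≤m N≤n → begin
    ℚ.∣ (seq x m ℚ.+ seq y m) ℚ.- (seq x n ℚ.+ seq y n) ∣
      ≡⟨ cong ℚ.∣_∣ (solve 4 (λ a b c d → (a :+ b) :- (c :+ d) := (a :- c) :+ (b :- d)) refl
                       (seq x m) (seq y m) (seq x n) (seq y n)) ⟩
    ℚ.∣ (seq x m ℚ.- seq x n) ℚ.+ (seq y m ℚ.- seq y n) ∣
      ≤⟨ ℚ.∣p+q∣≤∣p∣+∣q∣ (seq x m ℚ.- seq x n) (seq y m ℚ.- seq y n) ⟩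
    ℚ.∣ seq x m ℚ.- seq x n ∣ ℚ.+ ℚ.∣ seq y m ℚ.- seq y n ∣
      ≤⟨ ℚ.+-mono-≤ (closeX m n (ℕ.m⊔n≤o⇒m≤o N₁ N₂ N≤m) (ℕ.m⊔n≤o⇒m≤o N₁ N₂ N≤n))
                    (closeY m n (ℕ.m⊔n≤o⇒n≤o N₁ N₂ N≤m) (ℕ.m⊔n≤o⇒n≤o N₁ N₂ N≤n)) ⟩
    ½ ℚ.* ε ℚ.+ ½ ℚ.* ε
      ≡⟨ halves ε ⟩
    ε ∎
  where
  open ℚ.≤-Reasoning
  open +-*-Solver
  cx = cauchy x (½ ℚ.* ε) {{*-pos ½ ε}}
  cy = cauchy y (½ ℚ.* ε) {{*-pos ½ ε}}
  N₁ = proj₁ cx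
  N₂ = proj₁ cy
  closeX = proj₂ cx
  closeY = proj₂ cy

private
  *-close : ∀ {a b c d B C δ} → .{{Positive δ}} → ℚ.∣ a ∣ ℚ.≤ B → ℚ.∣ d ∣ ℚ.≤ C →
            ℚ.∣ b ℚ.- d ∣ ℚ.≤ δ → ℚ.∣ a ℚ.- c ∣ ℚ.≤ δ →
            ℚ.∣ a ℚ.* b ℚ.- c ℚ.* d ∣ ℚ.≤ (B ℚ.+ C) ℚ.* δ
  *-close {a} {b} {c} {d} {B} {C} {δ} a≤B d≤C b-d≤δ a-c≤δ = begin
    ℚ.∣ a ℚ.* b ℚ.- c ℚ.* d ∣
      ≡⟨ cong ℚ.∣_∣ (solve 4 (λ a b c d → a :* b :- c :* d := a :* (b :- d) :+ d :* (a :- c)) refl a b c d) ⟩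
    ℚ.∣ a ℚ.* (b ℚ.- d) ℚ.+ d ℚ.* (a ℚ.- c) ∣
      ≤⟨ ℚ.∣p+q∣≤∣p∣+∣q∣ (a ℚ.* (b ℚ.- d)) (d ℚ.* (a ℚ.- c)) ⟩
    ℚ.∣ a ℚ.* (b ℚ.- d) ∣ ℚ.+ ℚ.∣ d ℚ.* (a ℚ.- c) ∣
      ≤⟨ ℚ.+-mono-≤ (mul≤ a (b ℚ.- d) a≤B b-d≤δ) (mul≤ d (a ℚ.- c) d≤C a-c≤δ) ⟩
    B ℚ.* δ ℚ.+ C ℚ.* δ
      ≡⟨ ℚ.*-distribʳ-+ δ B C ⟨
    (B ℚ.+ C) ℚ.* δ ∎
    where
    open ℚ.≤-Reasoning
    open +-*-Solver
    mul≤ : ∀ {D} p q → ℚ.∣ p ∣ ℚ.≤ D → ℚ.∣ q ∣ ℚ.≤ δ → ℚ.∣ p ℚ.* q ∣ ℚ.≤ D ℚ.* δ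
    mul≤ {D} p q p≤D q≤δ = begin
      ℚ.∣ p ℚ.* q ∣       ≡⟨ ℚ.∣p*q∣≡∣p∣*∣q∣ p q ⟩
      ℚ.∣ p ∣ ℚ.* ℚ.∣ q ∣ ≤⟨ ℚ.*-monoˡ-≤-nonNeg ℚ.∣ p ∣ {{ℚ.∣-∣-nonNeg p}} q≤δ ⟩
      ℚ.∣ p ∣ ℚ.* δ       ≤⟨ ℚ.*-monoʳ-≤-nonNeg δ {{ℚ.pos⇒nonNeg δ}} p≤D ⟩
      D ℚ.* δ             ∎

  shrink : ∀ B ε → .{{Positive B}} → .{{Positive ε}} → ∃ λ δ → Positive δ × B ℚ.* δ ≡ ε
  shrink B ε = 1/B ℚ.* ε , *-pos 1/B ε {{ℚ.1/pos⇒pos B}}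
             , trans (sym (ℚ.*-assoc B 1/B ε)) (trans (cong (ℚ._* ε) (ℚ.*-inverseʳ B {{B≢0}})) (ℚ.*-identityˡ ε))
    where
    B≢0 : ℚ.NonZero B
    B≢0 = ℚ.pos⇒nonZero B
    1/B : ℚ
    1/B = ℚ.1/_ B {{B≢0}}

_*ℝ_ : ℝ → ℝ → ℝ
(x *ℝ y) .seq n = seq x n ℚ.* seq y n
(x *ℝ y) .cauchy ε = go (bounded x) (bounded y)
  where
  go : (∃ λ B → Positive B × ∃ λ N → ∀ n → N ℕ.≤ n → ℚ.∣ seq x n ∣ ℚ.≤ B) →
       (∃ λ C → Positive C × ∃ λ N → ∀ n → N ℕ.≤ n → ℚ.∣ seq y n ∣ ℚ.≤ C) →
       ∃ λ N → ∀ m n → N ℕ.≤ m → N ℕ.≤ n →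
       ℚ.∣ seq x m ℚ.* seq y m ℚ.- seq x n ℚ.* seq y n ∣ ℚ.≤ ε
  go (B , B>0 , M₁ , x≤B) (C , C>0 , M₂ , y≤C) = go′ (shrink (B ℚ.+ C) ε {{+-pos B C {{B>0}} {{C>0}}}})
    where
    go′ : (∃ λ δ → Positive δ × (B ℚ.+ C) ℚ.* δ ≡ ε) →
          ∃ λ N → ∀ m n → N ℕ.≤ m → N ℕ.≤ n →
          ℚ.∣ seq x m ℚ.* seq y m ℚ.- seq x n ℚ.* seq y n ∣ ℚ.≤ ε
    go′ (δ , δ>0 , [B+C]δ≡ε) = (M₁ ℕ.⊔ M₂) ℕ.⊔ (N₁ ℕ.⊔ N₂) , close
      where
      cx = cauchy x δ {{δ>0}}
      cy = cauchy y δ {{δ>0}}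
      N₁ = proj₁ cx
      N₂ = proj₁ cy
      close : ∀ m n → (M₁ ℕ.⊔ M₂) ℕ.⊔ (N₁ ℕ.⊔ N₂) ℕ.≤ m → (M₁ ℕ.⊔ M₂) ℕ.⊔ (N₁ ℕ.⊔ N₂) ℕ.≤ n →
              ℚ.∣ seq x m ℚ.* seq y m ℚ.- seq x n ℚ.* seq y n ∣ ℚ.≤ ε
      close m n m≥ n≥ = subst (ℚ.∣ seq x m ℚ.* seq y m ℚ.- seq x n ℚ.* seq y n ∣ ℚ.≤_) [B+C]δ≡ε
       (*-close {a = seq x m} {b = seq y m} {c = seq x n} {d = seq y n} {{δ>0}}
         (x≤B m (ℕ.m⊔n≤o⇒m≤o M₁ M₂ m≥M))
         (y≤C n (ℕ.m⊔n≤o⇒n≤o M₁ M₂ n≥M))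
         (proj₂ cy m n (ℕ.m⊔n≤o⇒n≤o N₁ N₂ m≥N) (ℕ.m⊔n≤o⇒n≤o N₁ N₂ n≥N))
         (proj₂ cx m n (ℕ.m⊔n≤o⇒m≤o N₁ N₂ m≥N) (ℕ.m⊔n≤o⇒m≤o N₁ N₂ n≥N)))
        where
        m≥M = ℕ.m⊔n≤o⇒m≤o (M₁ ℕ.⊔ M₂) (N₁ ℕ.⊔ N₂) m≥
        n≥M = ℕ.m⊔n≤o⇒m≤o (M₁ ℕ.⊔ M₂) (N₁ ℕ.⊔ N₂) n≥
        m≥N = ℕ.m⊔n≤o⇒n≤o (M₁ ℕ.⊔ M₂) (N₁ ℕ.⊔ N₂) m≥
        n≥N = ℕ.m⊔n≤o⇒n≤o (M₁ ℕ.⊔ M₂) (N₁ ℕ.⊔ N₂) n≥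

-ℝ_ : ℝ → ℝ
-ℝ x = fromℚ (ℚ.- 1ℚ) *ℝ x

≈ℝ-refl : ∀ {x} → x ≈ℝ x
≈ℝ-refl {x} = x≤x , x≤x
  where
  x≤x : x ≤ℝ x
  x≤x ε = 0 , λ n _ → subst (ℚ._≤ seq x n ℚ.+ ε) (ℚ.+-identityʳ (seq x n))
                        (ℚ.+-monoʳ-≤ (seq x n) (ℚ.<⇒≤ (ℚ.positive⁻¹ ε)))

≤ℝ-trans : ∀ x y z → x ≤ℝ y → y ≤ℝ z → x ≤ℝ z
≤ℝ-trans x y z x≤y y≤z ε
  with x≤y (½ ℚ.* ε) {{*-pos ½ ε}} | y≤z (½ ℚ.* ε) {{*-pos ½ ε}}
... | N₁ , p | N₂ , q = N₁ ℕ.⊔ N₂ , λ n N≤n → begin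
    seq x n                                ≤⟨ p n (ℕ.m⊔n≤o⇒m≤o N₁ N₂ N≤n) ⟩
    seq y n ℚ.+ ½ ℚ.* ε                    ≤⟨ ℚ.+-monoˡ-≤ (½ ℚ.* ε) (q n (ℕ.m⊔n≤o⇒n≤o N₁ N₂ N≤n)) ⟩
    (seq z n ℚ.+ ½ ℚ.* ε) ℚ.+ ½ ℚ.* ε      ≡⟨ ℚ.+-assoc (seq z n) (½ ℚ.* ε) (½ ℚ.* ε) ⟩
    seq z n ℚ.+ (½ ℚ.* ε ℚ.+ ½ ℚ.* ε)      ≡⟨ cong (seq z n ℚ.+_) (halves ε) ⟩
    seq z n ℚ.+ ε                          ∎
  where open ℚ.≤-Reasoning

------------------------------------------------------------------------
-- √½ by bisection, with √½² = ½

private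
  2⁻ : ℕ → ℚ
  2⁻ zero    = 1ℚ
  2⁻ (suc n) = ½ ℚ.* 2⁻ n

  bisect : ℕ → ℚ
  bisect zero    = 0ℚ
  bisect (suc n) with bisect n ℚ.+ 2⁻ (suc n)
  ... | c with c ℚ.* c ℚ.≤? ½
  ... | yes _ = c
  ... | no  _ = bisect n

  0<2⁻ : ∀ n → 0ℚ ℚ.< 2⁻ n
  0<2⁻ zero    = ℚ.positive⁻¹ 1ℚ
  0<2⁻ (suc n) = ℚ.positive⁻¹ (½ ℚ.* 2⁻ n) {{*-pos ½ (2⁻ n) {{_}} {{ℚ.positive (0<2⁻ n)}}}}

  p≤p+2⁻ : ∀ p n → p ℚ.≤ p ℚ.+ 2⁻ n
  p≤p+2⁻ p n = subst (ℚ._≤ p ℚ.+ 2⁻ n) (ℚ.+-identityʳ p) (ℚ.+-monoʳ-≤ p (ℚ.<⇒≤ (0<2⁻ n)))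

  split : ∀ p n → (p ℚ.+ 2⁻ (suc n)) ℚ.+ 2⁻ (suc n) ≡ p ℚ.+ 2⁻ n
  split p n = trans (ℚ.+-assoc p (2⁻ (suc n)) (2⁻ (suc n))) (cong (p ℚ.+_) (halves (2⁻ n)))

  upper : ℕ → ℚ
  upper n = bisect n ℚ.+ 2⁻ n

  bisect-step : ∀ n → bisect n ℚ.≤ bisect (suc n)
  bisect-step n with (bisect n ℚ.+ 2⁻ (suc n)) ℚ.* (bisect n ℚ.+ 2⁻ (suc n)) ℚ.≤? ½
  ... | yes _ = p≤p+2⁻ (bisect n) (suc n)
  ... | no  _ = ℚ.≤-refl

  upper-step : ∀ n → upper (suc n) ℚ.≤ upper n
  upper-step n with (bisect n ℚ.+ 2⁻ (suc n)) ℚ.* (bisect n ℚ.+ 2⁻ (suc n)) ℚ.≤? ½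
  ... | yes _ = ℚ.≤-reflexive (split (bisect n) n)
  ... | no  _ = subst (bisect n ℚ.+ 2⁻ (suc n) ℚ.≤_) (split (bisect n) n)
                      (p≤p+2⁻ (bisect n ℚ.+ 2⁻ (suc n)) (suc n))

  bisect-mono′ : ∀ {m n} → m ℕ.≤′ n → bisect m ℚ.≤ bisect n × upper n ℚ.≤ upper m
  bisect-mono′ ℕ.≤′-refl = ℚ.≤-refl , ℚ.≤-refl
  bisect-mono′ {n = suc n} (ℕ.≤′-step m≤n) with bisect-mono′ m≤n
  ... | p , q = ℚ.≤-trans p (bisect-step n) , ℚ.≤-trans (upper-step n) q

  bisect-mono : ∀ {m n} → m ℕ.≤ n → bisect m ℚ.≤ bisect n × upper n ℚ.≤ upper m
  bisect-mono = bisect-mono′ ∘ ℕ.≤⇒≤′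

  bisect²≤½ : ∀ n → bisect n ℚ.* bisect n ℚ.≤ ½
  bisect²≤½ zero    = ℚ.<⇒≤ (ℚ.positive⁻¹ ½)
  bisect²≤½ (suc n) with (bisect n ℚ.+ 2⁻ (suc n)) ℚ.* (bisect n ℚ.+ 2⁻ (suc n)) ℚ.≤? ½
  ... | yes c²≤½ = c²≤½
  ... | no  _    = bisect²≤½ n

  ½≤upper² : ∀ n → ½ ℚ.≤ upper n ℚ.* upper n
  ½≤upper² zero    = ℚ.≤ᵇ⇒≤ _
  ½≤upper² (suc n) with (bisect n ℚ.+ 2⁻ (suc n)) ℚ.* (bisect n ℚ.+ 2⁻ (suc n)) ℚ.≤? ½
  ... | yes _    = subst (λ u → ½ ℚ.≤ u ℚ.* u) (sym (split (bisect n) n)) (½≤upper² n)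
  ... | no  ½<c² = ℚ.<⇒≤ (ℚ.≰⇒> ½<c²)

  ∣p-q∣≤ : ∀ {a h p q} → a ℚ.≤ p → p ℚ.≤ a ℚ.+ h → a ℚ.≤ q → q ℚ.≤ a ℚ.+ h → ℚ.∣ p ℚ.- q ∣ ℚ.≤ h
  ∣p-q∣≤ {a} {h} {p} {q} a≤p p≤u a≤q q≤u with ℚ.∣p∣≡p∨∣p∣≡-p (p ℚ.- q)
  ... | inj₁ eq = begin
      ℚ.∣ p ℚ.- q ∣    ≡⟨ eq ⟩
      p ℚ.- q          ≤⟨ ℚ.+-mono-≤ p≤u (ℚ.neg-antimono-≤ a≤q) ⟩
      a ℚ.+ h ℚ.- a    ≡⟨ solve 2 (λ a h → a :+ h :- a := h) refl a h ⟩
      h                ∎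
    where open ℚ.≤-Reasoning
          open +-*-Solver
  ... | inj₂ eq = begin
      ℚ.∣ p ℚ.- q ∣    ≡⟨ eq ⟩
      ℚ.- (p ℚ.- q)    ≡⟨ solve 2 (λ p q → :- (p :- q) := q :- p) refl p q ⟩
      q ℚ.- p          ≤⟨ ℚ.+-mono-≤ q≤u (ℚ.neg-antimono-≤ a≤p) ⟩
      a ℚ.+ h ℚ.- a    ≡⟨ solve 2 (λ a h → a :+ h :- a := h) refl a h ⟩
      h                ∎
    where open ℚ.≤-Reasoning
          open +-*-Solver

  2^n-1 : ℕ → ℕ
  2^n-1 zero = 0
  2^n-1 (suc n) = suc (2^n-1 n ℕ.+ 2^n-1 n)

  toℚᵘ-2⁻ : ∀ n → ℚ.toℚᵘ (2⁻ n) ℚᵘ.≃ ℚᵘ.mkℚᵘ (+ 1) (2^n-1 n)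
  toℚᵘ-2⁻ zero = ℚᵘ.≃-refl
  toℚᵘ-2⁻ (suc n) = ℚᵘ.≃-trans (ℚ.toℚᵘ-homo-* ½ (2⁻ n)) (ℚᵘ.≃-trans (ℚᵘ.*-congˡ {ℚ.toℚᵘ ½} (toℚᵘ-2⁻ n))
    (ℚᵘ.≃-reflexive (cong (ℚᵘ.mkℚᵘ (+ 1)) (cong ℕ.pred (trans (cong (suc (2^n-1 n) ℕ.+_) (ℕ.+-identityʳ _)) (cong suc (ℕ.+-suc (2^n-1 n) (2^n-1 n))))))))

  n≤2^n-1 : ∀ n → n ℕ.≤ 2^n-1 n
  n≤2^n-1 zero    = ℕ.z≤n
  n≤2^n-1 (suc n) = ℕ.s≤s (ℕ.≤-trans (n≤2^n-1 n) (ℕ.m≤m+n (2^n-1 n) (2^n-1 n)))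

  archimedean : ∀ ε → .{{Positive ε}} → ∃ λ N → ∀ n → N ℕ.≤ n → 2⁻ n ℚ.≤ ε
  archimedean ε@(mkℚ +[1+ a ] d _) = d , λ n d≤n →
    ℚ.toℚᵘ-cancel-≤ (ℚᵘ.≤-trans (ℚᵘ.≤-reflexive (toℚᵘ-2⁻ n)) (ℚᵘ.*≤* (ℤ.+≤+
      (ℕ.*-mono-≤ {1} {suc a} {suc d} {suc (2^n-1 n)} (ℕ.s≤s ℕ.z≤n) (ℕ.s≤s (ℕ.≤-trans d≤n (n≤2^n-1 n)))))))

√½ : ℝ
√½ .seq = bisect
√½ .cauchy ε with archimedean ε
... | N , small = N , λ m n N≤m N≤n → ℚ.≤-trans
      (∣p-q∣≤ (proj₁ (bisect-mono N≤m)) (ℚ.≤-trans (p≤p+2⁻ (bisect m) m) (proj₂ (bisect-mono N≤m)))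
              (proj₁ (bisect-mono N≤n)) (ℚ.≤-trans (p≤p+2⁻ (bisect n) n) (proj₂ (bisect-mono N≤n))))
      (small N ℕ.≤-refl)

√½²≈½ : √½ *ℝ √½ ≈ℝ fromℚ ½
√½²≈½ = below , above
  where
  open ℚ.≤-Reasoning
  open +-*-Solver

  below : √½ *ℝ √½ ≤ℝ fromℚ ½
  below ε = 0 , λ n _ → begin
    bisect n ℚ.* bisect n ≤⟨ bisect²≤½ n ⟩
    ½                     ≤⟨ ℚ.+-monoʳ-≤ ½ (ℚ.<⇒≤ (ℚ.positive⁻¹ ε)) ⟩
    ½ ℚ.+ ε               ∎

  above′ : ∀ ε n → 2⁻ n ℚ.≤ ½ ℚ.* ε → ½ ℚ.≤ bisect n ℚ.* bisect n ℚ.+ ε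
  above′ ε n h≤ε/2 = begin
    ½                              ≤⟨ ½≤upper² n ⟩
    u ℚ.* u                        ≡⟨ solve 2 (λ a h → (a :+ h) :* (a :+ h) := a :* a :+ (h :* a :+ h :* (a :+ h))) refl a h ⟩
    a ℚ.* a ℚ.+ (h ℚ.* a ℚ.+ h ℚ.* u)
      ≤⟨ ℚ.+-monoʳ-≤ (a ℚ.* a) (ℚ.+-mono-≤ (h*p≤ε/2 (ℚ.≤-trans (p≤p+2⁻ a n) u≤1)) (h*p≤ε/2 u≤1)) ⟩
    a ℚ.* a ℚ.+ (½ ℚ.* ε ℚ.+ ½ ℚ.* ε)
      ≡⟨ cong (a ℚ.* a ℚ.+_) (halves ε) ⟩
    a ℚ.* a ℚ.+ ε                  ∎
    where
    a = bisect n
    h = 2⁻ n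
    u = upper n
    u≤1 : u ℚ.≤ 1ℚ
    u≤1 = proj₂ (bisect-mono {0} {n} ℕ.z≤n)
    h*p≤ε/2 : ∀ {p} → p ℚ.≤ 1ℚ → h ℚ.* p ℚ.≤ ½ ℚ.* ε
    h*p≤ε/2 {p} p≤1 = begin
      h ℚ.* p   ≤⟨ ℚ.*-monoˡ-≤-nonNeg h {{ℚ.nonNegative (ℚ.<⇒≤ (0<2⁻ n))}} p≤1 ⟩
      h ℚ.* 1ℚ  ≡⟨ ℚ.*-identityʳ h ⟩
      h         ≤⟨ h≤ε/2 ⟩
      ½ ℚ.* ε   ∎

  above : fromℚ ½ ≤ℝ √½ *ℝ √½
  above ε with archimedean (½ ℚ.* ε) {{*-pos ½ ε}}
  ... | N , small = N , λ n N≤n → above′ ε n (small n N≤n)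

------------------------------------------------------------------------
-- Complex numbers and n-qubit states

record ℂ : Set where
  constructor _+i_
  field
    re im : ℝ

open ℂ

infixl 6 _+ℂ_
infixl 7 _*ℂ_

0ℂ 1ℂ -1ℂ : ℂ
0ℂ  = fromℚ 0ℚ +i fromℚ 0ℚ
1ℂ  = fromℚ 1ℚ +i fromℚ 0ℚ
-1ℂ = fromℚ (ℚ.- 1ℚ) +i fromℚ 0ℚ

_+ℂ_ _*ℂ_ : ℂ → ℂ → ℂ
(a +i b) +ℂ (c +i d) = (a +ℝ c) +i (b +ℝ d)
(a +i b) *ℂ (c +i d) = (a *ℝ c +ℝ -ℝ (b *ℝ d)) +i (a *ℝ d +ℝ b *ℝ c)

conj : ℂ → ℂ
conj (a +i b) = a +i (-ℝ b)

1/√2 e^iπ/4 : ℂ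
1/√2   = √½ +i fromℚ 0ℚ
e^iπ/4 = √½ +i √½

-- Amplitudes in the computational basis; the i-th entry of the index is
-- the i-th qubit.
State : ℕ → Set
State n = Vec Bool n → ℂ

sumBits : ∀ n → (Vec Bool n → ℂ) → ℂ
sumBits zero    f = f []
sumBits (suc n) f = sumBits n (f ∘ (false ∷_)) +ℂ sumBits n (f ∘ (true ∷_))

⟨_∣_⟩ : ∀ {n} → State n → State n → ℂ
⟨_∣_⟩ {n} φ ψ = sumBits n λ b → conj (φ b) *ℂ ψ b

-- ⟨ψ|ψ⟩ is always real, so only its real part is constrained.
IsUnit : ∀ {n} → State n → Set
IsUnit ψ = re ⟨ ψ ∣ ψ ⟩ ≈ℝ fromℚ 1ℚ

∣0^_⟩ : ∀ n → State n
∣0^ zero  ⟩ []          = 1ℂ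
∣0^ suc n ⟩ (false ∷ b) = ∣0^ n ⟩ b
∣0^ suc n ⟩ (true  ∷ b) = 0ℂ

infixr 7 _⊗_

_⊗_ : ∀ {m n} → State m → State n → State (m ℕ.+ n)
_⊗_ {m} φ ψ b = φ (Vec.take m b) *ℂ ψ (Vec.drop m b)

------------------------------------------------------------------------
-- Quantum circuits

data Gate (n : ℕ) : Set where
  H T  : Fin n → Gate n
  CNOT : (control target : Fin n) → control ≢ target → Gate n

record Circuit (n : ℕ) : Set where
  constructor circuit
  field
    output : Fin n
    gates  : List (Gate n)    -- in order of application

Matrix₂ : Set
Matrix₂ = Bool → Bool → ℂ

hadamard tGate : Matrix₂
hadamard true  true  = -1ℂ *ℂ 1/√2
hadamard _     _     = 1/√2
tGate    false false = 1ℂ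
tGate    true  true  = e^iπ/4
tGate    _     _     = 0ℂ

onQubit : ∀ {n} → Matrix₂ → Fin n → State n → State n
onQubit G i ψ b = G (lookup b i) false *ℂ ψ (b [ i ]≔ false)
               +ℂ G (lookup b i) true  *ℂ ψ (b [ i ]≔ true)

applyGate : ∀ {n} → State n → Gate n → State n
applyGate ψ (H i)        = onQubit hadamard i ψ
applyGate ψ (T i)        = onQubit tGate i ψ
applyGate ψ (CNOT c t _) = λ b → ψ (b [ t ]%= (lookup b c xor_))

applyCircuit : ∀ {n} → Circuit n → State n → State n
applyCircuit U ψ = List.foldl applyGate ψ (Circuit.gates U)

Π-acc : ∀ {n} → Circuit n → State n → State n
Π-acc U ψ b = if lookup b (Circuit.output U) then ψ b else 0ℂ

-- ⟨ψ| U† Π_acc U |ψ⟩ = ⟨Uψ| Π_acc |Uψ⟩, which is always real.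
acceptance : ∀ {n} → Circuit n → State n → ℝ
acceptance U ψ = re ⟨ applyCircuit U ψ ∣ Π-acc U (applyCircuit U ψ) ⟩

------------------------------------------------------------------------
-- Strings

Str : Set
Str = List Bool

-- A sequence of numbers is encoded by writing each number n as 1ⁿ0.
encodeℕs : List ℕ → Str
encodeℕs = concatMap λ n → replicate n true ++ false ∷ []

decodeℕs : Str → Maybe (List ℕ)
decodeℕs = go 0
  where
  go : ℕ → Str → Maybe (List ℕ)
  go zero    []          = just []
  go (suc _) []          = nothing
  go n       (true  ∷ w) = go (suc n) w
  go n       (false ∷ w) = Maybe.map (n ∷_) (go 0 w)

binary : ℕ → Str
binary n = map (ℕ._≡ᵇ 1) (toNatDigits 2 n)

------------------------------------------------------------------------
-- Encodings of circuits
--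
-- As a sequence of numbers a circuit is its output qubit followed by its
-- gates: 0 i for H, 1 i for T, 2 c t for CNOT.  In front of this stands
-- the number k of qubits, respectively the numbers m and k of witness and
-- ancilla qubits.  Everything is unary, so the encoding of a circuit is
-- at least as long as its numbers of qubits and gates.

parseQubit : ∀ n → ℕ → Maybe (Fin n)
parseQubit n i with i ℕ.<? n
... | yes i<n = just (fromℕ< i<n)
... | no  _   = nothing

mkCNOT : ∀ {n} → Fin n → Fin n → Maybe (Gate n)
mkCNOT c t with c Fin.≟ t
... | yes _   = nothing
... | no  c≢t = just (CNOT c t c≢t)

parseGates : ∀ n → List ℕ → Maybe (List (Gate n))
parseGates n []                = just []
parseGates n (0 ∷ i ∷ ts)      = Maybe.zipWith _∷_ (Maybe.map H (parseQubit n i)) (parseGates n ts)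
parseGates n (1 ∷ i ∷ ts)      = Maybe.zipWith _∷_ (Maybe.map T (parseQubit n i)) (parseGates n ts)
parseGates n (2 ∷ c ∷ t ∷ ts)  = Maybe.zipWith _∷_
  (parseQubit n c Maybe.>>= λ c′ → parseQubit n t Maybe.>>= mkCNOT c′) (parseGates n ts)
parseGates n _                 = nothing

parseCircuit : ∀ n → List ℕ → Maybe (Circuit n)
parseCircuit n []       = nothing
parseCircuit n (o ∷ ts) = Maybe.zipWith circuit (parseQubit n o) (parseGates n ts)

record BQPCircuit : Set where
  constructor bqpCircuit
  field
    {k} : ℕ
    U   : Circuit k

record QMACircuit : Set where
  constructor qmaCircuit
  field
    m k : ℕ
    U   : Circuit (m ℕ.+ k)

parseBQP : List ℕ → Maybe BQPCircuit
parseBQP (k ∷ ts) = Maybe.map bqpCircuit (parseCircuit k ts)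
parseBQP _        = nothing

parseQMA : List ℕ → Maybe QMACircuit
parseQMA (m ∷ k ∷ ts) = Maybe.map (qmaCircuit m k) (parseCircuit (m ℕ.+ k) ts)
parseQMA _            = nothing

decodeBQP : Str → Maybe BQPCircuit
decodeBQP w = decodeℕs w Maybe.>>= parseBQP

decodeQMA : Str → Maybe QMACircuit
decodeQMA w = decodeℕs w Maybe.>>= parseQMA

------------------------------------------------------------------------
-- Deterministic Turing machines

data Move : Set where
  left stay right : Move

record Tape (A : Set) : Set where
  constructor tape
  field
    before : List A    -- nearest cell first
    here   : A
    after  : List A

-- Tapes are infinite in both directions; cells that are not stored are blank.
moveTape : ∀ {A} → A → Move → Tape A → Tape A
moveTape blank left  (tape []       a rs)       = tape [] blank (a ∷ rs)
moveTape blank left  (tape (l ∷ ls) a rs)       = tape ls l (a ∷ rs)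
moveTape blank stay  t                          = t
moveTape blank right (tape ls       a [])       = tape (a ∷ ls) blank []
moveTape blank right (tape ls       a (r ∷ rs)) = tape (a ∷ ls) r rs

-- At least one tape, at least one state, and at least the three tape
-- symbols blank, 0 and 1, in this order.
record DTM : Set where
  field
    extraTapes extraSymbols extraStates : ℕ

  tapes  = suc extraTapes
  Symbol = Fin (3 ℕ.+ extraSymbols)
  States = Fin (suc extraStates)

  field
    δ     : States → Vec Symbol tapes → States × Vec (Symbol × Move) tapes
    final : States → Bool

  blank : Symbol
  blank = zero

  bit : Bool → Symbol
  bit false = suc zero
  bit true  = suc (suc zero)

  bit⁻¹ : Symbol → Maybe Bool
  bit⁻¹ (suc zero)       = just false
  bit⁻¹ (suc (suc zero)) = just true
  bit⁻¹ _                = nothing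

  Config : Set
  Config = States × Vec (Tape Symbol) tapes

  start : Str → Config
  start x = zero , inputTape x ∷ Vec.replicate extraTapes (tape [] blank [])
    where
    inputTape : Str → Tape Symbol
    inputTape []      = tape [] blank []
    inputTape (b ∷ x) = tape [] (bit b) (map bit x)

  step : Config → Config
  step (q , ts) = if final q then (q , ts) else
    (let q′ , actions = δ q (Vec.map Tape.here ts)
     in  q′ , Vec.zipWith act actions ts)
    where
    act : Symbol × Move → Tape Symbol → Tape Symbol
    act (s , d) (tape ls _ rs) = moveTape blank d (tape ls s rs)

  run : ℕ → Config → Config
  run zero    c = c
  run (suc n) c = run n (step c)

  halted : Config → Bool
  halted (q , _) = final q

  -- The string of bits on the first tape that starts under the head.
  outputOf : Config → Str
  outputOf (_ , tape _ a rs ∷ _) = bits (a ∷ rs)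
    where
    bits : List Symbol → Str
    bits []       = []
    bits (s ∷ ss) with bit⁻¹ s
    ... | just b  = b ∷ bits ss
    ... | nothing = []

Outputs : DTM → Str → Str → Set
Outputs M x y = ∃ λ t → halted (run t (start x)) ≡ true × outputOf (run t (start x)) ≡ y
  where open DTM M

-- A polynomial is the list of its coefficients, constant term first.
Polynomial : Set
Polynomial = List ℕ

eval : Polynomial → ℕ → ℕ
eval []       n = 0
eval (a ∷ as) n = a ℕ.+ n ℕ.* eval as n

PolynomialRuntime : DTM → Set
PolynomialRuntime M = ∃ λ p → ∀ x → halted (run (eval p (length x)) (start x)) ≡ true
  where open DTM M

result : (M : DTM) → PolynomialRuntime M → Str → Str
result M (p , _) x = outputOf (run (eval p (length x)) (start x))
  where open DTM M

Poly : (ℕ → ℕ) → Set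
Poly f = (∃ λ p → ∀ n → f n ℕ.≤ eval p n)
       × ∃ λ M → Σ (PolynomialRuntime M) λ h → ∀ x → result M h x ≡ binary (f (length x))

allVecs : ∀ n k → List (Vec (Fin n) k)
allVecs n zero    = [] ∷ []
allVecs n (suc k) = concatMap (λ a → map (a ∷_) (allVecs n k)) (List.allFin n)

-- The sizes of the machine, then for every state whether it is final and
-- the table of δ on all tuples of scanned symbols.
gödelNumber : DTM → Str
gödelNumber M = encodeℕs $
  extraTapes ∷ extraSymbols ∷ extraStates ∷ concatMap stateCode (List.allFin (suc extraStates))
  where
  open DTM M

  moveCode : Move → ℕ
  moveCode left  = 0
  moveCode stay  = 1
  moveCode right = 2

  actionCode : States × Vec (Symbol × Move) tapes → List ℕ
  actionCode (q , as) = toℕ q ∷ concatMap (λ (s , d) → toℕ s ∷ moveCode d ∷ []) (Vec.toList as)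

  stateCode : States → List ℕ
  stateCode q = (if final q then 1 else 0)
              ∷ concatMap (actionCode ∘ δ q) (allVecs (3 ℕ.+ extraSymbols) tapes)

------------------------------------------------------------------------
-- BQP, QMA and extremal problems

record PromiseProblem : Set₁ where
  field
    yesSet noSet : Pred Str 0ℓ
    disjoint     : ∀ x → x ∈ yesSet → ¬ x ∈ noSet

record BQPMachine : Set where
  field
    dtm     : DTM
    runtime : PolynomialRuntime dtm

  circuitAt : Str → Maybe BQPCircuit
  circuitAt x = decodeBQP (result dtm runtime x)

record QMAMachine : Set where
  field
    dtm     : DTM
    runtime : PolynomialRuntime dtm

  circuitAt : Str → Maybe QMACircuit
  circuitAt x = decodeQMA (result dtm runtime x)

  field
    witnessQubits totalQubits : ℕ → ℕ
    totalQubits-poly          : Poly totalQubits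
    qubits-correct            : ∀ x C → circuitAt x ≡ just C →
                                QMACircuit.m C ≡ witnessQubits (length x) ×
                                QMACircuit.m C ℕ.+ QMACircuit.k C ≡ totalQubits (length x)

IsMaximum : {I : Set} → Pred I 0ℓ → (I → ℝ) → ℝ → Set
IsMaximum S f r = (∃ λ i → i ∈ S × f i ≈ℝ r) × (∀ i → i ∈ S → f i ≤ℝ r)

-- v(x) is treated as a relation, since constructively the maximum over all
-- witnesses is not given by a function.  An invalid encoding (nothing) stands
-- for the never-accepting circuit.
Value : Set₁
Value = Str → ℝ → Set

valueBQP : BQPMachine → Value
valueBQP M x r with BQPMachine.circuitAt M x
... | just (bqpCircuit {k} U) = r ≈ℝ acceptance U ∣0^ k ⟩
... | nothing                 = r ≈ℝ fromℚ 0ℚ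

valueOfQMACircuit : Maybe QMACircuit → ℝ → Set
valueOfQMACircuit (just (qmaCircuit m k U)) r = IsMaximum IsUnit (λ (ψ : State m) → acceptance U (ψ ⊗ ∣0^ k ⟩)) r
valueOfQMACircuit nothing                   r = r ≈ℝ fromℚ 0ℚ

valueQMA : QMAMachine → Value
valueQMA M x = valueOfQMACircuit (QMAMachine.circuitAt M x)

Accepts Rejects : Value → Pred Str 0ℓ
Accepts v x = ∃ λ r → v x r × fromℚ (+ 2 / 3) ≤ℝ r
Rejects v x = ∃ λ r → v x r × r ≤ℝ fromℚ (+ 1 / 3)

Decides : Value → PromiseProblem → Set
Decides v A = (PromiseProblem.yesSet A ⊆ Accepts v) × (PromiseProblem.noSet A ⊆ Rejects v)

BQP QMA : Pred PromiseProblem 0ℓ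
BQP A = ∃ λ M → Decides (valueBQP M) A
QMA A = ∃ λ M → Decides (valueQMA M) A

P : QMAMachine → PromiseProblem
P M .PromiseProblem.yesSet = Accepts (valueQMA M)
P M .PromiseProblem.noSet  = Rejects (valueQMA M)
P M .PromiseProblem.disjoint x (r , vr , 2/3≤r) (s , vs , s≤1/3) =
  2/3≰1/3 (≤ℝ-trans ⅔ s ⅓ (≤ℝ-trans ⅔ r s 2/3≤r (unique (QMAMachine.circuitAt M x) vr vs)) s≤1/3)
  where
  ⅔ ⅓ : ℝ
  ⅔ = fromℚ (+ 2 / 3)
  ⅓ = fromℚ (+ 1 / 3)

  2/3≰1/3 : ¬ ⅔ ≤ℝ ⅓
  2/3≰1/3 le with le (+ 1 / 6)
  ... | N , le′ = from-no ((+ 2 / 3) ℚ.≤? (+ 1 / 3) ℚ.+ (+ 1 / 6)) (le′ N ℕ.≤-refl)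

  unique : ∀ c {r s} → valueOfQMACircuit c r → valueOfQMACircuit c s → r ≤ℝ s
  unique (just (qmaCircuit m k U)) {r} {s} ((ψ , unit , _ , r≤fψ) , _) (_ , f≤s) =
    ≤ℝ-trans r (acceptance U (ψ ⊗ ∣0^ k ⟩)) s r≤fψ (f≤s ψ unit)
  unique nothing {r} {s} (r≤0 , _) (_ , 0≤s) = ≤ℝ-trans r (fromℚ 0ℚ) s r≤0 0≤s

infix 4 _⊊_

-- Strictness with an explicit witness, which constructively is more than
-- Relation.Unary's Q ⊈ P.
_⊊_ : Pred PromiseProblem 0ℓ → Pred PromiseProblem 0ℓ → Set₁
𝒞 ⊊ 𝒟 = 𝒞 ⊆ 𝒟 × ∃ λ A → A ∈ 𝒟 × ¬ A ∈ 𝒞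

{-# OPTIONS --safe #-}
-- Let D be a machine that decides membership of P(M) in BQP, and let M₀ be a
-- QMA-machine for a problem outside BQP.  A quine M writes its own Gödel
-- number, runs D on it for as many steps as the input x has symbols, and then
-- behaves on x like M₀, unless D has already answered 0, in which case M
-- outputs an invalid circuit.  If D answers 1 on M, then M agrees with M₀
-- everywhere, so P(M) is not in BQP.  If D answers 0, then M rejects all long
-- inputs, so P(M) is a finite problem up to rejected inputs and, classically,
-- in BQP by a finite table.  The argument proves a contradiction, so the
-- classical choice of the table is harmless.
--
-- M has three groups of states: a start state, for each symbol of a string w
-- one state that writes it, and a control that does not depend on w.  The
-- string w describes the code of the control, while the codes of the writer
-- states can be computed from w.  From w the control produces the whole Gödel
-- number, from right to left.
module Submission where

open import Defs
open import Data.Bool.Base using (Bool; true; false; if_then_else_)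
open import Data.Bool.Properties using (¬-not)
open import Data.Empty using (⊥-elim)
open import Data.Fin.Base as Fin using (Fin; zero; suc; toℕ; fromℕ; fromℕ<; inject₁; inject≤; _↑ˡ_; _↑ʳ_)
import Data.Fin.Properties as Fin
open import Data.Integer.Base using (+_)
open import Data.List.Base as List using (List; []; _∷_; _++_; _ʳ++_; length; concatMap)
import Data.List.Properties as List
open import Data.List.Relation.Unary.All as All using (All; []; _∷_)
import Data.List.Relation.Unary.All.Properties as All
open import Data.Maybe.Base as Maybe using (Maybe; just; nothing; maybe′)
open import Data.Nat.Base using (ℕ; zero; suc; _+_; _*_; _∸_; _≤_; _<_; z≤n; s≤s; s≤s⁻¹)
import Data.Nat.Properties as ℕ
import Data.Nat.Solver as ℕ
open import Data.Product.Base as Product using (Σ; ∃; _×_; _,_; proj₁; proj₂)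
open import Data.Rational.Base as ℚ using (ℚ; 0ℚ; 1ℚ; ½; _/_)
import Data.Rational.Properties as ℚ
open import Data.Rational.Solver using (module +-*-Solver)
open import Data.Sum.Base as Sum using (_⊎_; inj₁; inj₂; [_,_]′)
open import Data.Vec.Base as Vec using (Vec; []; _∷_)
import Data.Vec.Properties as Vec
open import Data.Vec.Relation.Binary.Pointwise.Inductive using (Pointwise; []; _∷_)
open import Function.Base using (_∘_; flip)
open import Relation.Binary.PropositionalEquality
open import Relation.Nullary using (¬_)
open import Relation.Nullary.Decidable using (from-yes)
open import Relation.Unary using (_∈_; _∉_)

-- Turing machines

-- A Gödel number refers to states by number, and the control states are numbered after the writer
-- states. So the code of the control depends on the length of `w`, and `w` contains that code. The
-- unary encoding breaks the circle: adding |w| to a number means putting |w| ones in front of it.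
-- The text therefore has a placeholder wherever the content of a unary counter is to be inserted.
-- The same counter, run down token by token, numbers the writer states. `D` may run for long or
-- forever on its input, so it is stopped after |x| steps. This keeps `M` polynomial, and an answer
-- 0 given at time t is seen on every input of length at least t. The time spent on
-- self-reproduction is a constant, because none of it depends on x. `M` outputs either what `M₀`
-- outputs or an invalid code, so it inherits the qubit numbers of `M₀`. The finite table needs one
-- circuit that accepts with probability at least 2/3. Since the square root of 1/2 exists only as a
-- Cauchy sequence, acceptance is estimated on its rational approximants.

act : ∀ {n} → Fin (suc n) × Move → Tape (Fin (suc n)) → Tape (Fin (suc n))
act (s , d) (tape ls _ rs) = moveTape zero d (tape ls s rs)

module Run (M : DTM) where
  open DTM M

  -- `act` is a global copy of the action function local to `step`; once the finality test is
  -- resolved, both sides agree by computation.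
  step-δ : ∀ q ts → final q ≡ false → let q′ , as = δ q (Vec.map Tape.here ts) in
           step (q , ts) ≡ (q′ , Vec.zipWith act as ts)
  step-δ q ts q-working rewrite q-working = refl

  step-final : ∀ c → halted c ≡ true → step c ≡ c
  step-final (q , ts) q-final rewrite q-final = refl

  run-+ : ∀ m n c → run (m + n) c ≡ run n (run m c)
  run-+ zero    n c = refl
  run-+ (suc m) n c = run-+ m n (step c)

  run-final : ∀ n c → halted c ≡ true → run n c ≡ c
  run-final zero    c h = refl
  run-final (suc n) c h = trans (cong (run n) (step-final c h)) (run-final n c h)

  run-halted : ∀ {m n} c → m ≤ n → halted (run m c) ≡ true → run n c ≡ run m c
  run-halted {m} {n} c m≤n h = begin
    run n c                 ≡⟨ cong (λ k → run k c) (ℕ.m+[n∸m]≡n m≤n) ⟨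
    run (m + (n ∸ m)) c     ≡⟨ run-+ m (n ∸ m) c ⟩
    run (n ∸ m) (run m c)   ≡⟨ run-final (n ∸ m) (run m c) h ⟩
    run m c                 ∎
    where open ≡-Reasoning

  -- A halted configuration is a fixed point of `step`, so the earlier halting time already
  -- determines the later configuration.
  halted-unique : ∀ m n c → halted (run m c) ≡ true → halted (run n c) ≡ true → run m c ≡ run n c
  halted-unique m n c hm hn with ℕ.≤-total m n
  ... | inj₁ m≤n = sym (run-halted c m≤n hm)
  ... | inj₂ n≤m = run-halted c n≤m hn

  readBits : List Symbol → Str
  readBits []       = []
  readBits (s ∷ ss) = maybe′ (λ b → b ∷ readBits ss) [] (bit⁻¹ s)

  -- outputOf reads the tape with a local function whose parameters change in
  -- the recursive calls below; they are unused there, so conversion ignores them.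
  outputOf-readBits : ∀ q ls a rs ts → outputOf (q , tape ls a rs ∷ ts) ≡ readBits (a ∷ rs)
  outputOf-readBits q ls zero                rs       ts = refl
  outputOf-readBits q ls (suc zero)          []       ts = refl
  outputOf-readBits q ls (suc zero)          (r ∷ rs) ts = cong (false ∷_) (outputOf-readBits q ls r rs ts)
  outputOf-readBits q ls (suc (suc zero))    []       ts = refl
  outputOf-readBits q ls (suc (suc zero))    (r ∷ rs) ts = cong (true ∷_) (outputOf-readBits q ls r rs ts)
  outputOf-readBits q ls (suc (suc (suc _))) rs       ts = refl

infixl 6 _+ᵖ_

_+ᵖ_ : Polynomial → Polynomial → Polynomial
[]       +ᵖ q        = q
(a ∷ p)  +ᵖ []       = a ∷ p
(a ∷ p)  +ᵖ (b ∷ q)  = a + b ∷ p +ᵖ q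

eval-+ᵖ : ∀ p q n → eval (p +ᵖ q) n ≡ eval p n + eval q n
eval-+ᵖ []      q       n = refl
eval-+ᵖ (a ∷ p) []      n = sym (ℕ.+-identityʳ _)
eval-+ᵖ (a ∷ p) (b ∷ q) n rewrite eval-+ᵖ p q n =
  solve 5 (λ a b n x y → a :+ b :+ n :* (x :+ y) := a :+ n :* x :+ (b :+ n :* y)) refl a b n (eval p n) (eval q n)
  where
  open ℕ.+-*-Solver

-- A retraction of `inject≤` that clamps larger values to the last one. With it the δ of a simulated
-- machine can be applied to whatever symbols the host scans.
restrict : ∀ {m n} → Fin n → Fin (suc m)
restrict         zero    = zero
restrict {zero}  (suc i) = zero
restrict {suc m} (suc i) = suc (restrict i)

restrict-inject≤ : ∀ {m n} (i : Fin (suc m)) (m≤n : suc m ≤ n) → restrict (inject≤ i m≤n) ≡ i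
restrict-inject≤         {n = suc _}       zero    _   = refl
restrict-inject≤ {suc m} {n = suc (suc _)} (suc i) m≤n = cong suc (restrict-inject≤ i (s≤s⁻¹ m≤n))
restrict-inject≤ {suc m} {n = suc zero}    (suc i) (s≤s ())

-- A tape over the larger alphabet simulates one over the smaller alphabet if
-- they agree up to trailing blanks on the larger one.
module Simulation {s s′ : ℕ} (s≤s′ : s ≤ s′) where

  private
    inner outer : Set
    inner = Fin (3 + s)
    outer = Fin (3 + s′)

  embed : inner → outer
  embed i = inject≤ i (ℕ.+-monoʳ-≤ 3 s≤s′)

  infix 4 _∼_ _≈ₜ_ _≈ₜₛ_

  -- Asymmetric, because the host visits cells beyond the ends of the simulated tape, for instance
  -- the blank beside the input when it rewinds; such cells are stored on the outer side only.
  data _∼_ : List outer → List inner → Set where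
    []      : [] ∼ []
    blank∷_ : ∀ {xs} → xs ∼ [] → zero ∷ xs ∼ []
    _∷_     : ∀ x {xs ys} → xs ∼ ys → embed x ∷ xs ∼ x ∷ ys

  data _≈ₜ_ : Tape outer → Tape inner → Set where
    tape : ∀ {ls ls′ rs rs′} → ls ∼ ls′ → ∀ a → rs ∼ rs′ → tape ls (embed a) rs ≈ₜ tape ls′ a rs′

  _≈ₜₛ_ : ∀ {n} → Vec (Tape outer) n → Vec (Tape inner) n → Set
  _≈ₜₛ_ = Pointwise _≈ₜ_

  moveTape-≈ : ∀ d {t t′} → t ≈ₜ t′ → moveTape zero d t ≈ₜ moveTape zero d t′
  moveTape-≈ left  (tape []         a r)           = tape [] zero (a ∷ r)
  moveTape-≈ left  (tape (blank∷ l) a r)           = tape l zero (a ∷ r)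
  moveTape-≈ left  (tape (x ∷ l)    a r)           = tape l x (a ∷ r)
  moveTape-≈ stay  t≈t′                            = t≈t′
  moveTape-≈ right (tape l          a [])          = tape (a ∷ l) zero []
  moveTape-≈ right (tape l          a (blank∷ r))  = tape (a ∷ l) zero r
  moveTape-≈ right (tape l          a (x ∷ r))     = tape (a ∷ l) x r

  embedAction : inner × Move → outer × Move
  embedAction (a , d) = embed a , d

  act-≈ : ∀ a {t t′} → t ≈ₜ t′ → act (embedAction a) t ≈ₜ act a t′
  act-≈ (a , d) (tape l _ r) = moveTape-≈ d (tape l a r)

  acts-≈ : ∀ {n} as {ts : Vec (Tape outer) n} {ts′ : Vec (Tape inner) n} → ts ≈ₜₛ ts′ →
           Vec.zipWith act (Vec.map embedAction as) ts ≈ₜₛ Vec.zipWith act as ts′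
  acts-≈ []       []            = []
  acts-≈ (a ∷ as) (t≈t′ ∷ ts≈) = act-≈ a t≈t′ ∷ acts-≈ as ts≈

  scanned : ∀ {n} {ts : Vec (Tape outer) n} {ts′ : Vec (Tape inner) n} → ts ≈ₜₛ ts′ →
            Vec.map restrict (Vec.map Tape.here ts) ≡ Vec.map Tape.here ts′
  scanned []                  = refl
  scanned (tape _ a _ ∷ ts≈) = cong₂ _∷_ (restrict-inject≤ a (ℕ.+-monoʳ-≤ 3 s≤s′)) (scanned ts≈)

  blanks-≈ : ∀ n → Vec.replicate n (tape [] zero []) ≈ₜₛ Vec.replicate n (tape [] zero [])
  blanks-≈ zero    = []
  blanks-≈ (suc n) = tape [] zero [] ∷ blanks-≈ n

-- A numbering of a datatype of control states. Transitions can then be defined by pattern matching,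
-- while the states of the machine form an initial segment of the numbers.
record Finite (A : Set) : Set where
  field
    size            : ℕ
    index           : A → Fin size
    fromIndex       : Fin size → A
    fromIndex-index : ∀ a → fromIndex (index a) ≡ a

open Finite

finite-Fin : ∀ n → Finite (Fin n)
finite-Fin n = record { size = n ; index = λ i → i ; fromIndex = λ i → i ; fromIndex-index = λ _ → refl }

finite-⊎ : ∀ {A B} → Finite A → Finite B → Finite (A ⊎ B)
finite-⊎ FA FB .size = size FA + size FB
finite-⊎ FA FB .index = Fin.join (size FA) (size FB) ∘ Sum.map (index FA) (index FB)
finite-⊎ FA FB .fromIndex = Sum.map (fromIndex FA) (fromIndex FB) ∘ Fin.splitAt (size FA)
finite-⊎ FA FB .fromIndex-index a rewrite Fin.splitAt-join (size FA) (size FB) (Sum.map (index FA) (index FB) a) with a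
... | inj₁ a′ = cong inj₁ (fromIndex-index FA a′)
... | inj₂ b′ = cong inj₂ (fromIndex-index FB b′)

finite-× : ∀ {A B} → Finite A → Finite B → Finite (A × B)
finite-× FA FB .size = size FA * size FB
finite-× FA FB .index (a , b) = Fin.combine (index FA a) (index FB b)
finite-× FA FB .fromIndex = Product.map (fromIndex FA) (fromIndex FB) ∘ Fin.remQuot (size FB)
finite-× FA FB .fromIndex-index (a , b) = trans
  (cong (Product.map (fromIndex FA) (fromIndex FB)) (Fin.remQuot-combine (index FA a) (index FB b)))
  (cong₂ _,_ (fromIndex-index FA a) (fromIndex-index FB b))

finite-Maybe : ∀ {A} → Finite A → Finite (Maybe A)
finite-Maybe FA .size = suc (size FA)
finite-Maybe FA .index nothing = zero
finite-Maybe FA .index (just a) = suc (index FA a)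
finite-Maybe FA .fromIndex zero = nothing
finite-Maybe FA .fromIndex (suc i) = just (fromIndex FA i)
finite-Maybe FA .fromIndex-index nothing = refl
finite-Maybe FA .fromIndex-index (just a) = cong just (fromIndex-index FA a)

-- The diagonal machine

upperBound : ∀ {n} → (Fin n → ℕ) → ℕ
upperBound {zero}  f = 0
upperBound {suc n} f = f zero + upperBound (f ∘ suc)

≤-upperBound : ∀ {n} (f : Fin n → ℕ) i → f i ≤ upperBound f
≤-upperBound f zero    = ℕ.m≤m+n _ _
≤-upperBound f (suc i) = ℕ.≤-trans (≤-upperBound (f ∘ suc) i) (ℕ.m≤n+m _ (f zero))

-- The successor may leave the block of writer states: after the last one comes the control state
-- with index 0, which is `entry`.
next : ∀ {m n} → Fin m → Fin (m + suc n)
next {suc zero}    zero    = suc zero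
next {suc (suc m)} zero    = suc zero
next               (suc i) = suc (next i)

toℕ-next : ∀ {m n} (i : Fin m) → toℕ (next {m} {n} i) ≡ suc (toℕ i)
toℕ-next {suc zero}    zero    = refl
toℕ-next {suc (suc m)} zero    = refl
toℕ-next               (suc i) = cong suc (toℕ-next i)

-- The first writer state, or `entry` if there are no writer states.
first : ∀ m {n} → Fin (m + suc n)
first zero    = zero
first (suc m) = zero

toℕ-first : ∀ m {n} → toℕ (first m {n}) ≡ 0
toℕ-first zero    = refl
toℕ-first (suc m) = refl

cut : ∀ {A : Set} m {n} → Vec A (m + n) → Vec A m × Vec A n
cut zero    v       = [] , v
cut (suc m) (x ∷ v) = Product.map₁ (x ∷_) (cut m v)

cut-++ : ∀ {A : Set} {m n} (xs : Vec A m) (ys : Vec A n) → cut m (xs Vec.++ ys) ≡ (xs , ys)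
cut-++ []       ys = refl
cut-++ (x ∷ xs) ys = cong (Product.map₁ (x ∷_)) (cut-++ xs ys)

-- Global counterpart of the encoding local to `gödelNumber`; `gödelNumber≡` identifies the two.
moveCode : Move → ℕ
moveCode left  = 0
moveCode stay  = 1
moveCode right = 2

actionsCode : ∀ {s n} → Vec (Fin s × Move) n → List ℕ
actionsCode as = concatMap (λ (s , d) → toℕ s ∷ moveCode d ∷ []) (Vec.toList as)

keep : ∀ {n} → Fin n → Fin n × Move
keep a = a , stay

-- Symbols are ordered blank, 0, 1, so the bit 0 is `suc zero`.
isZero : ∀ {n} → Fin n → Bool
isZero (suc zero) = true
isZero _          = false

-- The symbols of the string w.  In the Gödel number, a bit stands for itself,
-- count for as many ones as the unary counter C holds, split for the codes of
-- the writer states, and total for as many ones as w has symbols.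
Token : Set
Token = Fin 5

pattern lit0  = zero
pattern lit1  = suc zero
pattern count = suc (suc zero)
pattern split = suc (suc (suc zero))
pattern total = suc (suc (suc (suc zero)))

literal : Bool → Token
literal false = lit0
literal true  = lit1

module Diagonal (D M₀ : DTM) where

  module D  = DTM D
  module M₀ = DTM M₀

  -- The three new symbols are for `count`, `split` and `total`; the tokens `lit0` and `lit1` are
  -- the bits themselves. The sum leaves room for either simulated alphabet as an initial segment.
  extraSymbols : ℕ
  extraSymbols = 3 + (D.extraSymbols + M₀.extraSymbols)

  Symbol : Set
  Symbol = Fin (3 + extraSymbols)

  extraTapes : ℕ
  extraTapes = M₀.extraTapes + suc (D.extraTapes + 3)

  module SimD = Simulation {D.extraSymbols} {extraSymbols}
    (ℕ.≤-trans (ℕ.m≤m+n D.extraSymbols M₀.extraSymbols) (ℕ.m≤n+m _ 3))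
  module Sim₀ = Simulation {M₀.extraSymbols} {extraSymbols}
    (ℕ.≤-trans (ℕ.m≤n+m M₀.extraSymbols D.extraSymbols) (ℕ.m≤n+m _ 3))

  blank one : Symbol
  blank = zero
  one   = suc (suc zero)

  symbol : Token → Symbol
  symbol t = inject≤ {6} (suc t) (ℕ.m≤m+n 6 _)

  -- The tapes of M₀, which include the input tape, the tapes of D, two copies
  -- W and W′ of w, and a counter C.
  record Frame (A : Set) : Set where
    constructor frame
    field
      input  : A
      rest₀  : Vec A M₀.extraTapes
      inputᴰ : A
      restᴰ  : Vec A D.extraTapes
      W W′ C : A

  open Frame public

  flat : ∀ {A} → Frame A → Vec A (suc extraTapes)
  flat (frame i r d rᴰ w w′ c) = i ∷ r Vec.++ d ∷ rᴰ Vec.++ w ∷ w′ ∷ c ∷ []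

  unflat : ∀ {A} → Vec A (suc extraTapes) → Frame A
  unflat (i ∷ v) with cut M₀.extraTapes v
  ... | r , d ∷ v′ with cut D.extraTapes v′
  ... | rᴰ , w ∷ w′ ∷ c ∷ [] = frame i r d rᴰ w w′ c

  unflat-flat : ∀ {A} (F : Frame A) → unflat (flat F) ≡ F
  unflat-flat (frame i r d rᴰ w w′ c)
    rewrite cut-++ r (d ∷ rᴰ Vec.++ w ∷ w′ ∷ c ∷ []) | cut-++ rᴰ (w ∷ w′ ∷ c ∷ []) = refl

  mapF : ∀ {A B} → (A → B) → Frame A → Frame B
  mapF f (frame i r d rᴰ w w′ c) = frame (f i) (Vec.map f r) (f d) (Vec.map f rᴰ) (f w) (f w′) (f c)

  actF : Frame (Symbol × Move) → Frame (Tape Symbol) → Frame (Tape Symbol)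
  actF (frame a as aᴰ asᴰ b b′ e) (frame i r d rᴰ w w′ c) =
    frame (act a i) (Vec.zipWith act as r) (act aᴰ d) (Vec.zipWith act asᴰ rᴰ) (act b w) (act b′ w′) (act e c)

  map-flat : ∀ {A B} (f : A → B) F → Vec.map f (flat F) ≡ flat (mapF f F)
  map-flat f (frame i r d rᴰ w w′ c) = cong (f i ∷_)
    (trans (Vec.map-++ f r _) (cong (λ v → Vec.map f r Vec.++ f d ∷ v) (Vec.map-++ f rᴰ _)))

  act-flat : ∀ as F → Vec.zipWith act (flat as) (flat F) ≡ flat (actF as F)
  act-flat (frame a as aᴰ asᴰ b b′ e) (frame i r d rᴰ w w′ c) = cong (act a i ∷_)
    (trans (Vec.zipWith-++ act as _ r _)
           (cong (λ v → Vec.zipWith act as r Vec.++ act aᴰ d ∷ v) (Vec.zipWith-++ act asᴰ _ rᴰ _)))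

  idle : Frame Symbol → Frame (Symbol × Move)
  idle = mapF keep

  keep-act : ∀ {n} (ts : Vec (Tape Symbol) n) → Vec.zipWith act (Vec.map keep (Vec.map Tape.here ts)) ts ≡ ts
  keep-act []       = refl
  keep-act (t ∷ ts) = cong (t ∷_) (keep-act ts)

  -- A writer state is reached only when every head scans a blank, so it may
  -- act in the same way on all scanned symbols; this makes its code regular.
  writeToken : Token → Frame (Symbol × Move)
  writeToken t = frame (keep blank) (Vec.replicate _ (keep blank)) (keep blank) (Vec.replicate _ (keep blank))
                       (symbol t , right) (symbol t , right) (one , right)

  opaque
    -- Here count stands for the number of preceding writer states.
    writerCode : Token → List Token
    writerCode t = lit0 ∷ concatMap
      (λ (_ : Vec Symbol (suc extraTapes)) →
         count ∷ lit1 ∷ lit1 ∷ lit0 ∷ List.map literal (encodeℕs (actionsCode (flat (writeToken t)))))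
      (allVecs _ _)

  opaque
    maxLength : ℕ
    maxLength = upperBound (length ∘ writerCode)

    length≤maxLength : ∀ t → length (writerCode t) ≤ maxLength
    length≤maxLength = ≤-upperBound (length ∘ writerCode)

  nth : List Token → ℕ → Token
  nth []       _       = lit0
  nth (t ∷ ts) zero    = t
  nth (t ∷ ts) (suc i) = nth ts i

  -- The number of tokens of a writer code that remain to be emitted, counted down because emission
  -- goes from right to left. The uniform bound `maxLength` makes positions a finite set.
  Position : Set
  Position = Token × Fin (suc maxLength)

  endOf : Token → Position
  endOf t = t , fromℕ< (s≤s (length≤maxLength t))

  Control : Set
  Control = Fin 6 ⊎ (Token ⊎ (Position ⊎ (Maybe Position ⊎ (Maybe Position ⊎ (D.States ⊎ M₀.States)))))

  -- scan copies W to the tape of D from right to left, expand does so with the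
  -- writer codes of the tokens of W′, and measure writes a one per token of W′.
  pattern entry     = inj₁ zero
  pattern scan      = inj₁ (suc zero)
  pattern measure   = inj₁ (suc (suc zero))
  pattern expand    = inj₁ (suc (suc (suc zero)))
  pattern rewind    = inj₁ (suc (suc (suc (suc zero))))
  pattern dead      = inj₁ (suc (suc (suc (suc (suc zero)))))
  pattern pop t     = inj₂ (inj₁ t)
  pattern emit p    = inj₂ (inj₂ (inj₁ p))
  pattern sweep← r  = inj₂ (inj₂ (inj₂ (inj₁ r)))
  pattern sweep→ r  = inj₂ (inj₂ (inj₂ (inj₂ (inj₁ r))))
  pattern simD q    = inj₂ (inj₂ (inj₂ (inj₂ (inj₂ (inj₁ q)))))
  pattern sim₀ q    = inj₂ (inj₂ (inj₂ (inj₂ (inj₂ (inj₂ q)))))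

  finite-Position : Finite Position
  finite-Position = finite-× (finite-Fin _) (finite-Fin _)

  finite-Control : Finite Control
  finite-Control =
    finite-⊎ (finite-Fin _) (finite-⊎ (finite-Fin _) (finite-⊎ finite-Position
      (finite-⊎ (finite-Maybe finite-Position) (finite-⊎ (finite-Maybe finite-Position)
        (finite-⊎ (finite-Fin _) (finite-Fin _))))))

  isBlank isOne : Symbol → Bool
  isBlank zero = true
  isBlank _    = false
  isOne (suc (suc zero)) = true
  isOne _                = false

  -- Sweeping over the counter is a subroutine of both scanning and emitting; a `Maybe Position` is
  -- its return address.
  return : Maybe Position → Control
  return nothing  = scan
  return (just p) = emit p

  Response : Set
  Response = Control × Frame (Symbol × Move)

  shift : Move → Symbol → Symbol × Move
  shift d a = a , d

  emitBit : Bool → Frame (Symbol × Move) → Frame (Symbol × Move)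
  emitBit b as = record as { inputᴰ = symbol (literal b) , left }

  scanResponse : Fin 6 → Frame Symbol → Response
  -- The blank left of `w`: the Gödel number is complete. The head of `D` stands one cell before it
  -- and steps onto it; likewise the input head, which the start state moved off the input.
  scanResponse zero        v = simD zero , record (idle v) { input = shift right (input v) ; inputᴰ = shift right (inputᴰ v) }
  scanResponse (suc lit0)  v = scan , emitBit false (record (idle v) { W = shift left (W v) })
  scanResponse (suc lit1)  v = scan , emitBit true (record (idle v) { W = shift left (W v) })
  scanResponse (suc count) v = sweep← nothing , record (idle v) { W = shift left (W v) ; C = shift left (C v) }
  scanResponse (suc split) v = expand , record (idle v) { W = shift left (W v) }
  scanResponse (suc total) v = measure , record (idle v) { W = shift left (W v) ; W′ = shift right (W′ v) }

  -- Each popped token takes a one off the counter: the head moves onto the last one here, and `pop`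
  -- erases it. So while the code of a writer state is emitted, `C` holds the number of writer
  -- states before it.
  expandResponse : Fin 6 → Frame Symbol → Response
  expandResponse zero    v = scan , idle v
  expandResponse (suc t) v = pop t , record (idle v) { W′ = shift left (W′ v) ; C = shift left (C v) }

  emitResponse : Position → Token → Frame Symbol → Response
  emitResponse p lit0 v = emit p , emitBit false (idle v)
  emitResponse p lit1 v = emit p , emitBit true (idle v)
  emitResponse p _    v = sweep← (just p) , record (idle v) { C = shift left (C v) }

  performᴰ : Frame Symbol → Vec (D.Symbol × Move) D.tapes → Frame (Symbol × Move)
  performᴰ v as = record (idle v) { input  = shift right (input v)
                                  ; inputᴰ = SimD.embedAction (Vec.head as)
                                  ; restᴰ  = Vec.map SimD.embedAction (Vec.tail as) }

  perform₀ : Frame Symbol → Vec (M₀.Symbol × Move) M₀.tapes → Frame (Symbol × Move)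
  perform₀ v as = record (idle v) { input = Sim₀.embedAction (Vec.head as)
                                  ; rest₀ = Vec.map Sim₀.embedAction (Vec.tail as) }

  -- A blank under the head of the first tape makes the output empty, and the empty string decodes
  -- to no circuit.
  verdictResponse : Bool → Frame Symbol → Response
  verdictResponse true  v = dead , record (idle v) { input = keep blank }
  verdictResponse false v = rewind , record (idle v) { input = shift left (input v) }

  -- The input serves as a clock: each simulated step of D moves its head right.
  clockResponse : D.States → Bool → Frame Symbol → Response
  clockResponse q true  v = rewind , record (idle v) { input = shift left (input v) }
  clockResponse q false v = Product.map (λ q → simD q) (performᴰ v) (D.δ q (Vec.map restrict (inputᴰ v ∷ restᴰ v)))

  simDResponse : D.States → Bool → Frame Symbol → Response
  simDResponse q true  v = verdictResponse (isZero (inputᴰ v)) v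
  simDResponse q false v = clockResponse q (isBlank (input v)) v

  respond : Control → Frame Symbol → Response
  respond entry              v = scan , record (idle v) { W = shift left (W v) ; W′ = shift left (W′ v) }
  respond scan               v = scanResponse (restrict (W v)) v
  respond measure            v = if isBlank (W′ v) then scan , idle v
    else measure , emitBit true (record (idle v) { W′ = shift right (W′ v) })
  respond expand             v = expandResponse (restrict (W′ v)) v
  respond (pop t)            v = emit (endOf t) , record (idle v) { C = keep blank }
  respond (emit (t , zero))  v = expand , idle v
  respond (emit (t , suc i)) v = emitResponse (t , inject₁ i) (nth (writerCode t) (toℕ i)) v
  respond (sweep← r)         v = if isOne (C v)
    then sweep← r , emitBit true (record (idle v) { C = shift left (C v) })
    else sweep→ r , record (idle v) { C = shift right (C v) }
  respond (sweep→ r)         v = if isOne (C v)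
    then sweep→ r , record (idle v) { C = shift right (C v) }
    else return r , idle v
  respond (simD q)           v = simDResponse q (D.final q) v
  respond rewind             v = if isBlank (input v)
    then sim₀ zero , record (idle v) { input = shift right (input v) }
    else rewind , record (idle v) { input = shift left (input v) }
  respond (sim₀ q)           v =
    Product.map (λ q → sim₀ q) (perform₀ v) (M₀.δ q (Vec.map restrict (input v ∷ rest₀ v)))
  respond dead               v = dead , idle v

  finalControl : Control → Bool
  finalControl dead     = true
  finalControl (sim₀ q) = M₀.final q
  finalControl _        = false

  -- The writer states put a blank under the input head, so it first moves beside the input. On `C`
  -- the step to the right leaves a stored blank behind the head, the bottom of the counter.
  startActions : Frame Symbol → Frame (Symbol × Move)
  startActions v = record (idle v) { input = shift left (input v) ; C = blank , right }

  module Machine (w : List Token) where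

    States : Set
    States = Fin (suc (length w + size finite-Control))

    state : Control → States
    state c = suc (length w ↑ʳ index finite-Control c)

    transition : Fin (length w) ⊎ Fin (size finite-Control) → Frame Symbol → States × Frame (Symbol × Move)
    transition (inj₁ i) v = suc (next i) , writeToken (List.lookup w i)
    transition (inj₂ b) v = Product.map₁ state (respond (fromIndex finite-Control b) v)

    isFinal : Fin (length w) ⊎ Fin (size finite-Control) → Bool
    isFinal (inj₁ i) = false
    isFinal (inj₂ b) = finalControl (fromIndex finite-Control b)

    machine : DTM
    machine .DTM.extraTapes      = extraTapes
    machine .DTM.extraSymbols    = extraSymbols
    machine .DTM.extraStates     = length w + size finite-Control
    machine .DTM.δ zero v        = suc (first (length w)) , flat (startActions (unflat v))
    machine .DTM.δ (suc j) v     = Product.map₂ flat (transition (Fin.splitAt (length w) j) (unflat v))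
    machine .DTM.final zero      = false
    machine .DTM.final (suc j)   = isFinal (Fin.splitAt (length w) j)

    open DTM machine using (Config; step; run; start; outputOf; halted) public
    module R = Run machine

    config : Control → Frame (Tape Symbol) → Config
    config c F = state c , flat F

    halted-config : ∀ c F → halted (config c F) ≡ finalControl c
    halted-config c F = trans
      (cong isFinal (Fin.splitAt-↑ʳ (length w) (size finite-Control) (index finite-Control c)))
      (cong finalControl (fromIndex-index finite-Control c))

    step-flat : ∀ q F → machine .DTM.final q ≡ false → ∀ q′ as →
                machine .DTM.δ q (flat (mapF Tape.here F)) ≡ (q′ , flat as) →
                step (q , flat F) ≡ (q′ , flat (actF as F))
    step-flat q F q-working q′ as δ≡ = begin
      step (q , flat F)
        ≡⟨ R.step-δ q (flat F) q-working ⟩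
      perform (machine .DTM.δ q (Vec.map Tape.here (flat F)))
        ≡⟨ cong (λ v → perform (machine .DTM.δ q v)) (map-flat Tape.here F) ⟩
      perform (machine .DTM.δ q (flat (mapF Tape.here F)))
        ≡⟨ cong perform δ≡ ⟩
      (q′ , Vec.zipWith act (flat as) (flat F))
        ≡⟨ cong (q′ ,_) (act-flat as F) ⟩
      (q′ , flat (actF as F)) ∎
      where
      open ≡-Reasoning
      perform : States × Vec (Symbol × Move) (suc extraTapes) → Config
      perform (q′ , as) = q′ , Vec.zipWith act as (flat F)

    step-config : ∀ c F {c′ as} → finalControl c ≡ false → respond c (mapF Tape.here F) ≡ (c′ , as) →
                  step (config c F) ≡ config c′ (actF as F)
    step-config c F {c′} {as} c-working response =
      step-flat (state c) F (trans (halted-config c F) c-working) (state c′) as (begin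
        machine .DTM.δ (state c) (flat (mapF Tape.here F))
          ≡⟨ cong (λ s → Product.map₂ flat (transition s (unflat (flat (mapF Tape.here F)))))
                  (Fin.splitAt-↑ʳ (length w) (size finite-Control) (index finite-Control c)) ⟩
        Product.map₂ flat (transition (inj₂ (index finite-Control c)) (unflat (flat (mapF Tape.here F))))
          ≡⟨ cong₂ (λ c v → Product.map state flat (respond c v))
                   (fromIndex-index finite-Control c) (unflat-flat (mapF Tape.here F)) ⟩
        Product.map state flat (respond c (mapF Tape.here F))
          ≡⟨ cong (Product.map state flat) response ⟩
        (state c′ , flat as) ∎)
      where open ≡-Reasoning

-- Runs of the quine

module QuineRun (D M₀ : DTM) (w : List Token) where
  open Diagonal D M₀
  open Machine w

  emptyTape : Tape Symbol
  emptyTape = tape [] blank []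

  -- All that changes during self-reproduction. The other work tapes stay empty, and the input tape
  -- is kept apart so that runs can be stated uniformly in it.
  record Stage : Set where
    constructor stage
    field
      control : Control
      out     : List Symbol
      w₁ w₂ c : Tape Symbol

  stageFrame : List Symbol → (w₁ w₂ c i : Tape Symbol) → Frame (Tape Symbol)
  stageFrame out w₁ w₂ c i =
    frame i (Vec.replicate _ emptyTape) (tape [] blank out) (Vec.replicate _ emptyTape) w₁ w₂ c

  stageConfig : Stage → Tape Symbol → Config
  stageConfig (stage s out w₁ w₂ c) i = config s (stageFrame out w₁ w₂ c i)

  infix 4 _↝_

  -- The number of steps does not depend on the input tape.
  record _↝_ (S S′ : Stage) : Set where
    constructor _steps,_
    field
      duration : ℕ
      arrives  : ∀ i → run duration (stageConfig S i) ≡ stageConfig S′ i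

  ↝-refl : ∀ {S} → S ↝ S
  ↝-refl = 0 steps, λ _ → refl

  infixr 5 _⨾_

  _⨾_ : ∀ {S S′ S″} → S ↝ S′ → S′ ↝ S″ → S ↝ S″
  (m steps, p) ⨾ (n steps, q) = (m + n) steps, λ i → trans (R.run-+ m n _) (trans (cong (run n) (p i)) (q i))

  ↝-resp : ∀ {S S′ S″} → S ↝ S′ → S′ ≡ S″ → S ↝ S″
  ↝-resp r refl = r

  -- Only four tapes can change in such a step. For concrete stages both equations then usually hold
  -- by computation.
  step↝ : ∀ {s out w₁ w₂ c s′ a b₁ b₂ e out′ w₁′ w₂′ c′} → finalControl s ≡ false →
    (∀ i → let v = mapF Tape.here (stageFrame out w₁ w₂ c i) in
           respond s v ≡ (s′ , record (idle v) { inputᴰ = a ; W = b₁ ; W′ = b₂ ; C = e })) →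
    (act a (tape [] blank out) , act b₁ w₁ , act b₂ w₂ , act e c) ≡ (tape [] blank out′ , w₁′ , w₂′ , c′) →
    stage s out w₁ w₂ c ↝ stage s′ out′ w₁′ w₂′ c′
  step↝ {s} {out} {w₁} {w₂} {c} {s′} s-working response acted = 1 steps, λ i → trans
    (step-config s (stageFrame out w₁ w₂ c i) s-working (response i))
    (cong₂ (λ (d , w₁ , w₂ , c) (r , rᴰ) → config s′ (frame i r d rᴰ w₁ w₂ c))
           acted (cong₂ _,_ (keep-act _) (keep-act _)))

  onesThen : ℕ → List Symbol → List Symbol
  onesThen zero    out = out
  onesThen (suc n) out = onesThen n (one ∷ out)

  ones : ℕ → List Symbol
  ones n = List.replicate n one

  -- The counter tape: k ones behind the head, m ones from the head on.
  counterAt : ℕ → ℕ → List Symbol → Tape Symbol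
  counterAt k zero    bl = tape (ones k ++ blank ∷ []) blank bl
  counterAt k (suc m) bl = tape (ones k ++ blank ∷ []) one (ones m ++ blank ∷ bl)

  counter : ℕ → List Symbol → Tape Symbol
  counter n = counterAt n 0

  bottom : ℕ → List Symbol → Tape Symbol
  bottom m bl = tape [] blank (ones m ++ blank ∷ bl)

  infixl 6 _⊕_

  -- Addition that moves units across one at a time, as the head moves over the ones; the recursions
  -- below then follow the tape without arithmetic.
  _⊕_ : ℕ → ℕ → ℕ
  zero  ⊕ m = m
  suc k ⊕ m = k ⊕ suc m

  ⊕-+ : ∀ k m → k ⊕ m ≡ k + m
  ⊕-+ zero    m = refl
  ⊕-+ (suc k) m = trans (⊕-+ k (suc m)) (ℕ.+-suc k m)

  module _ (r : Maybe Position) {w₁ w₂ : Tape Symbol} where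

    turn : ∀ m {out bl} → stage (sweep← r) out w₁ w₂ (bottom m bl) ↝ stage (sweep→ r) out w₁ w₂ (counterAt 0 m bl)
    turn zero    = step↝ refl (λ _ → refl) refl
    turn (suc m) = step↝ refl (λ _ → refl) refl

    sweepLeft : ∀ k m {out bl} → stage (sweep← r) out w₁ w₂ (counterAt k (suc m) bl)
                               ↝ stage (sweep→ r) (onesThen (suc k) out) w₁ w₂ (counterAt 0 (k ⊕ suc m) bl)
    sweepLeft zero    m = step↝ refl (λ _ → refl) refl ⨾ turn (suc m)
    sweepLeft (suc k) m = step↝ refl (λ _ → refl) refl ⨾ sweepLeft k (suc m)

    sweepRight : ∀ m k {out bl} → stage (sweep→ r) out w₁ w₂ (counterAt k m bl)
                                ↝ stage (return r) out w₁ w₂ (counter (m ⊕ k) bl)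
    sweepRight zero          k = step↝ refl (λ _ → refl) refl
    sweepRight (suc zero)    k = step↝ refl (λ _ → refl) refl ⨾ sweepRight zero (suc k)
    sweepRight (suc (suc m)) k = step↝ refl (λ _ → refl) refl ⨾ sweepRight (suc m) (suc k)

    -- The pass to the left writes a one for each one that it crosses; the pass to the right only
    -- brings the head back, so the counter is preserved.
    sweep : ∀ n {out bl} → stage (sweep← r) out w₁ w₂ (act (shift left blank) (counter n bl))
                         ↝ stage (return r) (onesThen n out) w₁ w₂ (counter n bl)
    sweep zero = turn zero ⨾ sweepRight zero zero
    sweep (suc k) {out} {bl} = sweepLeft k 0 ⨾ ↝-resp (sweepRight (k ⊕ 1) 0)
      (cong (λ n → stage (return r) (onesThen (suc k) out) w₁ w₂ (counter n bl))
            (trans (⊕-+ (k ⊕ 1) 0) (trans (ℕ.+-identityʳ _) (trans (⊕-+ k 1) (ℕ.+-comm k 1)))))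

  write : ℕ → Token → List Symbol → List Symbol
  write n lit0 out = symbol lit0 ∷ out
  write n lit1 out = symbol lit1 ∷ out
  write n _    out = onesThen n out

  writeAll : ℕ → List Token → List Symbol → List Symbol
  writeAll n ts out = List.foldr (write n) out ts

  take-nth : ∀ k ts → k < length ts → List.take (suc k) ts ≡ List.take k ts ++ nth ts k ∷ []
  take-nth zero    (t ∷ ts) _         = refl
  take-nth (suc k) (t ∷ ts) (s≤s k<) = cong (t ∷_) (take-nth k ts k<)

  emitToken : ∀ p x n {s out w₁ w₂ bl} → finalControl s ≡ false → (∀ v → respond s v ≡ emitResponse p x v) →
              stage s out w₁ w₂ (counter n bl) ↝ stage (emit p) (write n x out) w₁ w₂ (counter n bl)
  emitToken p lit0  n s-working r = step↝ s-working (λ _ → r _) refl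
  emitToken p lit1  n s-working r = step↝ s-working (λ _ → r _) refl
  emitToken p count n s-working r = step↝ s-working (λ _ → r _) refl ⨾ sweep (just p) n
  emitToken p split n s-working r = step↝ s-working (λ _ → r _) refl ⨾ sweep (just p) n
  emitToken p total n s-working r = step↝ s-working (λ _ → r _) refl ⨾ sweep (just p) n

  emitRun : ∀ t k i n {out w₁ w₂ bl} → toℕ i ≡ k → k ≤ length (writerCode t) →
            stage (emit (t , i)) out w₁ w₂ (counter n bl)
            ↝ stage expand (writeAll n (List.take k (writerCode t)) out) w₁ w₂ (counter n bl)
  emitRun t zero    zero    n e k≤ = step↝ refl (λ _ → refl) refl
  emitRun t (suc k) (suc i) n {out} {w₁} {w₂} {bl} e k< =
    emitToken (t , inject₁ i) (nth (writerCode t) (toℕ i)) n refl (λ _ → refl) ⨾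
    ↝-resp (emitRun t k (inject₁ i) n (trans (Fin.toℕ-inject₁ i) i≡k) (ℕ.<⇒≤ k<))
           (cong (λ o → stage expand o w₁ w₂ (counter n bl)) written)
    where
    i≡k : toℕ i ≡ k
    i≡k = ℕ.suc-injective e
    written : writeAll n (List.take k (writerCode t)) (write n (nth (writerCode t) (toℕ i)) out)
            ≡ writeAll n (List.take (suc k) (writerCode t)) out
    written = begin
      writeAll n (List.take k (writerCode t)) (write n (nth (writerCode t) (toℕ i)) out)
        ≡⟨ cong (λ j → writeAll n (List.take k (writerCode t)) (write n (nth (writerCode t) j) out)) i≡k ⟩
      writeAll n (List.take k (writerCode t)) (write n (nth (writerCode t) k) out)
        ≡⟨ List.foldr-++ (write n) out (List.take k (writerCode t)) _ ⟨
      writeAll n (List.take k (writerCode t) ++ nth (writerCode t) k ∷ []) out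
        ≡⟨ cong (λ ts → writeAll n ts out) (take-nth k (writerCode t) k<) ⟨
      writeAll n (List.take (suc k) (writerCode t)) out ∎
      where open ≡-Reasoning

  -- A tape whose head is on the last of the listed tokens, which are given in reverse.
  lastOf : List Token → List Symbol → Tape Symbol
  lastOf []       rs = tape [] blank rs
  lastOf (t ∷ ts) rs = tape (List.map symbol ts) (symbol t) rs

  left-lastOf : ∀ t ts rs → act (shift left (symbol t)) (lastOf (t ∷ ts) rs) ≡ lastOf ts (symbol t ∷ rs)
  left-lastOf t []       rs = refl
  left-lastOf t (_ ∷ ts) rs = refl

  restrict-symbol : ∀ t → restrict (symbol t) ≡ suc t
  restrict-symbol t = restrict-inject≤ (suc t) (ℕ.m≤m+n 6 _)

  expandAll : List Token → List Symbol → List Symbol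
  expandAll []       out = out
  expandAll (t ∷ ts) out = expandAll ts (writeAll (length ts) (writerCode t) out)

  respond-expand : ∀ t v → W′ v ≡ symbol t →
                   respond expand v ≡ (pop t , record (idle v) { W′ = shift left (symbol t) ; C = shift left (C v) })
  respond-expand t v refl = cong (λ s → expandResponse s v) (restrict-symbol t)

  -- The tokens are listed in reverse, so the length of the rest is the number of preceding writer
  -- states. Erased ones remain on `C` as stored blanks, whence the unspecified `bl′`. `W′` is
  -- traversed but not erased, since it is still to be measured.
  expandRun : ∀ ts {out w₁ rs bl} → ∃ λ bl′ →
    stage expand out w₁ (lastOf ts rs) (counter (length ts) bl)
    ↝ stage scan (expandAll ts out) w₁ (tape [] blank (List.map symbol ts ʳ++ rs)) (counter 0 bl′)
  expandRun []                         {bl = bl} = bl , step↝ refl (λ _ → refl) refl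
  expandRun (t ∷ ts) {out} {w₁} {rs} {bl} =
    proj₁ rest ,
    (step↝ refl (λ i → respond-expand t _ refl) refl ⨾
     subst (λ w₂ → stage (pop t) out w₁ w₂ (counterAt (length ts) 1 bl)
                   ↝ stage expand (writeAll (length ts) (writerCode t) out) w₁ (lastOf ts (symbol t ∷ rs))
                           (counter (length ts) (blank ∷ bl)))
           (sym (left-lastOf t ts rs))
           (step↝ refl (λ _ → refl) refl ⨾
            ↝-resp (emitRun t (length (writerCode t)) _ (length ts)
                            (Fin.toℕ-fromℕ< (s≤s (length≤maxLength t))) ℕ.≤-refl)
                   (cong (λ l → stage expand (writeAll (length ts) l out) w₁ (lastOf ts (symbol t ∷ rs))
                                      (counter (length ts) (blank ∷ bl)))
                         (List.take-all (length (writerCode t)) (writerCode t) ℕ.≤-refl))) ⨾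
     proj₂ rest)
    where rest = expandRun ts {writeAll (length ts) (writerCode t) out} {w₁} {symbol t ∷ rs} {blank ∷ bl}

  -- The tokens that `scan` deals with on its own, possibly by a sweep; `split` and `total` switch
  -- to another phase.
  data Plain : Token → Set where
    plain0 : Plain lit0
    plain1 : Plain lit1
    plainC : Plain count

  scanRun : ∀ ts {us} → All Plain ts → ∀ n {out rs w₂ bl} → ∃ λ rs′ →
    stage scan out (lastOf (ts ++ us) rs) w₂ (counter n bl)
    ↝ stage scan (List.foldl (flip (write n)) out ts) (lastOf us rs′) w₂ (counter n bl)
  scanRun []       []       n {rs = rs} = rs , ↝-refl
  scanRun (t ∷ ts) {us} (p ∷ ps) n {out} {rs} {w₂} {bl} = proj₁ rest ,
    (subst (λ w₁ → stage scan out (lastOf (t ∷ ts ++ us) rs) w₂ (counter n bl)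
                   ↝ stage scan (write n t out) w₁ w₂ (counter n bl))
           (left-lastOf t (ts ++ us) rs) (one-token p) ⨾ proj₂ rest)
    where
    rest = scanRun ts {us} ps n {write n t out} {symbol t ∷ rs} {w₂} {bl}
    one-token : ∀ {t} → Plain t → stage scan out (lastOf (t ∷ ts ++ us) rs) w₂ (counter n bl)
      ↝ stage scan (write n t out) (act (shift left (symbol t)) (lastOf (t ∷ ts ++ us) rs)) w₂ (counter n bl)
    one-token plain0 = step↝ refl (λ _ → refl) refl
    one-token plain1 = step↝ refl (λ _ → refl) refl
    one-token plainC = step↝ refl (λ _ → refl) refl ⨾ sweep nothing n

  scanList : ∀ ts {us} → All Plain (List.reverse ts) → ∀ n {out rs w₂ bl} → ∃ λ rs′ →
    stage scan out (lastOf (List.reverse ts ++ us) rs) w₂ (counter n bl)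
    ↝ stage scan (writeAll n ts out) (lastOf us rs′) w₂ (counter n bl)
  scanList ts {us} ps n {out} {rs} {w₂} {bl} with scanRun (List.reverse ts) {us} ps n {out} {rs} {w₂} {bl}
  ... | rs′ , r = rs′ , ↝-resp r (cong (λ o → stage scan o (lastOf us rs′) w₂ (counter n bl))
                                       (List.reverse-foldl (flip (write n)) out ts))

  -- A tape whose head has just moved right onto the first of the listed symbols.
  firstOf : List Symbol → List Symbol → Tape Symbol
  firstOf ls []       = tape ls blank []
  firstOf ls (a ∷ rs) = tape ls a rs

  measureRun : ∀ ts {out ls w₁ c} → ∃ λ ls′ →
    stage measure out w₁ (firstOf ls (List.map symbol ts ++ blank ∷ [])) c
    ↝ stage scan (onesThen (length ts) out) w₁ (tape ls′ blank []) c
  measureRun []           {ls = ls} = ls , step↝ refl (λ _ → refl) refl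
  measureRun (t ∷ [])     {out} {ls} {w₁} {c} = Product.map₂ (step↝ refl (λ _ → refl) refl ⨾_)
    (measureRun [] {one ∷ out} {symbol t ∷ ls} {w₁} {c})
  measureRun (t ∷ u ∷ ts) {out} {ls} {w₁} {c} = Product.map₂ (step↝ refl (λ _ → refl) refl ⨾_)
    (measureRun (u ∷ ts) {one ∷ out} {symbol t ∷ ls} {w₁} {c})

  right-firstOf : ∀ a ls x rs → act (a , right) (tape ls x rs) ≡ firstOf (a ∷ ls) rs
  right-firstOf a ls x []       = refl
  right-firstOf a ls x (_ ∷ rs) = refl

  written : List Token → Tape Symbol
  written ts = tape (List.map symbol (List.reverse ts)) blank []

  left-written : ∀ ts → act (shift left blank) (tape (List.map symbol ts) blank []) ≡ lastOf ts (blank ∷ [])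
  left-written []       = refl
  left-written (t ∷ ts) = refl

  simStart : Tape Symbol → List Symbol → (w₁ w₂ c : Tape Symbol) → Config
  simStart i out w₁ w₂ c = config (simD zero)
    (frame (act (shift right (Tape.here i)) i) (Vec.replicate _ emptyTape)
           (act (shift right blank) (tape [] blank out)) (Vec.replicate _ emptyTape) w₁ w₂ c)

  launch : ∀ out rs w₂ c → ∃ λ w₁ → ∀ i →
           step (stageConfig (stage scan out (tape [] blank rs) w₂ c) i) ≡ simStart i out w₁ w₂ c
  launch out rs w₂ c = tape [] blank rs , λ i → trans
    (step-config scan (stageFrame out (tape [] blank rs) w₂ c i) refl refl)
    (cong₂ (λ r rᴰ → config (simD zero) (frame (act (shift right (Tape.here i)) i) r
                                               (act (shift right blank) (tape [] blank out)) rᴰ (tape [] blank rs) w₂ c))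
           (keep-act _) (keep-act _))

  lookup-++-∷ : ∀ (xs : List Token) t ys (i : Fin (length (xs ++ t ∷ ys))) → toℕ i ≡ length xs →
                List.lookup (xs ++ t ∷ ys) i ≡ t
  lookup-++-∷ []       t ys zero    _ = refl
  lookup-++-∷ (x ∷ xs) t ys (suc i) e = lookup-++-∷ xs t ys i (ℕ.suc-injective e)

  step-writer : ∀ pre t suf → w ≡ pre ++ t ∷ suf → ∀ j → toℕ j ≡ length pre → ∀ rs →
    ∃ λ j′ → toℕ j′ ≡ length (pre ++ t ∷ []) ×
    step (suc j , flat (stageFrame [] (written pre) (written pre) (counter (length pre) []) (tape [] blank rs)))
    ≡ (suc j′ , flat (stageFrame [] (written (pre ++ t ∷ [])) (written (pre ++ t ∷ []))
                                 (counter (length (pre ++ t ∷ [])) []) (tape [] blank rs)))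
  step-writer pre t suf w≡ j j≡ rs = next i , next≡ , trans
    (step-flat (suc j) F (cong isFinal at-i) _ (writeToken t)
               (trans (cong (λ s → Product.map₂ flat (transition s (unflat (flat (mapF Tape.here F))))) at-i)
                      (cong (λ u → suc (next i) , flat (writeToken u)) (at-t w≡ i (trans toℕ-i j≡)))))
    (cong (λ F → suc (next i) , flat F) acted)
    where
    F = stageFrame [] (written pre) (written pre) (counter (length pre) []) (tape [] blank rs)
    |pre|< : length pre < length w
    |pre|< rewrite w≡ | List.length-++ pre {t ∷ suf} | ℕ.+-suc (length pre) (length suf) = s≤s (ℕ.m≤m+n _ _)
    j< : toℕ j < length w
    j< = subst (_< length w) (sym j≡) |pre|<
    i : Fin (length w)
    i = fromℕ< j<
    toℕ-i : toℕ i ≡ toℕ j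
    toℕ-i = Fin.toℕ-fromℕ< j<
    at-i : Fin.splitAt (length w) j ≡ inj₁ i
    at-i = Fin.splitAt-< (length w) j j<
    -- Generalised over the list, so that the equation can be matched with `refl`.
    at-t : ∀ {v} → v ≡ pre ++ t ∷ suf → (i : Fin (length v)) → toℕ i ≡ length pre → List.lookup v i ≡ t
    at-t refl = lookup-++-∷ pre t suf
    length-snoc : length (pre ++ t ∷ []) ≡ suc (length pre)
    length-snoc = trans (List.length-++ pre) (ℕ.+-comm (length pre) 1)
    next≡ : toℕ (next i) ≡ length (pre ++ t ∷ [])
    next≡ = trans (toℕ-next i) (trans (cong suc (trans toℕ-i j≡)) (sym length-snoc))
    written-snoc : tape (symbol t ∷ List.map symbol (List.reverse pre)) blank [] ≡ written (pre ++ t ∷ [])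
    written-snoc = cong (λ ts → tape (List.map symbol ts) blank []) (sym (List.reverse-++ pre (t ∷ [])))
    acted : actF (writeToken t) F ≡ stageFrame [] (written (pre ++ t ∷ [])) (written (pre ++ t ∷ []))
                                      (counter (length (pre ++ t ∷ [])) []) (tape [] blank rs)
    acted rewrite Vec.zipWith-replicate {n = M₀.extraTapes} act (keep blank) emptyTape
                | Vec.zipWith-replicate {n = D.extraTapes} act (keep blank) emptyTape
                | length-snoc | sym written-snoc = refl

  writerRun : ∀ suf pre → w ≡ pre ++ suf → ∀ j → toℕ j ≡ length pre → ∀ rs →
    run (length suf) (suc j , flat (stageFrame [] (written pre) (written pre) (counter (length pre) []) (tape [] blank rs)))
    ≡ stageConfig (stage entry [] (written w) (written w) (counter (length w) [])) (tape [] blank rs)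
  writerRun [] pre w≡ j j≡ rs =
    subst (λ v → (suc j , flat (stageFrame [] (written v) (written v) (counter (length v) []) (tape [] blank rs)))
               ≡ stageConfig (stage entry [] (written w) (written w) (counter (length w) [])) (tape [] blank rs))
          (trans w≡ (List.++-identityʳ pre))
          (cong (λ j → suc j , flat (stageFrame [] (written w) (written w) (counter (length w) []) (tape [] blank rs)))
                (Fin.toℕ-injective (begin
                  toℕ j                                             ≡⟨ j≡ ⟩
                  length pre                                        ≡⟨ cong length (trans w≡ (List.++-identityʳ pre)) ⟨
                  length w                                          ≡⟨ ℕ.+-identityʳ _ ⟨
                  length w + 0                                      ≡⟨ Fin.toℕ-↑ʳ (length w) (index finite-Control entry) ⟨
                  toℕ (length w ↑ʳ index finite-Control entry)      ∎)))
    where open ≡-Reasoning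
  writerRun (t ∷ suf) pre w≡ j j≡ rs with step-writer pre t suf w≡ j j≡ rs
  ... | j′ , j′≡ , stepped = trans (cong (run (length suf)) stepped)
    (writerRun suf (pre ++ t ∷ []) (trans w≡ (sym (List.++-assoc pre (t ∷ []) suf))) j′ j′≡ rs)

  inputTape : Str → Tape Symbol
  inputTape []      = emptyTape
  inputTape (b ∷ x) = tape [] (symbol (literal b)) (List.map (symbol ∘ literal) x)

  besideInput : Str → Tape Symbol
  besideInput []      = tape [] blank (blank ∷ [])
  besideInput (b ∷ x) = tape [] blank (List.map (symbol ∘ literal) (b ∷ x))

  start≡ : ∀ x → start x ≡ (zero , flat (stageFrame [] emptyTape emptyTape emptyTape (inputTape x)))
  start≡ x = trans (input≡ x) (cong (λ v → zero , inputTape x ∷ v) (trans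
    (replicate-+ M₀.extraTapes (suc (D.extraTapes + 3)))
    (cong (λ v → Vec.replicate M₀.extraTapes emptyTape Vec.++ emptyTape ∷ v) (replicate-+ D.extraTapes 3))))
    where
    replicate-+ : ∀ m n → Vec.replicate (m + n) emptyTape ≡ Vec.replicate m emptyTape Vec.++ Vec.replicate n emptyTape
    replicate-+ zero    n = refl
    replicate-+ (suc m) n = cong (emptyTape ∷_) (replicate-+ m n)
    bit≡ : ∀ b → DTM.bit machine b ≡ symbol (literal b)
    bit≡ false = refl
    bit≡ true  = refl
    input≡ : ∀ x → start x ≡ (zero , inputTape x ∷ Vec.replicate extraTapes emptyTape)
    input≡ []      = refl
    input≡ (b ∷ x) = cong₂ (λ a as → zero , tape [] a as ∷ Vec.replicate extraTapes emptyTape)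
                           (bit≡ b) (List.map-cong bit≡ x)

  startRun : ∀ x → run (suc (length w)) (start x)
                 ≡ stageConfig (stage entry [] (written w) (written w) (counter (length w) [])) (besideInput x)
  startRun x = begin
    run (length w) (step (start x))
      ≡⟨ cong (λ c → run (length w) (step c)) (start≡ x) ⟩
    run (length w) (step (zero , flat F))
      ≡⟨ cong (run (length w)) (step-flat zero F refl _ (startActions (mapF Tape.here F))
              (cong (λ v → suc (first (length w)) , flat (startActions v)) (unflat-flat (mapF Tape.here F)))) ⟩
    run (length w) (suc (first (length w)) , flat (actF (startActions (mapF Tape.here F)) F))
      ≡⟨ cong (λ F → run (length w) (suc (first (length w)) , flat F)) (acted x) ⟩
    run (length w) (suc (first (length w)) , flat (stageFrame [] (written []) (written []) (counter 0 []) (besideInput x)))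
      ≡⟨ beside x ⟩
    stageConfig (stage entry [] (written w) (written w) (counter (length w) [])) (besideInput x) ∎
    where
    open ≡-Reasoning
    F = stageFrame [] emptyTape emptyTape emptyTape (inputTape x)
    idle-tapes : ∀ i → frame i (Vec.zipWith act (Vec.map keep (Vec.map Tape.here (Vec.replicate _ emptyTape))) (Vec.replicate _ emptyTape))
                             emptyTape (Vec.zipWith act (Vec.map keep (Vec.map Tape.here (Vec.replicate _ emptyTape))) (Vec.replicate _ emptyTape))
                             emptyTape emptyTape (counter 0 [])
                     ≡ stageFrame [] emptyTape emptyTape (counter 0 []) i
    idle-tapes i = cong₂ (λ r rᴰ → frame i r emptyTape rᴰ emptyTape emptyTape (counter 0 [])) (keep-act _) (keep-act _)
    acted : ∀ x → let F = stageFrame [] emptyTape emptyTape emptyTape (inputTape x) in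
            actF (startActions (mapF Tape.here F)) F
            ≡ stageFrame [] (written []) (written []) (counter 0 []) (besideInput x)
    acted []      = idle-tapes (besideInput [])
    acted (b ∷ x) = idle-tapes (besideInput (b ∷ x))
    beside : ∀ x → run (length w) (suc (first (length w)) ,
                     flat (stageFrame [] (written []) (written []) (counter 0 []) (besideInput x)))
                 ≡ stageConfig (stage entry [] (written w) (written w) (counter (length w) [])) (besideInput x)
    beside []      = writerRun w [] refl (first (length w)) (toℕ-first (length w)) _
    beside (b ∷ x) = writerRun w [] refl (first (length w)) (toℕ-first (length w)) _

  module _ (a b c : List Token) (w≡ : w ≡ a ++ total ∷ b ++ split ∷ c)
           (plain-a : All Plain (List.reverse a)) (plain-b : All Plain (List.reverse b))
           (plain-c : All Plain (List.reverse c)) where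

    -- The innermost part is written first. While `c` is written, the counter holds the length of
    -- `w`; the expansion empties it, so `b` and `a` are written with counter 0.
    produced : List Symbol
    produced = writeAll 0 a (onesThen (length w) (writeAll 0 b
                 (expandAll (List.reverse w) (writeAll (length w) c []))))

    reverse-w : List.reverse w ≡ List.reverse c ++ split ∷ List.reverse b ++ total ∷ List.reverse a
    reverse-w = begin
      List.reverse w
        ≡⟨ cong List.reverse w≡ ⟩
      List.reverse (a ++ total ∷ b ++ split ∷ c)
        ≡⟨ List.reverse-++ a (total ∷ b ++ split ∷ c) ⟩
      List.reverse (total ∷ b ++ split ∷ c) ++ List.reverse a
        ≡⟨ cong (_++ List.reverse a) (snoc total (b ++ split ∷ c)) ⟩
      (List.reverse (b ++ split ∷ c) ++ total ∷ []) ++ List.reverse a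
        ≡⟨ List.++-assoc (List.reverse (b ++ split ∷ c)) _ _ ⟩
      List.reverse (b ++ split ∷ c) ++ total ∷ List.reverse a
        ≡⟨ cong (_++ total ∷ List.reverse a) (trans (List.reverse-++ b (split ∷ c)) (cong (_++ List.reverse b) (snoc split c))) ⟩
      ((List.reverse c ++ split ∷ []) ++ List.reverse b) ++ total ∷ List.reverse a
        ≡⟨ List.++-assoc (List.reverse c ++ split ∷ []) _ _ ⟩
      (List.reverse c ++ split ∷ []) ++ List.reverse b ++ total ∷ List.reverse a
        ≡⟨ List.++-assoc (List.reverse c) _ _ ⟩
      List.reverse c ++ split ∷ List.reverse b ++ total ∷ List.reverse a ∎
      where
      open ≡-Reasoning
      snoc : ∀ (t : Token) ts → List.reverse (t ∷ ts) ≡ List.reverse ts ++ t ∷ []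
      snoc t ts = List.unfold-reverse t ts

    -- The number of steps and the leftover tapes are chosen before `x`: self-reproduction costs a
    -- constant, which goes into the polynomial time bound.
    quineRun : ∃ λ w₁ → ∃ λ w₂ → ∃ λ k → ∃ λ n → ∀ x →
               run n (start x) ≡ simStart (besideInput x) produced w₁ w₂ k
    quineRun =
      proj₁ start-sim , _ , _ , suc (length w) + (_↝_.duration main-run + 1) , λ x →
      trans (R.run-+ (suc (length w)) (_↝_.duration main-run + 1) (start x))
     (trans (cong (run (_↝_.duration main-run + 1)) (startRun x))
     (trans (R.run-+ (_↝_.duration main-run) 1 _)
     (trans (cong step (_↝_.arrives main-run (besideInput x)))
            (proj₂ start-sim (besideInput x)))))
      where
      rw = List.reverse w
      rs₀ = blank ∷ []
      w₂-end = tape [] blank (List.map symbol rw ʳ++ rs₀)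
      out₁ = writeAll (length w) c []
      out₂ = expandAll rw out₁
      out₃ = writeAll 0 b out₂
      out₄ = onesThen (length w) out₃
      us₁ = split ∷ List.reverse b ++ total ∷ List.reverse a
      us₂ = total ∷ List.reverse a

      scan-c = scanList c {us₁} plain-c (length w) {[]} {rs₀} {lastOf rw rs₀} {[]}
      rs₁ = symbol split ∷ proj₁ scan-c
      expansion = expandRun rw {out₁} {lastOf (List.reverse b ++ us₂) rs₁} {rs₀} {[]}
      bl = proj₁ expansion
      scan-b = scanList b {us₂} plain-b 0 {out₂} {rs₁} {w₂-end} {bl}
      rs₂ = symbol total ∷ proj₁ scan-b
      measurement = measureRun w {out₃} {blank ∷ []} {lastOf (List.reverse a) rs₂} {counter 0 bl}
      w₂-last = tape (proj₁ measurement) blank []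
      scan-a = scanList a {[]} plain-a 0 {out₄} {rs₂} {w₂-last} {bl}
      start-sim = launch produced (proj₁ scan-a) w₂-last (counter 0 bl)

      entered : stage entry [] (written w) (written w) (counter (length w) [])
              ↝ stage scan [] (lastOf (List.reverse c ++ us₁) rs₀) (lastOf rw rs₀) (counter (length w) [])
      entered = ↝-resp (step↝ refl (λ _ → refl) refl)
        (cong₂ (λ w₁ w₂ → stage scan [] w₁ w₂ (counter (length w) []))
               (trans (left-written rw) (cong (λ ts → lastOf ts rs₀) reverse-w)) (left-written rw))

      splitting : stage scan out₁ (lastOf us₁ (proj₁ scan-c)) (lastOf rw rs₀) (counter (length w) [])
               ↝ stage expand out₁ (lastOf (List.reverse b ++ us₂) rs₁) (lastOf rw rs₀) (counter (length rw) [])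
      splitting = ↝-resp (step↝ refl (λ _ → refl) refl)
        (cong₂ (λ w₁ n → stage expand out₁ w₁ (lastOf rw rs₀) (counter n []))
               (left-lastOf split (List.reverse b ++ us₂) (proj₁ scan-c)) (sym (List.length-reverse w)))

      measuring : stage scan out₃ (lastOf us₂ (proj₁ scan-b)) w₂-end (counter 0 bl)
                ↝ stage measure out₃ (lastOf (List.reverse a) rs₂)
                        (firstOf (blank ∷ []) (List.map symbol w ++ blank ∷ [])) (counter 0 bl)
      measuring = ↝-resp (step↝ refl (λ _ → refl) refl)
        (cong₂ (λ w₁ w₂ → stage measure out₃ w₁ w₂ (counter 0 bl))
               (left-lastOf total (List.reverse a) (proj₁ scan-b))
               (trans (right-firstOf blank [] blank _) (cong (firstOf (blank ∷ [])) unreversed)))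
        where
        unreversed : List.map symbol rw ʳ++ rs₀ ≡ List.map symbol w ++ rs₀
        unreversed = trans (List.ʳ++-defn (List.map symbol rw))
          (cong (_++ rs₀) (trans (cong List.reverse (List.reverse-map symbol w)) (List.reverse-involutive _)))

      last-scan : stage scan out₄ (lastOf (List.reverse a) rs₂) w₂-last (counter 0 bl)
                ↝ stage scan produced (tape [] blank (proj₁ scan-a)) w₂-last (counter 0 bl)
      last-scan = subst (λ ts → stage scan out₄ (lastOf ts rs₂) w₂-last (counter 0 bl)
                              ↝ stage scan produced (tape [] blank (proj₁ scan-a)) w₂-last (counter 0 bl))
                        (List.++-identityʳ (List.reverse a)) (proj₂ scan-a)

      main-run = entered ⨾ proj₂ scan-c ⨾ splitting ⨾ proj₂ expansion ⨾ proj₂ scan-b ⨾ measuring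
                 ⨾ proj₂ measurement ⨾ last-scan

-- Gödel numbers

encodeℕs-++ : ∀ xs ys → encodeℕs (xs ++ ys) ≡ encodeℕs xs ++ encodeℕs ys
encodeℕs-++ = List.concatMap-++ _

All-ʳ++ : ∀ {A : Set} {P : A → Set} {xs ys} → All P xs → All P ys → All P (xs ʳ++ ys)
All-ʳ++ []       qs = qs
All-ʳ++ (p ∷ ps) qs = All-ʳ++ ps (p ∷ qs)

module _ (M : DTM) where
  open DTM M

  stateCode : States → List ℕ
  stateCode q = (if final q then 1 else 0)
              ∷ concatMap (λ v → toℕ (proj₁ (δ q v)) ∷ actionsCode (proj₂ (δ q v))) (allVecs (3 + extraSymbols) tapes)

  gödelNumber≡ : gödelNumber M ≡ encodeℕs (extraTapes ∷ extraSymbols ∷ extraStates ∷ List.concat (List.tabulate stateCode))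
  gödelNumber≡ = cong (λ ns → encodeℕs (extraTapes ∷ extraSymbols ∷ extraStates ∷ ns)) (trans
    (List.concatMap-cong (λ q → cong ((if final q then 1 else 0) ∷_) (List.concatMap-cong (λ v → cong (toℕ (proj₁ (δ q v)) ∷_)
      -- The two move codes are separate definitions by cases, equal only after a case distinction.
      (List.concatMap-cong (λ { (s , left) → refl ; (s , stay) → refl ; (s , right) → refl })
        (Vec.toList (proj₂ (δ q v))))) (allVecs (3 + extraSymbols) tapes)))
      (List.allFin (suc extraStates)))
    (cong List.concat (List.map-tabulate (λ q → q) stateCode)))

concat-tabulate-+ : ∀ {A : Set} m {n} (f : Fin (m + n) → List A) →
  List.concat (List.tabulate f)
  ≡ List.concat (List.tabulate (λ i → f (i ↑ˡ n))) ++ List.concat (List.tabulate (λ i → f (m ↑ʳ i)))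
concat-tabulate-+ zero    f = refl
concat-tabulate-+ (suc m) f = trans (cong (f zero ++_) (concat-tabulate-+ m (f ∘ suc))) (sym (List.++-assoc (f zero) _ _))

module Quine (D M₀ : DTM) where
  open Diagonal D M₀

  scans : List (Vec Symbol (suc extraTapes))
  scans = allVecs (3 + extraSymbols) (suc extraTapes)

  opaque
    unfolding writerCode

    writerCode≡ : ∀ t → writerCode t ≡ lit0 ∷ concatMap
      (λ (_ : Vec Symbol (suc extraTapes)) →
         count ∷ lit1 ∷ lit1 ∷ lit0 ∷ List.map literal (encodeℕs (actionsCode (flat (writeToken t)))))
      scans
    writerCode≡ t = refl

  literals : Str → List Token
  literals = List.map literal

  header : List Token
  header = literals (encodeℕs (extraTapes ∷ extraSymbols ∷ []))

  startCode : List ℕ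
  startCode = 0 ∷ concatMap (λ v → 1 ∷ actionsCode (flat (startActions (unflat v)))) scans

  -- The leading number completes the ones written for `total`: together they encode the length of
  -- `w` plus the size of the control, which is `extraStates`.
  startTokens : List Token
  startTokens = literals (encodeℕs (size finite-Control ∷ startCode))

  -- A control state has number |w| + 1 + its index, where 1 accounts for the start state. Of this
  -- only |w| is unknown when the text is fixed, and `count` supplies it as a prefix of ones.
  responseTokens : Response → List Token
  responseTokens (s , as) = count ∷ lit1 ∷ literals (encodeℕs (toℕ (index finite-Control s) ∷ actionsCode (flat as)))

  finalCode : Control → ℕ
  finalCode s = if finalControl s then 1 else 0

  controlTokens : Control → List Token
  controlTokens s = literals (encodeℕs (finalCode s ∷ []))
                 ++ concatMap (λ v → responseTokens (respond s (unflat v))) scans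

  body : List Token
  body = List.concat (List.tabulate (controlTokens ∘ fromIndex finite-Control))

  opaque
    -- Follows the order of a Gödel number: sizes, start state, writer states, control states. The
    -- codes of the writer states depend on the tokens of this very text and are left to `split`;
    -- everything else depends on it only through its length.
    quine : List Token
    quine = header ++ total ∷ startTokens ++ split ∷ body

    quine≡ : quine ≡ header ++ total ∷ startTokens ++ split ∷ body
    quine≡ = refl

  open QuineRun D M₀ quine
  open Machine quine

  plain-literals : ∀ bs → All Plain (literals bs)
  plain-literals []           = []
  plain-literals (false ∷ bs) = plain0 ∷ plain-literals bs
  plain-literals (true ∷ bs)  = plain1 ∷ plain-literals bs

  plain-body : All Plain body
  plain-body = All.concat⁺ (All.tabulate⁺ (plain-controlTokens ∘ fromIndex finite-Control))
    where
    plain-controlTokens : ∀ s → All Plain (controlTokens s)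
    plain-controlTokens s = All.++⁺ (plain-literals (encodeℕs (finalCode s ∷ [])))
      (All.concat⁺ (All.map⁺ (All.universal (λ v → let s′ , as = respond s (unflat v) in
        plainC ∷ plain1 ∷ plain-literals (encodeℕs (toℕ (index finite-Control s′) ∷ actionsCode (flat as)))) scans)))

  plain-reverse : ∀ {ts} → All Plain ts → All Plain (List.reverse ts)
  plain-reverse ps = All-ʳ++ ps []

  bits : Str → List Symbol
  bits = List.map (symbol ∘ literal)

  bits-++ : ∀ xs ys out → bits (xs ++ ys) ++ out ≡ bits xs ++ bits ys ++ out
  bits-++ xs ys out = trans (cong (_++ out) (List.map-++ _ xs ys)) (List.++-assoc (bits xs) (bits ys) out)

  writeAll-literals : ∀ n bs out → writeAll n (literals bs) out ≡ bits bs ++ out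
  writeAll-literals n []           out = refl
  writeAll-literals n (false ∷ bs) out = cong (_ ∷_) (writeAll-literals n bs out)
  writeAll-literals n (true ∷ bs)  out = cong (_ ∷_) (writeAll-literals n bs out)

  onesThen≡ : ∀ n out → onesThen n out ≡ bits (List.replicate n true) ++ out
  onesThen≡ zero    out = refl
  onesThen≡ (suc n) out = trans (onesThen≡ n (one ∷ out)) (snoc n)
    where
    snoc : ∀ n → bits (List.replicate n true) ++ one ∷ out ≡ one ∷ bits (List.replicate n true) ++ out
    snoc zero    = refl
    snoc (suc n) = cong (one ∷_) (snoc n)

  writeAll-concatMap : ∀ {A : Set} n (f : A → List Token) (g : A → List ℕ) →
    (∀ a out → writeAll n (f a) out ≡ bits (encodeℕs (g a)) ++ out) →
    ∀ as out → writeAll n (concatMap f as) out ≡ bits (encodeℕs (concatMap g as)) ++ out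
  writeAll-concatMap n f g eq []       out = refl
  writeAll-concatMap n f g eq (a ∷ as) out = begin
    writeAll n (f a ++ concatMap f as) out
      ≡⟨ List.foldr-++ (write n) out (f a) (concatMap f as) ⟩
    writeAll n (f a) (writeAll n (concatMap f as) out)
      ≡⟨ cong (writeAll n (f a)) (writeAll-concatMap n f g eq as out) ⟩
    writeAll n (f a) (bits (encodeℕs (concatMap g as)) ++ out)
      ≡⟨ eq a _ ⟩
    bits (encodeℕs (g a)) ++ bits (encodeℕs (concatMap g as)) ++ out
      ≡⟨ bits-++ (encodeℕs (g a)) _ out ⟨
    bits (encodeℕs (g a) ++ encodeℕs (concatMap g as)) ++ out
      ≡⟨ cong (λ s → bits s ++ out) (encodeℕs-++ (g a) (concatMap g as)) ⟨
    bits (encodeℕs (g a ++ concatMap g as)) ++ out ∎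
    where open ≡-Reasoning

  -- In unary, n ones in front of the code of k give the code of n + k.
  writeAll-target : ∀ n ts k ns out → (∀ out → writeAll n ts out ≡ bits (List.replicate k true ++ false ∷ encodeℕs ns) ++ out) →
    writeAll n (count ∷ ts) out ≡ bits (encodeℕs (n + k ∷ ns)) ++ out
  writeAll-target n ts k ns out eq = begin
    onesThen n (writeAll n ts out)
      ≡⟨ trans (onesThen≡ n _) (cong (bits (List.replicate n true) ++_) (eq out)) ⟩
    bits (List.replicate n true) ++ bits (List.replicate k true ++ false ∷ encodeℕs ns) ++ out
      ≡⟨ bits-++ (List.replicate n true) _ out ⟨
    bits (List.replicate n true ++ List.replicate k true ++ false ∷ encodeℕs ns) ++ out
      ≡⟨ cong (λ s → bits s ++ out) (shape n) ⟩
    bits (encodeℕs (n + k ∷ ns)) ++ out ∎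
    where
    open ≡-Reasoning
    shape : ∀ n → List.replicate n true ++ List.replicate k true ++ false ∷ encodeℕs ns ≡ encodeℕs (n + k ∷ ns)
    shape zero    = sym (List.++-assoc (List.replicate k true) (false ∷ []) (encodeℕs ns))
    shape (suc n) = cong (true ∷_) (shape n)

  -- With `n` writer states before it, a writer state has number n + 1, after the start state, and
  -- passes to n + 2.
  writerStateCode : ℕ → Token → List ℕ
  writerStateCode n t = 0 ∷ concatMap (λ (_ : Vec Symbol (suc extraTapes)) → n + 2 ∷ actionsCode (flat (writeToken t))) scans

  writeAll-writerCode : ∀ n t out → writeAll n (writerCode t) out ≡ bits (encodeℕs (writerStateCode n t)) ++ out
  writeAll-writerCode n t out = trans
    (cong (λ ts → writeAll n ts out) (writerCode≡ t))
    (cong (symbol lit0 ∷_) (writeAll-concatMap n _ _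
      (λ _ out → writeAll-target n (lit1 ∷ lit1 ∷ lit0 ∷ literals (encodeℕs ns)) 2 ns out
        (λ out → cong (λ o → symbol lit1 ∷ symbol lit1 ∷ symbol lit0 ∷ o) (writeAll-literals n (encodeℕs ns) out)))
      scans out))
    where ns = actionsCode (flat (writeToken t))

  writersCode : ℕ → List Token → List ℕ
  writersCode k []       = []
  writersCode k (t ∷ ts) = writerStateCode k t ++ writersCode (suc k) ts

  writersCode-∷ʳ : ∀ k ts t → writersCode k (ts ++ t ∷ []) ≡ writersCode k ts ++ writerStateCode (k + length ts) t
  writersCode-∷ʳ k []       t = trans (List.++-identityʳ _) (cong (λ n → writerStateCode n t) (sym (ℕ.+-identityʳ k)))
  writersCode-∷ʳ k (u ∷ ts) t = begin
    writerStateCode k u ++ writersCode (suc k) (ts ++ t ∷ [])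
      ≡⟨ cong (writerStateCode k u ++_) (writersCode-∷ʳ (suc k) ts t) ⟩
    writerStateCode k u ++ writersCode (suc k) ts ++ writerStateCode (suc k + length ts) t
      ≡⟨ List.++-assoc (writerStateCode k u) _ _ ⟨
    (writerStateCode k u ++ writersCode (suc k) ts) ++ writerStateCode (suc k + length ts) t
      ≡⟨ cong (λ n → (writerStateCode k u ++ writersCode (suc k) ts) ++ writerStateCode n t) (ℕ.+-suc k (length ts)) ⟨
    (writerStateCode k u ++ writersCode (suc k) ts) ++ writerStateCode (k + suc (length ts)) t ∎
    where open ≡-Reasoning

  -- Later writer states are written first and further to the right, so the reversed list yields the
  -- codes in their proper order.
  expandAll≡ : ∀ ts out → expandAll ts out ≡ bits (encodeℕs (writersCode 0 (List.reverse ts))) ++ out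
  expandAll≡ []       out = refl
  expandAll≡ (t ∷ ts) out = begin
    expandAll ts (writeAll (length ts) (writerCode t) out)
      ≡⟨ trans (cong (expandAll ts) (writeAll-writerCode (length ts) t out)) (expandAll≡ ts _) ⟩
    bits (encodeℕs (writersCode 0 (List.reverse ts))) ++ bits (encodeℕs (writerStateCode (length ts) t)) ++ out
      ≡⟨ bits-++ (encodeℕs (writersCode 0 (List.reverse ts))) _ out ⟨
    bits (encodeℕs (writersCode 0 (List.reverse ts)) ++ encodeℕs (writerStateCode (length ts) t)) ++ out
      ≡⟨ cong (λ s → bits s ++ out) (encodeℕs-++ (writersCode 0 (List.reverse ts)) (writerStateCode (length ts) t)) ⟨
    bits (encodeℕs (writersCode 0 (List.reverse ts) ++ writerStateCode (length ts) t)) ++ out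
      ≡⟨ cong (λ n → bits (encodeℕs (writersCode 0 (List.reverse ts) ++ writerStateCode n t)) ++ out) (List.length-reverse ts) ⟨
    bits (encodeℕs (writersCode 0 (List.reverse ts) ++ writerStateCode (length (List.reverse ts)) t)) ++ out
      ≡⟨ cong (λ ns → bits (encodeℕs ns) ++ out) (writersCode-∷ʳ 0 (List.reverse ts) t) ⟨
    bits (encodeℕs (writersCode 0 (List.reverse ts ++ t ∷ []))) ++ out
      ≡⟨ cong (λ ts → bits (encodeℕs (writersCode 0 ts)) ++ out) (List.unfold-reverse t ts) ⟨
    bits (encodeℕs (writersCode 0 (List.reverse (t ∷ ts)))) ++ out ∎
    where open ≡-Reasoning

  responseCode : ℕ → Response → List ℕ
  responseCode n (s , as) = n + suc (toℕ (index finite-Control s)) ∷ actionsCode (flat as)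

  controlCode : ℕ → Control → List ℕ
  controlCode n s = finalCode s ∷ concatMap (λ v → responseCode n (respond s (unflat v))) scans

  writeAll-controlTokens : ∀ n s out → writeAll n (controlTokens s) out ≡ bits (encodeℕs (controlCode n s)) ++ out
  writeAll-controlTokens n s out = begin
    writeAll n (literals fs ++ rs) out
      ≡⟨ List.foldr-++ (write n) out (literals fs) rs ⟩
    writeAll n (literals fs) (writeAll n rs out)
      ≡⟨ trans (writeAll-literals n fs _)
               (cong (bits fs ++_) (writeAll-concatMap n _ (λ v → responseCode n (respond s (unflat v)))
                 (λ v → writeAll-response (respond s (unflat v))) scans out)) ⟩
    bits fs ++ bits (encodeℕs cs) ++ out
      ≡⟨ bits-++ fs _ out ⟨
    bits (fs ++ encodeℕs cs) ++ out
      ≡⟨ cong (λ s → bits s ++ out) (encodeℕs-++ (finalCode s ∷ []) cs) ⟨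
    bits (encodeℕs (controlCode n s)) ++ out ∎
    where
    open ≡-Reasoning
    fs = encodeℕs (finalCode s ∷ [])
    rs = concatMap (λ v → responseTokens (respond s (unflat v))) scans
    cs = concatMap (λ v → responseCode n (respond s (unflat v))) scans
    writeAll-response : ∀ r out → writeAll n (responseTokens r) out ≡ bits (encodeℕs (responseCode n r)) ++ out
    writeAll-response (c , as) out = writeAll-target n (lit1 ∷ literals (encodeℕs (k ∷ ns))) (suc k) ns out
      (λ out → cong (symbol lit1 ∷_) (trans
        (writeAll-literals n (encodeℕs (k ∷ ns)) out)
        (cong (λ s → bits s ++ out) (List.++-assoc (List.replicate k true) (false ∷ []) (encodeℕs ns)))))
      where
      k  = toℕ (index finite-Control c)
      ns = actionsCode (flat as)

  concat-tabulate-map : ∀ {A B : Set} {n} (f : A → List B) (g : Fin n → A) →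
                        List.concat (List.tabulate (f ∘ g)) ≡ concatMap f (List.tabulate g)
  concat-tabulate-map f g = cong List.concat (sym (List.map-tabulate g f))

  bodyCode : List ℕ
  bodyCode = List.concat (List.tabulate (controlCode (length quine) ∘ fromIndex finite-Control))

  writeAll-body : writeAll (length quine) body [] ≡ bits (encodeℕs bodyCode) ++ []
  writeAll-body = begin
    writeAll n body []
      ≡⟨ cong (λ ts → writeAll n ts []) (concat-tabulate-map controlTokens (fromIndex finite-Control)) ⟩
    writeAll n (concatMap controlTokens ss) []
      ≡⟨ writeAll-concatMap n controlTokens (controlCode n) (writeAll-controlTokens n) ss [] ⟩
    bits (encodeℕs (concatMap (controlCode n) ss)) ++ []
      ≡⟨ cong (λ ns → bits (encodeℕs ns) ++ []) (concat-tabulate-map (controlCode n) (fromIndex finite-Control)) ⟨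
    bits (encodeℕs bodyCode) ++ [] ∎
    where
    open ≡-Reasoning
    n = length quine
    ss = List.tabulate (fromIndex finite-Control)

  writersCode-tabulate : ∀ k ts → List.concat (List.tabulate (λ i → writerStateCode (k + toℕ i) (List.lookup ts i))) ≡ writersCode k ts
  writersCode-tabulate k []       = refl
  writersCode-tabulate k (t ∷ ts) = cong₂ _++_ (cong (λ n → writerStateCode n t) (ℕ.+-identityʳ k))
    (trans (cong List.concat (List.tabulate-cong (λ i → cong (λ n → writerStateCode n (List.lookup ts i)) (ℕ.+-suc k (toℕ i)))))
           (writersCode-tabulate (suc k) ts))

  stateCode-start : stateCode machine zero ≡ startCode
  stateCode-start = cong (0 ∷_) (List.concatMap-cong
    (λ v → cong (λ n → suc n ∷ actionsCode (flat (startActions (unflat v)))) (toℕ-first (length quine))) scans)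

  stateCode-suc : ∀ j {s} → Fin.splitAt (length quine) j ≡ s → stateCode machine (suc j)
    ≡ (if isFinal s then 1 else 0) ∷ concatMap
        (λ v → let q , as = transition s (unflat v) in toℕ q ∷ actionsCode (flat as)) scans
  stateCode-suc j refl = refl

  stateCode-writer : ∀ i → stateCode machine (suc (i ↑ˡ size finite-Control)) ≡ writerStateCode (toℕ i) (List.lookup quine i)
  stateCode-writer i = trans (stateCode-suc _ (Fin.splitAt-↑ˡ (length quine) i (size finite-Control))) (cong (0 ∷_) (List.concatMap-cong
    (λ _ → cong (_∷ actionsCode (flat (writeToken (List.lookup quine i))))
                (trans (cong suc (toℕ-next i)) (ℕ.+-comm 2 (toℕ i)))) scans))

  stateCode-control : ∀ j → stateCode machine (suc (length quine ↑ʳ j)) ≡ controlCode (length quine) (fromIndex finite-Control j)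
  stateCode-control j = trans
    (stateCode-suc _ (Fin.splitAt-↑ʳ (length quine) (size finite-Control) j))
    (cong (finalCode (fromIndex finite-Control j) ∷_) (List.concatMap-cong
    (λ v → cong (_∷ actionsCode (flat (proj₂ (respond (fromIndex finite-Control j) (unflat v)))))
                (trans (cong suc (Fin.toℕ-↑ʳ (length quine) _)) (sym (ℕ.+-suc (length quine) _)))) scans))

  -- Cuts the Gödel number where the sections of `quine` meet. The number `extraStates` is cut as
  -- well, after its first |w| ones.
  machineCode : gödelNumber machine ≡
    encodeℕs (extraTapes ∷ extraSymbols ∷ []) ++ List.replicate (length quine) true
    ++ encodeℕs (size finite-Control ∷ startCode) ++ encodeℕs (writersCode 0 quine) ++ encodeℕs bodyCode
  machineCode = begin
    gödelNumber machine
      ≡⟨ gödelNumber≡ machine ⟩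
    encodeℕs (extraTapes ∷ extraSymbols ∷ n + k ∷ List.concat (List.tabulate (stateCode machine)))
      ≡⟨ cong (λ ns → encodeℕs (extraTapes ∷ extraSymbols ∷ n + k ∷ ns)) states ⟩
    encodeℕs (extraTapes ∷ extraSymbols ∷ n + k ∷ startCode ++ ws ++ bodyCode)
      ≡⟨ encodeℕs-++ (extraTapes ∷ extraSymbols ∷ []) (n + k ∷ startCode ++ ws ++ bodyCode) ⟩
    h ++ encodeℕs (n + k ∷ startCode ++ ws ++ bodyCode)
      ≡⟨ cong (h ++_) (sum-code n k (startCode ++ ws ++ bodyCode)) ⟩
    h ++ List.replicate n true ++ encodeℕs (k ∷ startCode ++ ws ++ bodyCode)
      ≡⟨ cong (λ bs → h ++ List.replicate n true ++ bs) (encodeℕs-++ (k ∷ startCode) (ws ++ bodyCode)) ⟩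
    h ++ List.replicate n true ++ encodeℕs (k ∷ startCode) ++ encodeℕs (ws ++ bodyCode)
      ≡⟨ cong (λ bs → h ++ List.replicate n true ++ encodeℕs (k ∷ startCode) ++ bs) (encodeℕs-++ ws bodyCode) ⟩
    h ++ List.replicate n true ++ encodeℕs (k ∷ startCode) ++ encodeℕs ws ++ encodeℕs bodyCode ∎
    where
    open ≡-Reasoning
    n  = length quine
    k  = size finite-Control
    h  = encodeℕs (extraTapes ∷ extraSymbols ∷ [])
    ws = writersCode 0 quine
    sum-code : ∀ m n ns → encodeℕs (m + n ∷ ns) ≡ List.replicate m true ++ encodeℕs (n ∷ ns)
    sum-code zero    n ns = refl
    sum-code (suc m) n ns = cong (true ∷_) (sum-code m n ns)
    states : List.concat (List.tabulate (stateCode machine)) ≡ startCode ++ writersCode 0 quine ++ bodyCode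
    states = cong₂ _++_ stateCode-start (trans (concat-tabulate-+ (length quine) (stateCode machine ∘ suc))
      (cong₂ _++_ (trans (cong List.concat (List.tabulate-cong stateCode-writer)) (writersCode-tabulate 0 quine))
                  (cong List.concat (List.tabulate-cong stateCode-control))))

  produced≡ : writeAll 0 header (onesThen (length quine) (writeAll 0 startTokens
               (expandAll (List.reverse quine) (writeAll (length quine) body [])))) ≡ bits (gödelNumber machine)
  produced≡ = begin
    writeAll 0 header (onesThen (length quine) (writeAll 0 startTokens (expandAll (List.reverse quine) (writeAll (length quine) body []))))
      ≡⟨ writeAll-literals 0 h _ ⟩
    bits h ++ onesThen (length quine) (writeAll 0 startTokens (expandAll (List.reverse quine) (writeAll (length quine) body [])))
      ≡⟨ cong (bits h ++_) (trans (onesThen≡ (length quine) _) (cong (bits l ++_) (trans (writeAll-literals 0 s _)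
          (cong (bits s ++_) (trans (expandAll≡ (List.reverse quine) _) (cong₂ (λ ts o → bits (encodeℕs (writersCode 0 ts)) ++ o)
            (List.reverse-involutive quine) (trans writeAll-body (List.++-identityʳ _)))))))) ⟩
    bits h ++ bits l ++ bits s ++ bits ws ++ bits bs
      ≡⟨ cong (λ o → bits h ++ bits l ++ bits s ++ o) (List.map-++ _ ws bs) ⟨
    bits h ++ bits l ++ bits s ++ bits (ws ++ bs)
      ≡⟨ cong (λ o → bits h ++ bits l ++ o) (List.map-++ _ s (ws ++ bs)) ⟨
    bits h ++ bits l ++ bits (s ++ ws ++ bs)
      ≡⟨ cong (bits h ++_) (List.map-++ _ l (s ++ ws ++ bs)) ⟨
    bits h ++ bits (l ++ s ++ ws ++ bs)
      ≡⟨ List.map-++ _ h (l ++ s ++ ws ++ bs) ⟨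
    bits (h ++ l ++ s ++ ws ++ bs)
      ≡⟨ cong bits machineCode ⟨
    bits (gödelNumber machine) ∎
    where
    open ≡-Reasoning
    h  = encodeℕs (extraTapes ∷ extraSymbols ∷ [])
    l  = List.replicate (length quine) true
    s  = encodeℕs (size finite-Control ∷ startCode)
    ws = encodeℕs (writersCode 0 quine)
    bs = encodeℕs bodyCode

  selfReference : ∃ λ w₁ → ∃ λ w₂ → ∃ λ k → ∃ λ n → ∀ x →
    run n (start x) ≡ simStart (besideInput x) (List.map (symbol ∘ literal) (gödelNumber machine)) w₁ w₂ k
  selfReference = subst
    (λ out → ∃ λ w₁ → ∃ λ w₂ → ∃ λ k → ∃ λ n → ∀ x → run n (start x) ≡ simStart (besideInput x) out w₁ w₂ k)
    produced≡
    (quineRun header startTokens body quine≡ (plain-reverse (plain-literals (encodeℕs (extraTapes ∷ extraSymbols ∷ []))))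
    (plain-reverse (plain-literals (encodeℕs (size finite-Control ∷ startCode)))) (plain-reverse plain-body))

-- Behaviour of the diagonal machine

module Behaviour (D M₀ : DTM) (w : List Token) where
  open Diagonal D M₀
  open Machine w
  open QuineRun D M₀ w
  open Sim₀ using () renaming (_≈ₜ_ to _≈ₜ⁰_; _≈ₜₛ_ to _≈ₜₛ⁰_; _∼_ to _∼⁰_)
  open SimD using () renaming (_≈ₜₛ_ to _≈ₜₛᴰ_)
  module R₀ = Run M₀
  module Rᴰ = Run D

  bits : Str → List Symbol
  bits = List.map (symbol ∘ literal)

  -- The lockstep persists after halting: `sim₀ q` is final exactly when `q` is, and then both
  -- machines stand still. So no case distinction on the halting time is needed later.
  track₀ : ∀ n q F ts → input F ∷ rest₀ F ≈ₜₛ⁰ ts → let q′ , ts′ = M₀.run n (q , ts) in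
           ∃ λ F′ → run n (config (sim₀ q) F) ≡ config (sim₀ q′) F′ × (input F′ ∷ rest₀ F′ ≈ₜₛ⁰ ts′)
  track₀ zero    q F ts F≈ts = F , refl , F≈ts
  track₀ (suc n) q F ts F≈ts = go (M₀.final q) refl
    where
    go : ∀ b → M₀.final q ≡ b → let q′ , ts′ = M₀.run n (M₀.step (q , ts)) in
         ∃ λ F′ → run n (step (config (sim₀ q) F)) ≡ config (sim₀ q′) F′ × (input F′ ∷ rest₀ F′ ≈ₜₛ⁰ ts′)
    go true  q-final = subst₂ (λ c c′ → ∃ λ F′ → run n c ≡ config (sim₀ (proj₁ (M₀.run n c′))) F′ ×
                                                 (input F′ ∷ rest₀ F′ ≈ₜₛ⁰ proj₂ (M₀.run n c′)))
      (sym (R.step-final (config (sim₀ q) F) (trans (halted-config (sim₀ q) F) q-final)))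
      (sym (R₀.step-final (q , ts) q-final)) (track₀ n q F ts F≈ts)
    go false q-working = subst₂ (λ c c′ → ∃ λ F′ → run n c ≡ config (sim₀ (proj₁ (M₀.run n c′))) F′ ×
                                                 (input F′ ∷ rest₀ F′ ≈ₜₛ⁰ proj₂ (M₀.run n c′)))
      (sym (step-config (sim₀ q) F q-working response)) (sym (R₀.step-δ q ts q-working))
      (track₀ n _ _ _ (tracks (proj₂ (M₀.δ q (Vec.map Tape.here ts)))))
      where
      v = mapF Tape.here F
      response : respond (sim₀ q) v ≡ Product.map (λ q → sim₀ q) (perform₀ v) (M₀.δ q (Vec.map Tape.here ts))
      response = cong (λ u → Product.map (λ q → sim₀ q) (perform₀ v) (M₀.δ q u)) (Sim₀.scanned F≈ts)
      tracks : ∀ as → input (actF (perform₀ v as) F) ∷ rest₀ (actF (perform₀ v as) F) ≈ₜₛ⁰ Vec.zipWith act as ts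
      tracks (a ∷ as) = Sim₀.acts-≈ (a ∷ as) F≈ts

  readBits-∼ : ∀ {xs ys} → xs ∼⁰ ys → R.readBits xs ≡ R₀.readBits ys
  readBits-∼ Sim₀.[]                              = refl
  readBits-∼ (Sim₀.blank∷ _)                      = refl
  readBits-∼ (zero                    Sim₀.∷ _)  = refl
  readBits-∼ (suc zero                Sim₀.∷ xs) = cong (false ∷_) (readBits-∼ xs)
  readBits-∼ (suc (suc zero)          Sim₀.∷ xs) = cong (true ∷_) (readBits-∼ xs)
  readBits-∼ (suc (suc (suc _))       Sim₀.∷ _)  = refl

  outputOf-sim₀ : ∀ q F ts → input F ∷ rest₀ F ≈ₜₛ⁰ ts → outputOf (config (sim₀ q) F) ≡ M₀.outputOf (q , ts)
  outputOf-sim₀ q F (t ∷ ts) (i≈t ∷ _) = same q (input F) (Vec.tail (flat F)) t ts i≈t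
    where
    same : ∀ q i is t ts → i ≈ₜ⁰ t → outputOf (state (sim₀ q) , i ∷ is) ≡ M₀.outputOf (q , t ∷ ts)
    same q _ is _ ts (Sim₀.tape {ls} {ls′} {rs} {rs′} _ a rs∼) = trans
      (R.outputOf-readBits (state (sim₀ q)) ls (Sim₀.embed a) rs is)
      (trans (readBits-∼ (a Sim₀.∷ rs∼)) (sym (R₀.outputOf-readBits q ls′ a rs′ ts)))

  simulated : ∀ x F → input F ≈ₜ⁰ Vec.head (proj₂ (M₀.start x)) → rest₀ F ≡ Vec.replicate _ emptyTape →
    ∀ n → halted (run n (config (sim₀ zero) F)) ≡ M₀.halted (M₀.run n (M₀.start x)) ×
          outputOf (run n (config (sim₀ zero) F)) ≡ M₀.outputOf (M₀.run n (M₀.start x))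
  simulated x F i≈ rest≡ n with track₀ n zero F (proj₂ (M₀.start x))
                              (i≈ ∷ subst (_≈ₜₛ⁰ _) (sym rest≡) (Sim₀.blanks-≈ M₀.extraTapes))
  ... | F′ , ran , F′≈ =
    trans (cong halted ran) (halted-config (sim₀ _) F′) ,
    trans (cong outputOf ran) (outputOf-sim₀ _ F′ _ F′≈)

  -- The input tape during rewinding: z has still to be passed, in this
  -- order, and rs starts under the head or, if z is empty, to the right of it.
  rewindTape : Str → List Symbol → Tape Symbol
  rewindTape []      rs = tape [] blank rs
  rewindTape (b ∷ z) rs = tape (bits z ++ blank ∷ []) (symbol (literal b)) rs

  left-rewindTape : ∀ b z rs → act (shift left (symbol (literal b))) (rewindTape (b ∷ z) rs)
                             ≡ rewindTape z (symbol (literal b) ∷ rs)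
  left-rewindTape b []      rs = refl
  left-rewindTape b (_ ∷ z) rs = refl

  ahead : Str → List Symbol
  ahead []      = blank ∷ []
  ahead (b ∷ y) = bits (b ∷ y)

  -- The input tape after z (reversed) has been read and y is left.
  readingTape : Str → Str → Tape Symbol
  readingTape z y = firstOf (bits z ++ blank ∷ []) (bits y)

  left-readingTape : ∀ z y → act (shift left (Tape.here (readingTape z y))) (readingTape z y) ≡ rewindTape z (ahead y)
  left-readingTape []      []      = refl
  left-readingTape []      (_ ∷ _) = refl
  left-readingTape (_ ∷ z) []      = refl
  left-readingTape (_ ∷ z) (_ ∷ _) = refl

  right-besideInput : ∀ x → act (shift right (Tape.here (besideInput x))) (besideInput x) ≡ readingTape [] x
  right-besideInput []      = refl
  right-besideInput (_ ∷ _) = refl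

  embed-bit₀ : ∀ b → Sim₀.embed (M₀.bit b) ≡ symbol (literal b)
  embed-bit₀ false = refl
  embed-bit₀ true  = refl

  embed-bitᴰ : ∀ b → SimD.embed (D.bit b) ≡ symbol (literal b)
  embed-bitᴰ false = refl
  embed-bitᴰ true  = refl

  ∷-∼⁰ : ∀ b {xs y} → xs ∼⁰ List.map M₀.bit y → symbol (literal b) ∷ xs ∼⁰ List.map M₀.bit (b ∷ y)
  ∷-∼⁰ b {xs} {y} xs∼ = subst (λ a → a ∷ xs ∼⁰ List.map M₀.bit (b ∷ y)) (embed-bit₀ b) (M₀.bit b Sim₀.∷ xs∼)

  bits-∼⁰ : ∀ y → bits y ∼⁰ List.map M₀.bit y
  bits-∼⁰ []      = Sim₀.[]
  bits-∼⁰ (b ∷ y) = ∷-∼⁰ b {y = y} (bits-∼⁰ y)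

  ahead-∼⁰ : ∀ y → ahead y ∼⁰ List.map M₀.bit y
  ahead-∼⁰ []      = Sim₀.blank∷ Sim₀.[]
  ahead-∼⁰ (b ∷ y) = bits-∼⁰ (b ∷ y)

  rewound-≈ : ∀ x rs → rs ∼⁰ List.map M₀.bit x → act (shift right blank) (tape [] blank rs) ≈ₜ⁰ Vec.head (proj₂ (M₀.start x))
  rewound-≈ []      []       Sim₀.[]            = Sim₀.tape (Sim₀.blank∷ Sim₀.[]) zero Sim₀.[]
  rewound-≈ []      (_ ∷ rs) (Sim₀.blank∷ rs∼) = Sim₀.tape (Sim₀.blank∷ Sim₀.[]) zero rs∼
  rewound-≈ (b ∷ x) (_ ∷ rs) (_ Sim₀.∷ rs∼)    = Sim₀.tape (Sim₀.blank∷ Sim₀.[]) (M₀.bit b) rs∼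

  -- Only the first symbol of the output is inspected, which is enough to tell the answers 0 and 1
  -- apart.
  Kills : D.Config → Set
  Kills (q , ts) = D.final q ≡ true × isZero (Tape.here (Vec.head ts)) ≡ true

  isZero-embed : ∀ {d t} → d SimD.≈ₜ t → isZero (Tape.here d) ≡ isZero (Tape.here t)
  isZero-embed (SimD.tape _ zero          _) = refl
  isZero-embed (SimD.tape _ (suc zero)    _) = refl
  isZero-embed (SimD.tape _ (suc (suc _)) _) = refl

  true≢false : true ≢ false
  true≢false ()

  module _ (w₁ w₂ c : Tape Symbol) where

    stateFrame : (i d : Tape Symbol) → Vec (Tape Symbol) D.extraTapes → Frame (Tape Symbol)
    stateFrame i d rᴰ = frame i (Vec.replicate _ emptyTape) d rᴰ w₁ w₂ c

    step-input : ∀ {s s′} i {a} d rᴰ {i′} → finalControl s ≡ false →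
      (let v = mapF Tape.here (stateFrame i d rᴰ) in respond s v ≡ (s′ , record (idle v) { input = a })) →
      act a i ≡ i′ → step (config s (stateFrame i d rᴰ)) ≡ config s′ (stateFrame i′ d rᴰ)
    step-input {s} {s′} i {a} d rᴰ s-working response acted = trans
      (step-config s (stateFrame i d rᴰ) s-working response)
      (cong₂ (λ i (r , rᴰ) → config s′ (frame i r d rᴰ w₁ w₂ c)) acted (cong₂ _,_ (keep-act _) (keep-act _)))

    rewindRun : ∀ z y rs d rᴰ → rs ∼⁰ List.map M₀.bit y → ∃ λ i →
      run (suc (length z)) (config rewind (stateFrame (rewindTape z rs) d rᴰ)) ≡ config (sim₀ zero) (stateFrame i d rᴰ) ×
      i ≈ₜ⁰ Vec.head (proj₂ (M₀.start (z ʳ++ y)))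
    rewindRun []      y rs d rᴰ rs∼ = _ , step-input {rewind} (tape [] blank rs) d rᴰ refl refl refl , rewound-≈ y rs rs∼
    rewindRun (b ∷ z) y rs d rᴰ rs∼ with rewindRun z (b ∷ y) (symbol (literal b) ∷ rs) d rᴰ (∷-∼⁰ b {y = y} rs∼)
    ... | i , ran , i≈ = i , trans (cong (run (suc (length z)))
                           (step-input {rewind} (rewindTape (b ∷ z) rs) d rᴰ refl refl (left-rewindTape b z rs))) ran , i≈

    -- The clocked phase with `y` still unread: at most one step per unread symbol, and one that
    -- ends the phase. The equation on `z′` and `y′` says that the input survives as a clock.
    data Verdict (y z : Str) (c₀ : D.Config) (C : Config) : Set where
      killed : ∀ n k F → n ≤ suc (length y) → k ≤ length y → Kills (D.run k c₀) → run n C ≡ config dead F →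
               Tape.here (input F) ≡ blank → Verdict y z c₀ C
      spared : ∀ n z′ y′ d rᴰ → n ≤ suc (length y) → (∀ k → k ≤ length y → ¬ Kills (D.run k c₀)) →
               z′ ʳ++ y′ ≡ z ʳ++ y → run n C ≡ config rewind (stateFrame (rewindTape z′ (ahead y′)) d rᴰ) →
               Verdict y z c₀ C

    -- Finality of `D` is tested before the clock, so every configuration from time 0 up to and
    -- including |y| is examined.
    simDRun : ∀ y z q d rᴰ t ts → d ∷ rᴰ ≈ₜₛᴰ t ∷ ts →
              Verdict y z (q , t ∷ ts) (config (simD q) (stateFrame (readingTape z y) d rᴰ))
    simDRun y z q d rᴰ t ts (d≈t ∷ rᴰ≈ts) = by-finality (D.final q) refl
      where
      v = mapF Tape.here (stateFrame (readingTape z y) d rᴰ)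

      here≡ : isZero (Tape.here d) ≡ isZero (Tape.here t)
      here≡ = isZero-embed d≈t

      verdict : ∀ b → D.final q ≡ true → isZero (Tape.here d) ≡ b →
                Verdict y z (q , t ∷ ts) (config (simD q) (stateFrame (readingTape z y) d rᴰ))
      verdict true q-final is0 = killed 1 0 (stateFrame (act (keep blank) (readingTape z y)) d rᴰ) (s≤s z≤n) z≤n (q-final , trans (sym here≡) is0)
        (step-input {simD q} (readingTape z y) d rᴰ refl
          (trans (cong (λ b → simDResponse q b v) q-final) (cong (λ b → verdictResponse b v) is0)) refl) refl
      verdict false q-final not0 = spared 1 z y d rᴰ (s≤s z≤n)
        (λ k _ (_ , is0) → true≢false (trans (sym is0) (trans
          (cong (λ c → isZero (Tape.here (Vec.head (proj₂ c)))) (Rᴰ.run-final k (q , t ∷ ts) q-final))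
          (trans (sym here≡) not0))))
        refl
        (step-input {simD q} (readingTape z y) d rᴰ refl
          (trans (cong (λ b → simDResponse q b v) q-final) (cong (λ b → verdictResponse b v) not0))
          (left-readingTape z y))

      clock : ∀ y → D.final q ≡ false → Verdict y z (q , t ∷ ts) (config (simD q) (stateFrame (readingTape z y) d rᴰ))
      clock [] q-working = spared 1 z [] d rᴰ (s≤s z≤n)
        (λ { zero _ (q-final , _) → true≢false (trans (sym q-final) q-working) })
        refl
        (step-input {simD q} (readingTape z []) d rᴰ refl
          (cong (λ b → simDResponse q b (mapF Tape.here (stateFrame (readingTape z []) d rᴰ))) q-working)
          (left-readingTape z []))
      clock (b ∷ y) q-working = prepend (stepped (D.δ q (Vec.map Tape.here (t ∷ ts))) refl)
        where
        v′ = mapF Tape.here (stateFrame (readingTape z (b ∷ y)) d rᴰ)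
        Next : Set
        Next = Verdict y (b ∷ z) (D.step (q , t ∷ ts)) (step (config (simD q) (stateFrame (readingTape z (b ∷ y)) d rᴰ)))
        stepped : ∀ r → D.δ q (Vec.map Tape.here (t ∷ ts)) ≡ r → Next
        stepped (q′ , a ∷ as) δ≡ = subst₂ (Verdict y (b ∷ z))
          (sym (trans (Rᴰ.step-δ q (t ∷ ts) q-working) (cong (λ r → proj₁ r , Vec.zipWith act (proj₂ r) (t ∷ ts)) δ≡)))
          (sym (trans
            (step-config (simD q) (stateFrame (readingTape z (b ∷ y)) d rᴰ) refl
              (trans (cong (λ b → simDResponse q b v′) q-working)
                     (cong (Product.map (λ q → simD q) (performᴰ v′)) (trans (cong (D.δ q) (SimD.scanned (d≈t ∷ rᴰ≈ts))) δ≡))))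
            (cong₂ (λ i r → config (simD q′) (frame i r (act (SimD.embedAction a) d)
                                                     (Vec.zipWith act (Vec.map SimD.embedAction as) rᴰ) w₁ w₂ c))
                   (right-firstOf (symbol (literal b)) (bits z ++ blank ∷ []) (symbol (literal b)) (bits y)) (keep-act _))))
          (simDRun y (b ∷ z) q′ _ _ _ _ (SimD.acts-≈ (a ∷ as) (d≈t ∷ rᴰ≈ts)))
        prepend : Next → Verdict (b ∷ y) z (q , t ∷ ts) (config (simD q) (stateFrame (readingTape z (b ∷ y)) d rᴰ))
        prepend (killed n k F n≤ k≤ kills ran blank-here) = killed (suc n) (suc k) F (s≤s n≤) (s≤s k≤) kills ran blank-here
        prepend (spared n z′ y′ d rᴰ n≤ no-kill zy ran) = spared (suc n) z′ y′ d rᴰ (s≤s n≤)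
          (λ { zero    _         (q-final , _) → true≢false (trans (sym q-final) q-working)
             ; (suc k) (s≤s k≤) kills         → no-kill k k≤ kills })
          zy ran

      by-finality : ∀ b → D.final q ≡ b →
                    Verdict y z (q , t ∷ ts) (config (simD q) (stateFrame (readingTape z y) d rᴰ))
      by-finality true  q-final   = verdict (isZero (Tape.here d)) q-final refl
      by-finality false q-working = clock y q-working

  outputOf-blank : ∀ q i {is} → Tape.here i ≡ blank → outputOf (q , i ∷ is) ≡ []
  outputOf-blank q (tape ls a rs) refl = refl

  started-≈ : ∀ g → act (shift right blank) (tape [] blank (bits g)) SimD.≈ₜ Vec.head (proj₂ (D.start g))
  started-≈ []      = SimD.tape (SimD.blank∷ SimD.[]) zero SimD.[]
  started-≈ (b ∷ g) = subst (λ a → tape (blank ∷ []) a (bits g) SimD.≈ₜ Vec.head (proj₂ (D.start (b ∷ g))))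
                            (embed-bitᴰ b) (SimD.tape (SimD.blank∷ SimD.[]) (D.bit b) (bits-∼ g))
    where
    bits-∼ : ∀ y → bits y SimD.∼ List.map D.bit y
    bits-∼ []      = SimD.[]
    bits-∼ (b ∷ y) = subst (λ a → a ∷ bits y SimD.∼ List.map D.bit (b ∷ y)) (embed-bitᴰ b) (D.bit b SimD.∷ bits-∼ y)

  module _ (runtime₀ : PolynomialRuntime M₀) (g : Str) (w₁ w₂ c : Tape Symbol) (n₀ : ℕ)
           (startup : ∀ x → run n₀ (start x) ≡ simStart (besideInput x) (bits g) w₁ w₂ c) where

    -- Upward closed in `n`, so once `D` answers 0 all sufficiently long inputs are affected.
    KillsBy : ℕ → Set
    KillsBy n = ∃ λ k → k ≤ n × Kills (D.run k (D.start g))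

    data Result (x : Str) (C : Config) : Set where
      vanished : KillsBy (length x) → outputOf C ≡ [] → Result x C
      copied  : ¬ KillsBy (length x) → outputOf C ≡ result M₀ runtime₀ x → Result x C

    -- The constant startup, at most l + 1 clocked steps, at most l + 1 steps of rewinding, and the
    -- time of `M₀`.
    bound : Polynomial
    bound = (n₀ + 2 ∷ 2 ∷ []) +ᵖ proj₁ runtime₀

    bound≥ : ∀ l {n z} → n ≤ suc l → z ≤ l → n₀ + (n + (suc z + eval (proj₁ runtime₀) l)) ≤ eval bound l
    bound≥ l {n} {z} n≤ z≤ = begin
      n₀ + (n + (suc z + p))              ≤⟨ ℕ.+-monoʳ-≤ n₀ (ℕ.+-mono-≤ n≤ (ℕ.+-monoˡ-≤ p (s≤s z≤))) ⟩
      n₀ + (suc l + (suc l + p))          ≡⟨ solve 3 (λ n₀ l p → n₀ :+ (con 1 :+ l :+ (con 1 :+ l :+ p))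
                                                      := n₀ :+ con 2 :+ l :* (con 2 :+ l :* con 0) :+ p) refl n₀ l p ⟩
      n₀ + 2 + l * (2 + l * 0) + p        ≡⟨ eval-+ᵖ (n₀ + 2 ∷ 2 ∷ []) (proj₁ runtime₀) l ⟨
      eval bound l                        ∎
      where
      open ℕ.≤-Reasoning
      open ℕ.+-*-Solver
      p = eval (proj₁ runtime₀) l

    outcome : ∀ x → ∃ λ n → n ≤ eval bound (length x) × halted (run n (start x)) ≡ true × Result x (run n (start x))
    outcome x = conclude (simDRun w₁ w₂ c x [] zero d rᴰ _ _ (started-≈ g ∷ SimD.blanks-≈ D.extraTapes))
      where
      d = act (shift right blank) (tape [] blank (bits g))
      rᴰ = Vec.replicate D.extraTapes emptyTape
      p₀ = eval (proj₁ runtime₀) (length x)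

      launched : ∀ n → run (n₀ + n) (start x) ≡ run n (config (simD zero) (stateFrame w₁ w₂ c (readingTape [] x) d rᴰ))
      launched n = trans (R.run-+ n₀ n (start x)) (cong (run n) (trans (startup x)
        (cong (λ i → config (simD zero) (stateFrame w₁ w₂ c i d rᴰ)) (right-besideInput x))))

      conclude : Verdict w₁ w₂ c x [] (D.start g) (config (simD zero) (stateFrame w₁ w₂ c (readingTape [] x) d rᴰ)) →
                 ∃ λ n → n ≤ eval bound (length x) × halted (run n (start x)) ≡ true × Result x (run n (start x))
      conclude (killed n k F n≤ k≤ kills ran blank-here) =
        n₀ + n ,
        ℕ.≤-trans (ℕ.+-monoʳ-≤ n₀ (ℕ.m≤m+n n (1 + p₀))) (bound≥ (length x) {z = 0} n≤ z≤n) ,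
        trans (cong halted end) (halted-config dead F) ,
        vanished (k , k≤ , kills) (trans (cong outputOf end) (outputOf-blank (state dead) (input F) {Vec.tail (flat F)} blank-here))
        where
        end : run (n₀ + n) (start x) ≡ config dead F
        end = trans (launched n) ran
      conclude (spared n z′ y′ d′ rᴰ′ n≤ no-kill zy ran) with rewindRun w₁ w₂ c z′ y′ (ahead y′) d′ rᴰ′ (ahead-∼⁰ y′)
      ... | i , rewound , i≈ =
        n₀ + (n + (suc (length z′) + p₀)) ,
        bound≥ (length x) n≤ |z′|≤ ,
        trans (cong halted end) (trans (proj₁ sim) (proj₂ runtime₀ x)) ,
        copied (λ (k , k≤ , kills) → no-kill k k≤ kills) (trans (cong outputOf end) (proj₂ sim))
        where
        F = stateFrame w₁ w₂ c i d′ rᴰ′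
        |z′|≤ : length z′ ≤ length x
        |z′|≤ = subst (length z′ ≤_) (trans (sym (List.length-ʳ++ z′)) (cong length zy)) (ℕ.m≤m+n _ _)
        end : run (n₀ + (n + (suc (length z′) + p₀))) (start x) ≡ run p₀ (config (sim₀ zero) F)
        end = trans (launched (n + (suc (length z′) + p₀))) (trans (R.run-+ n (suc (length z′) + p₀) _)
             (trans (cong (run (suc (length z′) + p₀)) ran) (trans (R.run-+ (suc (length z′)) p₀ _)
             (cong (run p₀) rewound))))
        sim = simulated x F (subst (λ v → i ≈ₜ⁰ Vec.head (proj₂ (M₀.start v))) zy i≈) refl p₀

    runtime : PolynomialRuntime machine
    runtime = bound , λ x → let n , n≤ , halts , _ = outcome x in
      trans (cong halted (R.run-halted (start x) n≤ halts)) halts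

    result-machine : ∀ x → (KillsBy (length x) × result machine runtime x ≡ [])
                         ⊎ (¬ KillsBy (length x) × result machine runtime x ≡ result M₀ runtime₀ x)
    result-machine x with outcome x
    ... | n , n≤ , halts , vanished kills out≡ = inj₁ (kills , trans (cong outputOf (R.run-halted (start x) n≤ halts)) out≡)
    ... | n , n≤ , halts , copied  spare out≡ = inj₂ (spare , trans (cong outputOf (R.run-halted (start x) n≤ halts)) out≡)

    scanned-bit : ∀ (C : D.Config) {b bs} → D.outputOf C ≡ b ∷ bs → D.bit⁻¹ (Tape.here (Vec.head (proj₂ C))) ≡ just b
    scanned-bit (q , tape ls zero                rs ∷ ts) ()
    scanned-bit (q , tape ls (suc zero)          rs ∷ ts) refl = refl
    scanned-bit (q , tape ls (suc (suc zero))    rs ∷ ts) refl = refl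
    scanned-bit (q , tape ls (suc (suc (suc _))) rs ∷ ts) ()

    outputs-true⇒¬kills : Outputs D g (true ∷ []) → ∀ n → ¬ KillsBy n
    outputs-true⇒¬kills (t , halts , out≡) n (k , _ , kills-halts , is0) =
      contra (Tape.here (Vec.head (proj₂ (D.run t (D.start g))))) (scanned-bit (D.run t (D.start g)) out≡)
        (subst (λ C → isZero (Tape.here (Vec.head (proj₂ C))) ≡ true) (Rᴰ.halted-unique k t (D.start g) kills-halts halts) is0)
      where
      contra : ∀ a → D.bit⁻¹ a ≡ just true → isZero a ≢ true
      contra (suc zero) ()

    outputs-false⇒kills : Outputs D g (false ∷ []) → ∃ λ t → ∀ n → t ≤ n → KillsBy n
    outputs-false⇒kills (t , halts , out≡) = t , λ n t≤n → t , t≤n , halts ,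
      is0 (Tape.here (Vec.head (proj₂ (D.run t (D.start g))))) (scanned-bit (D.run t (D.start g)) out≡)
      where
      is0 : ∀ a → D.bit⁻¹ a ≡ just false → isZero a ≡ true
      is0 zero                ()
      is0 (suc zero)          _ = refl
      is0 (suc (suc zero))    ()
      is0 (suc (suc (suc _))) ()

-- An accepting circuit

module _ (n : ℕ) where
  open +-*-Solver

  private
    q : ℚ
    q = ℝ.seq √½ n

  reAt imAt : State 1 → Bool → ℚ
  reAt ψ b = ℝ.seq (ℂ.re (ψ (b ∷ []))) n
  imAt ψ b = ℝ.seq (ℂ.im (ψ (b ∷ []))) n

  -- Amplitudes of the n-th rational approximants. There the square of `q` is only close to 1/2, so
  -- amplitudes are tracked as polynomials in `q`.
  Amplitudes : State 1 → (a b c d : ℚ) → Set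
  Amplitudes ψ a b c d = reAt ψ false ≡ a × imAt ψ false ≡ b × reAt ψ true ≡ c × imAt ψ true ≡ d

  applyH : ∀ ψ {a b c d} → Amplitudes ψ a b c d →
    Amplitudes (applyGate ψ (H zero)) (q ℚ.* (a ℚ.+ c)) (q ℚ.* (b ℚ.+ d)) (q ℚ.* (a ℚ.- c)) (q ℚ.* (b ℚ.- d))
  applyH ψ (refl , refl , refl , refl) =
    solve 5 (λ q a b c d → (q :* a :+ con m1 :* (con 0ℚ :* b)) :+ (q :* c :+ con m1 :* (con 0ℚ :* d))
                           := q :* (a :+ c)) refl q _ (imAt ψ false) _ (imAt ψ true) ,
    solve 5 (λ q a b c d → (q :* b :+ con 0ℚ :* a) :+ (q :* d :+ con 0ℚ :* c)
                           := q :* (b :+ d)) refl q (reAt ψ false) _ (reAt ψ true) _ ,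
    solve 5 (λ q a b c d → (q :* a :+ con m1 :* (con 0ℚ :* b))
                           :+ ((con m1 :* q :+ con m1 :* (con 0ℚ :* con 0ℚ)) :* c
                               :+ con m1 :* ((con m1 :* con 0ℚ :+ con 0ℚ :* q) :* d))
                           := q :* (a :- c)) refl q _ (imAt ψ false) _ (imAt ψ true) ,
    solve 5 (λ q a b c d → (q :* b :+ con 0ℚ :* a)
                           :+ ((con m1 :* q :+ con m1 :* (con 0ℚ :* con 0ℚ)) :* d
                               :+ (con m1 :* con 0ℚ :+ con 0ℚ :* q) :* c)
                           := q :* (b :- d)) refl q (reAt ψ false) _ (reAt ψ true) _
    where m1 = ℚ.- 1ℚ

  applyT : ∀ ψ {a b c d} → Amplitudes ψ a b c d →
    Amplitudes (applyGate ψ (T zero)) a b (q ℚ.* (c ℚ.- d)) (q ℚ.* (c ℚ.+ d))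
  applyT ψ (refl , refl , refl , refl) =
    solve 4 (λ a b c d → (con 1ℚ :* a :+ con m1 :* (con 0ℚ :* b)) :+ (con 0ℚ :* c :+ con m1 :* (con 0ℚ :* d))
                         := a) refl _ (imAt ψ false) (reAt ψ true) (imAt ψ true) ,
    solve 4 (λ a b c d → (con 1ℚ :* b :+ con 0ℚ :* a) :+ (con 0ℚ :* d :+ con 0ℚ :* c)
                         := b) refl (reAt ψ false) _ (reAt ψ true) (imAt ψ true) ,
    solve 5 (λ q a b c d → (con 0ℚ :* a :+ con m1 :* (con 0ℚ :* b)) :+ (q :* c :+ con m1 :* (q :* d))
                           := q :* (c :- d)) refl q (reAt ψ false) (imAt ψ false) _ (imAt ψ true) ,
    solve 5 (λ q a b c d → (con 0ℚ :* b :+ con 0ℚ :* a) :+ (q :* d :+ q :* c)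
                           := q :* (c :+ d)) refl q (reAt ψ false) (imAt ψ false) (reAt ψ true) _
    where m1 = ℚ.- 1ℚ

  -- Two T gates multiply the amplitude of the state 1 by (q + iq)² = 2q²i, so the mixed terms of a
  -- single T gate cancel.
  applyTT : ∀ ψ {a b c d} → Amplitudes ψ a b c d →
    Amplitudes (applyGate (applyGate ψ (T zero)) (T zero)) a b
               (ℚ.- ((+ 2 / 1) ℚ.* (q ℚ.* q) ℚ.* d)) ((+ 2 / 1) ℚ.* (q ℚ.* q) ℚ.* c)
  applyTT ψ {c = c} {d} amps = let a≡ , b≡ , c≡ , d≡ = applyT (applyGate ψ (T zero)) (applyT ψ amps) in
    a≡ , b≡ ,
    trans c≡ (solve 3 (λ q c d → q :* (q :* (c :- d) :- q :* (c :+ d)) := :- (con (+ 2 / 1) :* (q :* q) :* d)) refl q c d) ,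
    trans d≡ (solve 3 (λ q c d → q :* (q :* (c :- d) :+ q :* (c :+ d)) := con (+ 2 / 1) :* (q :* q) :* c) refl q c d)

  acceptance-amplitudes : ∀ (U : Circuit 1) ψ {a b c d} → Circuit.output U ≡ zero → Amplitudes (applyCircuit U ψ) a b c d →
                          ℝ.seq (acceptance U ψ) n ≡ c ℚ.* c ℚ.+ d ℚ.* d
  acceptance-amplitudes U@(circuit zero _) ψ refl (refl , refl , refl , refl) =
    solve 4 (λ a b c d → (a :* con 0ℚ :+ con m1 :* ((con m1 :* b) :* con 0ℚ)) :+ (c :* c :+ con m1 :* ((con m1 :* d) :* d))
                         := c :* c :+ d :* d) refl (reAt φ false) (imAt φ false) (reAt φ true) (imAt φ true)
    where
    φ = applyCircuit U ψ
    m1 = ℚ.- 1ℚ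

-- Up to a global sign, H T⁴ H = H Z H = X, which maps |0⟩ to |1⟩.
flipCircuit : Circuit 1
flipCircuit = circuit zero (H zero ∷ T zero ∷ T zero ∷ T zero ∷ T zero ∷ H zero ∷ [])

flipCode : Str
flipCode = encodeℕs (1 ∷ 0 ∷ 0 ∷ 0 ∷ 1 ∷ 0 ∷ 1 ∷ 0 ∷ 1 ∷ 0 ∷ 1 ∷ 0 ∷ 0 ∷ 0 ∷ [])

decode-flipCode : decodeBQP flipCode ≡ just (bqpCircuit flipCircuit)
decode-flipCode = refl

-- Four T gates multiply by (2si)² = -4s² with s = q². The final H then gives the state 1 the
-- amplitude q(q + 4s²q) = s(1 + 4s²), which is 1 at s = 1/2.
acceptance-flip : ∀ n → let s = ℝ.seq √½ n ℚ.* ℝ.seq √½ n; v = 1ℚ ℚ.+ (+ 4 / 1) ℚ.* (s ℚ.* s) in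
                  ℝ.seq (acceptance flipCircuit ∣0^ 1 ⟩) n ≡ (s ℚ.* s) ℚ.* (v ℚ.* v)
acceptance-flip n = trans
  (acceptance-amplitudes n flipCircuit ∣0^ 1 ⟩ refl
    (applyH n (after (T zero) (after (T zero) ψ₂)) (applyTT n ψ₂ (applyTT n ψ₁ (applyH n ∣0^ 1 ⟩ (refl , refl , refl , refl))))))
  (trans (cong₂ (λ c d → c ℚ.* c ℚ.+ d ℚ.* d) re≡ im≡)
         (solve 2 (λ s v → (s :* v) :* (s :* v) :+ con 0ℚ :* con 0ℚ := (s :* s) :* (v :* v)) refl s v))
  where
  open +-*-Solver
  after : Gate 1 → State 1 → State 1
  after g ψ = applyGate ψ g
  ψ₁ ψ₂ : State 1
  ψ₁ = after (H zero) ∣0^ 1 ⟩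
  ψ₂ = after (T zero) (after (T zero) ψ₁)
  q s v two : ℚ
  q = ℝ.seq √½ n
  s = q ℚ.* q
  v = 1ℚ ℚ.+ (+ 4 / 1) ℚ.* (s ℚ.* s)
  two = + 2 / 1
  re≡ : q ℚ.* (q ℚ.* (1ℚ ℚ.+ 0ℚ) ℚ.- ℚ.- (two ℚ.* s ℚ.* (two ℚ.* s ℚ.* (q ℚ.* (1ℚ ℚ.- 0ℚ))))) ≡ s ℚ.* v
  re≡ = solve 1 (λ q → q :* (q :* (con 1ℚ :+ con 0ℚ) :- :- (con two :* (q :* q) :* (con two :* (q :* q) :* (q :* (con 1ℚ :- con 0ℚ)))))
                     := (q :* q) :* (con 1ℚ :+ con (+ 4 / 1) :* ((q :* q) :* (q :* q)))) refl q
  im≡ : q ℚ.* (q ℚ.* (0ℚ ℚ.+ 0ℚ) ℚ.- (two ℚ.* s ℚ.* ℚ.- (two ℚ.* s ℚ.* (q ℚ.* (0ℚ ℚ.- 0ℚ))))) ≡ 0ℚ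
  im≡ = solve 1 (λ q → q :* (q :* (con 0ℚ :+ con 0ℚ) :- (con two :* (q :* q) :* :- (con two :* (q :* q) :* (q :* (con 0ℚ :- con 0ℚ)))))
                     := con 0ℚ) refl q

*-mono-≤-nonNeg : ∀ {a b c d} → 0ℚ ℚ.≤ a → 0ℚ ℚ.≤ c → a ℚ.≤ b → c ℚ.≤ d → a ℚ.* c ℚ.≤ b ℚ.* d
*-mono-≤-nonNeg {a} {b} {c} {d} 0≤a 0≤c a≤b c≤d = begin
  a ℚ.* c  ≤⟨ ℚ.*-monoʳ-≤-nonNeg c {{ℚ.nonNegative 0≤c}} a≤b ⟩
  b ℚ.* c  ≤⟨ ℚ.*-monoˡ-≤-nonNeg b {{ℚ.nonNegative (ℚ.≤-trans 0≤a a≤b)}} c≤d ⟩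
  b ℚ.* d  ∎
  where open ℚ.≤-Reasoning

flipPolynomial : ℚ → ℚ
flipPolynomial s = (s ℚ.* s) ℚ.* (v ℚ.* v)
  where v = 1ℚ ℚ.+ (+ 4 / 1) ℚ.* (s ℚ.* s)

flipPolynomial-mono : ∀ s t → 0ℚ ℚ.≤ s → s ℚ.≤ t → flipPolynomial s ℚ.≤ flipPolynomial t
flipPolynomial-mono s t 0≤s s≤t =
  *-mono-≤-nonNeg {s ℚ.* s} {t ℚ.* t} {v s ℚ.* v s} {v t ℚ.* v t} 0≤s² (square≥0 0≤v) s²≤t²
    (*-mono-≤-nonNeg {v s} {v t} {v s} {v t} 0≤v 0≤v v≤ v≤)
  where
  v : ℚ → ℚ
  v s = 1ℚ ℚ.+ (+ 4 / 1) ℚ.* (s ℚ.* s)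
  square≥0 : ∀ {x} → 0ℚ ℚ.≤ x → 0ℚ ℚ.≤ x ℚ.* x
  square≥0 {x} 0≤x = subst (ℚ._≤ x ℚ.* x) (ℚ.*-zeroʳ x) (ℚ.*-monoˡ-≤-nonNeg x {{ℚ.nonNegative 0≤x}} 0≤x)
  0≤s² : 0ℚ ℚ.≤ s ℚ.* s
  0≤s² = square≥0 0≤s
  s²≤t² : s ℚ.* s ℚ.≤ t ℚ.* t
  s²≤t² = *-mono-≤-nonNeg {s} {t} {s} {t} 0≤s 0≤s s≤t s≤t
  v≤ : v s ℚ.≤ v t
  v≤ = ℚ.+-monoʳ-≤ 1ℚ (ℚ.*-monoˡ-≤-nonNeg (+ 4 / 1) s²≤t²)
  0≤v : 0ℚ ℚ.≤ v s
  0≤v = ℚ.+-mono-≤ {0ℚ} {1ℚ} {0ℚ} (ℚ.<⇒≤ (ℚ.positive⁻¹ 1ℚ))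
    (subst (ℚ._≤ (+ 4 / 1) ℚ.* (s ℚ.* s)) (ℚ.*-zeroʳ (+ 4 / 1)) (ℚ.*-monoˡ-≤-nonNeg (+ 4 / 1) 0≤s²))

-- A coarse precision suffices: the polynomial is 1 at 1/2 and still about 0.92 at 49/100, and it
-- increases from there.
⅔≤flipPolynomial : ∀ s → ½ ℚ.≤ s ℚ.+ (+ 1 / 100) → (+ 2 / 3) ℚ.≤ flipPolynomial s
⅔≤flipPolynomial s ½≤ = ℚ.≤-trans
  (from-yes ((+ 2 / 3) ℚ.≤? flipPolynomial (½ ℚ.- (+ 1 / 100))))
  (flipPolynomial-mono (½ ℚ.- (+ 1 / 100)) s (from-yes (0ℚ ℚ.≤? ½ ℚ.- (+ 1 / 100)))
    (subst (½ ℚ.- (+ 1 / 100) ℚ.≤_) cancel (ℚ.+-monoˡ-≤ (ℚ.- (+ 1 / 100)) ½≤)))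
  where
  cancel : s ℚ.+ (+ 1 / 100) ℚ.- (+ 1 / 100) ≡ s
  cancel = trans (ℚ.+-assoc s (+ 1 / 100) (ℚ.- (+ 1 / 100)))
                 (trans (cong (s ℚ.+_) (ℚ.+-inverseʳ (+ 1 / 100))) (ℚ.+-identityʳ s))

-- The threshold comes from the precision 1/100 and not from ε: beyond it the inequality holds
-- without slack.
⅔≤ℝflipPolynomial : ∀ x → (∀ n → ℝ.seq x n ≡ flipPolynomial (ℝ.seq √½ n ℚ.* ℝ.seq √½ n)) → fromℚ (+ 2 / 3) ≤ℝ x
⅔≤ℝflipPolynomial x x≡ ε = let N , close = proj₂ √½²≈½ (+ 1 / 100) in N , λ n N≤n → ℚ.≤-trans
  (subst (+ 2 / 3 ℚ.≤_) (sym (x≡ n)) (⅔≤flipPolynomial (ℝ.seq √½ n ℚ.* ℝ.seq √½ n) (close n N≤n)))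
  (subst (ℚ._≤ ℝ.seq x n ℚ.+ ε) (ℚ.+-identityʳ (ℝ.seq x n)) (ℚ.+-monoʳ-≤ (ℝ.seq x n) (ℚ.<⇒≤ (ℚ.positive⁻¹ ε))))

flip-accepts : fromℚ (+ 2 / 3) ≤ℝ acceptance flipCircuit ∣0^ 1 ⟩
flip-accepts = ⅔≤ℝflipPolynomial (acceptance flipCircuit ∣0^ 1 ⟩) acceptance-flip

-- Finite problems

-- The strings of length at most L, as nodes of a binary tree.
Node : ℕ → Set
Node zero    = Fin 1
Node (suc L) = Maybe (Bool × Node L)

root : ∀ L → Node L
root zero    = zero
root (suc L) = nothing

path : ∀ L → Node L → Str
path zero    _              = []
path (suc L) nothing        = []
path (suc L) (just (b , v)) = b ∷ path L v

child : ∀ L → Node L → Bool → Maybe (Node L)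
child zero    _              b = nothing
child (suc L) nothing        b = just (just (b , root L))
child (suc L) (just (a , v)) b = Maybe.map (λ v → just (a , v)) (child L v b)

descend : ∀ L → Node L → Str → Maybe (Node L)
descend L v []      = just v
descend L v (b ∷ x) = maybe′ (λ v → descend L v x) nothing (child L v b)

descend-just : ∀ L a v x → descend (suc L) (just (a , v)) x ≡ Maybe.map (λ v → just (a , v)) (descend L v x)
descend-just L a v []      = refl
descend-just L a v (b ∷ x) with child L v b
... | just v′ = descend-just L a v′ x
... | nothing = refl

descend-root : ∀ L x → length x ≤ L → ∃ λ v → descend L (root L) x ≡ just v × path L v ≡ x
descend-root zero    []      _         = zero , refl , refl
descend-root (suc L) []      _         = nothing , refl , refl
descend-root (suc L) (b ∷ x) (s≤s x≤) with descend-root L x x≤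
... | v , at-v , v≡x = just (b , v) , trans (descend-just L b (root L) x) (cong (Maybe.map _) at-v) , cong (b ∷_) v≡x

descend-overflow : ∀ L x → L < length x → descend L (root L) x ≡ nothing
descend-overflow zero    (b ∷ x) _         = refl
descend-overflow (suc L) (b ∷ x) (s≤s L<) =
  trans (descend-just L b (root L) x) (cong (Maybe.map _) (descend-overflow L x L<))

finite-Bool : Finite Bool
finite-Bool .size            = 2
finite-Bool .index false     = zero
finite-Bool .index true      = suc zero
finite-Bool .fromIndex zero  = false
finite-Bool .fromIndex (suc _) = true
finite-Bool .fromIndex-index false = refl
finite-Bool .fromIndex-index true  = refl

finite-Node : ∀ L → Finite (Node L)
finite-Node zero    = finite-Fin 1
finite-Node (suc L) = finite-Maybe (finite-× finite-Bool (finite-Node L))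

-- Outputs b₀ ∷ bs on the strings of length at most suc L that f selects, and
-- the empty string on all others.
module Table (L : ℕ) (f : Str → Bool) (b₀ : Bool) (bs : Str) where

  code : Str
  code = b₀ ∷ bs

  -- With `suc L` in place of `L` the root is `nothing` even for a variable `L`, so its index
  -- computes to zero, the start state.
  Control : Set
  Control = Node (suc L) ⊎ (Fin (suc (length code)) ⊎ Fin 1)

  pattern node v  = inj₁ v
  pattern write i = inj₂ (inj₁ i)
  pattern stop    = inj₂ (inj₂ zero)

  finite-Control : Finite Control
  finite-Control = finite-⊎ (finite-Node (suc L)) (finite-⊎ (finite-Fin (suc (length code))) (finite-Fin 1))

  bit : Bool → Fin 3
  bit false = suc zero
  bit true  = suc (suc zero)

  decide : Bool → Control × (Fin 3 × Move)
  decide true  = write (fromℕ (length code)) , (zero , stay)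
  decide false = stop , (zero , stay)

  enter : Maybe (Node (suc L)) → Fin 3 → Control × (Fin 3 × Move)
  enter (just v) s = node v , (s , right)
  enter nothing  s = stop , (zero , stay)

  respond : Control → Fin 3 → Control × (Fin 3 × Move)
  respond (node v)        zero             = decide (f (path (suc L) v))
  respond (node v)        (suc zero)       = enter (child (suc L) v false) (suc zero)
  respond (node v)        (suc (suc zero)) = enter (child (suc L) v true) (suc (suc zero))
  respond (write zero)    s                = stop , (s , right)
  respond (write (suc i)) s                = write (inject₁ i) , (bit (List.lookup code i) , left)
  respond stop            s                = stop , (s , stay)

  final : Control → Bool
  final stop = true
  final _    = false

  machine : DTM
  machine .DTM.extraTapes     = 0
  machine .DTM.extraSymbols   = 0
  machine .DTM.extraStates    = _
  machine .DTM.δ q (s ∷ [])   = let c , a = respond (fromIndex finite-Control q) s in index finite-Control c , a ∷ []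
  machine .DTM.final q        = final (fromIndex finite-Control q)

  open DTM machine using (Config; step; run; start; outputOf; halted)
  module R = Run machine

  config : Control → Tape (Fin 3) → Config
  config c t = index finite-Control c , t ∷ []

  halted-config : ∀ c t → halted (config c t) ≡ final c
  halted-config c t = cong final (fromIndex-index finite-Control c)

  step-config : ∀ c t → final c ≡ false → let c′ , a = respond c (Tape.here t) in step (config c t) ≡ config c′ (act a t)
  step-config c t c-working = trans
    (R.step-δ (index finite-Control c) (t ∷ []) (trans (halted-config c t) c-working))
    (cong (λ c → let c′ , a = respond c (Tape.here t) in config c′ (act a t)) (fromIndex-index finite-Control c))

  left-tape : ∀ s ls a rs → ∃ λ ls′ → ∃ λ a′ → act {2} (s , left) (tape ls a rs) ≡ tape ls′ a′ (s ∷ rs)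
  left-tape s []       a rs = [] , zero , refl
  left-tape s (l ∷ ls) a rs = ls , l , refl

  -- The code is written backwards from the blank after the input, over the input, so nothing
  -- follows it on the tape. The head ends one cell before it, and `write zero` makes the step back
  -- onto its first symbol.
  writeRun : ∀ k i → toℕ i ≡ k → ∀ ls a rs → ∃ λ ls′ → ∃ λ a′ →
    run k (config (write i) (tape ls a rs)) ≡ config (write zero) (tape ls′ a′ (List.map bit (List.take k code) ++ rs))
  writeRun zero    zero    _  ls a rs = ls , a , refl
  writeRun (suc k) (suc i) e ls a rs =
    let ls₁ , a₁ , moved = left-tape (bit (List.lookup code i)) ls a rs
        ls₂ , a₂ , ran   = writeRun k (inject₁ i) (trans (Fin.toℕ-inject₁ i) i≡k) ls₁ a₁ (bit (List.lookup code i) ∷ rs)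
    in ls₂ , a₂ , trans (cong (run k) (trans (step-config (write (suc i)) (tape ls a rs) refl)
                                              (cong (config (write (inject₁ i))) moved)))
                  (trans ran (cong (λ as → config (write zero) (tape ls₂ a₂ as)) (snoc rs)))
    where
    i≡k : toℕ i ≡ k
    i≡k = ℕ.suc-injective e
    snoc : ∀ rs → List.map bit (List.take k code) ++ bit (List.lookup code i) ∷ rs
                ≡ List.map bit (List.take (suc k) code) ++ rs
    snoc rs = begin
      List.map bit (List.take k code) ++ bit (List.lookup code i) ∷ rs
        ≡⟨ List.++-assoc (List.map bit (List.take k code)) _ rs ⟨
      (List.map bit (List.take k code) ++ bit (List.lookup code i) ∷ []) ++ rs
        ≡⟨ cong (_++ rs) (List.map-++ bit (List.take k code) _) ⟨
      List.map bit (List.take k code ++ List.lookup code i ∷ []) ++ rs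
        ≡⟨ cong (λ k → List.map bit (List.take k code ++ List.lookup code i ∷ []) ++ rs) i≡k ⟨
      List.map bit (List.take (toℕ i) code ++ List.lookup code i ∷ []) ++ rs
        ≡⟨ cong (λ bs → List.map bit bs ++ rs) (List.take-suc code i) ⟨
      List.map bit (List.take (suc (toℕ i)) code) ++ rs
        ≡⟨ cong (λ k → List.map bit (List.take (suc k) code) ++ rs) i≡k ⟩
      List.map bit (List.take (suc k) code) ++ rs ∎
      where open ≡-Reasoning

  Halts : ℕ → Config → Str → Set
  Halts n c y = ∃ λ k → k ≤ n × halted (run k c) ≡ true × outputOf (run k c) ≡ y

  halts-step : ∀ {n c c′ y} → step c ≡ c′ → Halts n c′ y → Halts (suc n) c y
  halts-step refl (k , k≤ , halts , out) = suc k , s≤s k≤ , halts , out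

  answer : Maybe (Node (suc L)) → Bool
  answer = maybe′ (f ∘ path (suc L)) false

  codeFor : Bool → Str
  codeFor b = if b then code else []

  halts-stop : ∀ n ls rs → Halts n (config stop (tape ls zero rs)) []
  halts-stop n ls rs = 0 , z≤n , halted-config stop (tape ls zero rs) , refl

  halts-write : ∀ ls → Halts (suc (length code)) (config (write (fromℕ (length code))) (tape ls zero [])) code
  halts-write ls = length code + 1 , ℕ.≤-reflexive (ℕ.+-comm (length code) 1) ,
      trans (cong halted end) (halted-config stop (tape (a′ ∷ ls′) (bit b₀) (List.map bit bs))) ,
      trans (cong outputOf end) (trans (R.outputOf-readBits (index finite-Control stop) (a′ ∷ ls′) (bit b₀) (List.map bit bs) [])
                                       (readBits-bit code))
    where
    written = writeRun (length code) (fromℕ (length code)) (Fin.toℕ-fromℕ _) ls zero []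
    ls′ = proj₁ written
    a′  = proj₁ (proj₂ written)
    all-written : List.map bit (List.take (length code) code) ++ [] ≡ List.map bit code
    all-written = trans (List.++-identityʳ _) (cong (List.map bit) (List.take-all (length code) code ℕ.≤-refl))
    readBits-bit : ∀ bs → R.readBits (List.map bit bs) ≡ bs
    readBits-bit []           = refl
    readBits-bit (false ∷ bs) = cong (false ∷_) (readBits-bit bs)
    readBits-bit (true ∷ bs)  = cong (true ∷_) (readBits-bit bs)
    end : run (length code + 1) (config (write (fromℕ (length code))) (tape ls zero []))
        ≡ config stop (tape (a′ ∷ ls′) (bit b₀) (List.map bit bs))
    end = trans (R.run-+ (length code) 1 _)
                (trans (cong step (trans (proj₂ (proj₂ written)) (cong (λ as → config (write zero) (tape ls′ a′ as)) all-written)))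
                       (step-config (write zero) (tape ls′ a′ (List.map bit code)) refl))

  reading : List (Fin 3) → Str → Tape (Fin 3)
  reading ls []      = tape ls zero []
  reading ls (b ∷ x) = tape ls (bit b) (List.map bit x)

  right-reading : ∀ ls b x → act (bit b , right) (reading ls (b ∷ x)) ≡ reading (bit b ∷ ls) x
  right-reading ls b []      = refl
  right-reading ls b (c ∷ x) = refl

  time : Str → ℕ
  time []      = suc (suc (length code))
  time (_ ∷ x) = suc (time x)

  readRun : ∀ x v ls → Halts (time x) (config (node v) (reading ls x)) (codeFor (answer (descend (suc L) v x)))
  readRun [] v ls = halts-step (step-config (node v) (tape ls zero []) refl) (decided (f (path (suc L) v)))
    where
    decided : ∀ b → Halts (suc (length code)) (let c , a = decide b in config c (act a (tape ls zero []))) (codeFor b)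
    decided true  = halts-write ls
    decided false = halts-stop _ ls []
  readRun (b ∷ x) v ls = halts-step
    (trans (step-config (node v) (reading ls (b ∷ x)) refl)
           (cong (λ (c , a) → config c (act a (reading ls (b ∷ x)))) (bit-response b)))
    (entered (child (suc L) v b))
    where
    bit-response : ∀ b → respond (node v) (bit b) ≡ enter (child (suc L) v b) (bit b)
    bit-response false = refl
    bit-response true  = refl
    entered : ∀ m → Halts (time x) (let c , a = enter m (bit b) in config c (act a (reading ls (b ∷ x))))
                          (codeFor (answer (maybe′ (λ v → descend (suc L) v x) nothing m)))
    entered (just v′) = subst (λ t → Halts (time x) (config (node v′) t) (codeFor (answer (descend (suc L) v′ x))))
                              (sym (right-reading ls b x)) (readRun x v′ (bit b ∷ ls))
    entered nothing   = halts-stop (time x) ls _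

  start≡ : ∀ x → start x ≡ config (node (root (suc L))) (reading [] x)
  start≡ []      = refl
  start≡ (b ∷ x) = cong₂ (λ a as → zero , tape [] a as ∷ []) (bit≡ b) (List.map-cong bit≡ x)
    where
    bit≡ : ∀ b → DTM.bit machine b ≡ bit b
    bit≡ false = refl
    bit≡ true  = refl

  bound : Polynomial
  bound = suc (suc (length code)) ∷ 1 ∷ []

  bound-time : ∀ x → eval bound (length x) ≡ time x
  bound-time []      = ℕ.+-identityʳ _
  bound-time (b ∷ x) = trans
    (solve 2 (λ c l → c :+ (con 1 :+ l) :* (con 1 :+ (con 1 :+ l) :* con 0)
                      := con 1 :+ (c :+ l :* (con 1 :+ l :* con 0)))
             refl (suc (suc (length code))) (length x))
    (cong suc (bound-time x))
    where
    open ℕ.+-*-Solver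

  halts : ∀ x → Halts (eval bound (length x)) (start x) (codeFor (answer (descend (suc L) (root (suc L)) x)))
  halts x rewrite start≡ x | bound-time x = readRun x (root (suc L)) []

  runtime : PolynomialRuntime machine
  runtime = bound , λ x → let k , k≤ , halted-k , _ = halts x in trans (cong halted (R.run-halted (start x) k≤ halted-k)) halted-k

  result≡ : ∀ x → result machine runtime x ≡ codeFor (answer (descend (suc L) (root (suc L)) x))
  result≡ x = let k , k≤ , halted-k , out = halts x in trans (cong outputOf (R.run-halted (start x) k≤ halted-k)) out

  bqpMachine : BQPMachine
  bqpMachine = record { dtm = machine ; runtime = runtime }

  circuitAt-short : ∀ x → length x ≤ suc L → BQPMachine.circuitAt bqpMachine x ≡ decodeBQP (codeFor (f x))
  circuitAt-short x x≤ with descend-root (suc L) x x≤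
  ... | v , at-v , v≡x = cong decodeBQP
    (trans (result≡ x) (trans (cong (codeFor ∘ answer) at-v) (cong (codeFor ∘ f) v≡x)))

  circuitAt-long : ∀ x → suc L < length x → BQPMachine.circuitAt bqpMachine x ≡ nothing
  circuitAt-long x L< = cong decodeBQP (trans (result≡ x) (cong (codeFor ∘ answer) (descend-overflow (suc L) x L<)))

table : ∀ b₀ bs L (f : Str → Bool) → ∃ λ N →
        (∀ x → length x ≤ suc L → BQPMachine.circuitAt N x ≡ decodeBQP (if f x then b₀ ∷ bs else [])) ×
        (∀ x → suc L < length x → BQPMachine.circuitAt N x ≡ nothing)
table b₀ bs L f = bqpMachine , circuitAt-short , circuitAt-long
  where open Table L f b₀ bs

-- Diagonalisation

private
  ¬¬-em : ∀ {ℓ} {X : Set ℓ} → ¬ ¬ (Σ Bool λ b → (X → b ≡ true) × (b ≡ true → X))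
  ¬¬-em k = k (false , (λ x → ⊥-elim (k (true , (λ _ → refl) , λ _ → x))) , λ ())

-- Excluded middle for a single string is irrefutable, and finitely many irrefutable statements are
-- jointly so; the recursion splits the strings by their first bit.
¬¬-characteristic : ∀ L (Q : Str → Set) →
  ¬ ¬ (Σ (Str → Bool) λ f → ∀ x → length x ≤ L → (Q x → f x ≡ true) × (f x ≡ true → Q x))
¬¬-characteristic zero    Q k = ¬¬-em {X = Q []} λ (b , spec) → k ((λ _ → b) , λ { [] _ → spec })
¬¬-characteristic (suc L) Q k =
  ¬¬-em {X = Q []} λ (b , spec) →
  ¬¬-characteristic L (Q ∘ (false ∷_)) λ (f₀ , spec₀) →
  ¬¬-characteristic L (Q ∘ (true ∷_)) λ (f₁ , spec₁) →
  k ((λ { [] → b ; (false ∷ x) → f₀ x ; (true ∷ x) → f₁ x }) ,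
     λ { [] _ → spec ; (false ∷ x) (s≤s x≤) → spec₀ x x≤ ; (true ∷ x) (s≤s x≤) → spec₁ x x≤ })

0≤ℝ⅓ : fromℚ 0ℚ ≤ℝ fromℚ (+ 1 / 3)
0≤ℝ⅓ ε = 0 , λ _ _ → ℚ.+-mono-≤ {0ℚ} {+ 1 / 3} {0ℚ} {ε} (from-yes (0ℚ ℚ.≤? + 1 / 3)) (ℚ.<⇒≤ (ℚ.positive⁻¹ ε))

rejectsQMA : ∀ M x → QMAMachine.circuitAt M x ≡ nothing → Rejects (valueQMA M) x
rejectsQMA M x none = fromℚ 0ℚ ,
  subst (λ c → valueOfQMACircuit c (fromℚ 0ℚ)) (sym none) (≈ℝ-refl {fromℚ 0ℚ}) , 0≤ℝ⅓

-- `valueBQP` is defined by `with`; as a function of the decoded circuit, values can be transported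
-- along equations for `circuitAt`.
ValueOf : Maybe BQPCircuit → ℝ → Set
ValueOf (just C) r = r ≈ℝ acceptance (BQPCircuit.U C) ∣0^ BQPCircuit.k C ⟩
ValueOf nothing  r = r ≈ℝ fromℚ 0ℚ

value-of : ∀ N x r → ValueOf (BQPMachine.circuitAt N x) r → valueBQP N x r
value-of N x r v with BQPMachine.circuitAt N x
... | just C  = v
... | nothing = v

rejectsBQP : ∀ N x → BQPMachine.circuitAt N x ≡ nothing → Rejects (valueBQP N) x
rejectsBQP N x none = fromℚ 0ℚ ,
  value-of N x (fromℚ 0ℚ) (subst (λ c → ValueOf c (fromℚ 0ℚ)) (sym none) (≈ℝ-refl {fromℚ 0ℚ})) , 0≤ℝ⅓

acceptsBQP : ∀ N x C → BQPMachine.circuitAt N x ≡ just C →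
             fromℚ (+ 2 / 3) ≤ℝ acceptance (BQPCircuit.U C) ∣0^ BQPCircuit.k C ⟩ → Accepts (valueBQP N) x
acceptsBQP N x C some accepting = r , value-of N x r (subst (λ c → ValueOf c r) (sym some) (≈ℝ-refl {r})) , accepting
  where
  r : ℝ
  r = acceptance (BQPCircuit.U C) ∣0^ BQPCircuit.k C ⟩

module _ (M : QMAMachine) (L : ℕ) (none : ∀ x → L ≤ length x → QMAMachine.circuitAt M x ≡ nothing)
         (b₀ : Bool) (bs : Str) (C : BQPCircuit) (decodes : decodeBQP (b₀ ∷ bs) ≡ just C)
         (accepting : fromℚ (+ 2 / 3) ≤ℝ acceptance (BQPCircuit.U C) ∣0^ BQPCircuit.k C ⟩) where

  open PromiseProblem (P M)

  answer : Bool → Maybe BQPCircuit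
  answer b = decodeBQP (if b then b₀ ∷ bs else [])

  -- Long inputs are rejected by both machines, so by disjointness none of them is a yes-instance.
  -- On a short no-instance `f` cannot be true, as that would make it a yes-instance too.
  table-decides : ∀ (f : Str → Bool) →
    (∀ x → length x ≤ suc L → (x ∈ yesSet → f x ≡ true) × (f x ≡ true → x ∈ yesSet)) →
    ∀ N → (∀ x → length x ≤ suc L → BQPMachine.circuitAt N x ≡ answer (f x)) →
          (∀ x → suc L < length x → BQPMachine.circuitAt N x ≡ nothing) → Decides (valueBQP N) (P M)
  table-decides f f-spec N short long = (λ {x} → yes-case x) , (λ {x} → no-case x)
    where
    yes-case : ∀ x → x ∈ yesSet → Accepts (valueBQP N) x
    yes-case x accepts = Sum.[
      (λ x≤ → acceptsBQP N x C (trans (short x x≤) (trans (cong answer (proj₁ (f-spec x x≤) accepts)) decodes)) accepting) ,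
      (λ L< → ⊥-elim (disjoint x accepts (rejectsQMA M x (none x (ℕ.<⇒≤ (ℕ.<-trans (ℕ.n<1+n L) L<)))))) ]
      (ℕ.≤-<-connex (length x) (suc L))
    f≡false : ∀ x → length x ≤ suc L → x ∈ noSet → f x ≡ false
    f≡false x x≤ rejects = ¬-not λ fx → disjoint x (proj₂ (f-spec x x≤) fx) rejects
    no-case : ∀ x → x ∈ noSet → Rejects (valueBQP N) x
    no-case x rejects = Sum.[
      (λ x≤ → rejectsBQP N x (trans (short x x≤) (cong answer (f≡false x x≤ rejects)))) ,
      (λ L< → rejectsBQP N x (long x L<)) ]
      (ℕ.≤-<-connex (length x) (suc L))

  ¬¬-finite-BQP : ¬ ¬ P M ∈ BQP
  ¬¬-finite-BQP P∉BQP = ¬¬-characteristic (suc L) yesSet λ (f , f-spec) →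
    let N , short , long = table b₀ bs L f in P∉BQP (N , table-decides f f-spec N short long)

finite-in-BQP : ∀ M L → (∀ x → L ≤ length x → QMAMachine.circuitAt M x ≡ nothing) → ¬ ¬ P M ∈ BQP
finite-in-BQP M L none =
  -- `flipCode` begins with `true`, the unary digit of its single qubit. The table takes the first
  -- bit separately, so that its code is visibly non-empty.
  ¬¬-finite-BQP M L none true (List.drop 1 flipCode) (bqpCircuit flipCircuit) decode-flipCode flip-accepts

-- Equal circuits have equal values, so `A` is contained in the extremal problem of `M`; a machine
-- for a larger promise also decides the smaller one.
same-circuits : ∀ M M₀ → (∀ x → QMAMachine.circuitAt M x ≡ QMAMachine.circuitAt M₀ x) →
                ∀ A → Decides (valueQMA M₀) A → P M ∈ BQP → A ∈ BQP
same-circuits M M₀ same A (yes₀ , no₀) (N , yesᴺ , noᴺ) = N ,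
  (λ {x} x∈A → yesᴺ (transport x (λ v → ∃ λ r → v r × fromℚ (+ 2 / 3) ≤ℝ r) (yes₀ x∈A))) ,
  (λ {x} x∈A → noᴺ (transport x (λ v → ∃ λ r → v r × r ≤ℝ fromℚ (+ 1 / 3)) (no₀ x∈A)))
  where
  transport : ∀ x (F : (ℝ → Set) → Set) → F (valueQMA M₀ x) → F (valueQMA M x)
  transport x F = subst (λ c → F (valueOfQMACircuit c)) (sym (same x))

module Diagonalisation (D : DTM) (M₀ : QMAMachine) where
  open QMAMachine M₀ using (dtm; witnessQubits; totalQubits; totalQubits-poly; qubits-correct) renaming (runtime to runtime₀)

  module _ (w : List Token) (g : Str) (w₁ w₂ c : Tape (Diagonal.Symbol D dtm)) (n₀ : ℕ)
           (startup : ∀ x → DTM.run (Diagonal.Machine.machine D dtm w) n₀ (DTM.start (Diagonal.Machine.machine D dtm w) x)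
              ≡ QuineRun.simStart D dtm w (QuineRun.besideInput D dtm w x) (Behaviour.bits D dtm w g) w₁ w₂ c) where

    private
      module B = Behaviour D dtm w

      machine : DTM
      machine = Diagonal.Machine.machine D dtm w

      runtime : PolynomialRuntime machine
      runtime = B.runtime runtime₀ g w₁ w₂ c n₀ startup

      KillsBy : ℕ → Set
      KillsBy = B.KillsBy runtime₀ g w₁ w₂ c n₀ startup

      result≡ : ∀ x → (KillsBy (length x) × result machine runtime x ≡ [])
                    ⊎ (¬ KillsBy (length x) × result machine runtime x ≡ result dtm runtime₀ x)
      result≡ = B.result-machine runtime₀ g w₁ w₂ c n₀ startup

    qmaMachine : QMAMachine
    qmaMachine .QMAMachine.dtm = machine
    qmaMachine .QMAMachine.runtime = runtime
    qmaMachine .QMAMachine.witnessQubits = witnessQubits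
    qmaMachine .QMAMachine.totalQubits = totalQubits
    qmaMachine .QMAMachine.totalQubits-poly = totalQubits-poly
    -- An empty output decodes to no circuit and so imposes no condition; any other output is that
    -- of `M₀`, whose qubit numbers are correct.
    qmaMachine .QMAMachine.qubits-correct x C C-at = Sum.[
      (λ (_ , empty) → ⊥-elim (just≢nothing (trans (sym C-at) (cong decodeQMA empty)))) ,
      (λ (_ , same) → qubits-correct x C (trans (sym (cong decodeQMA same)) C-at)) ]′ (result≡ x)
      where
      just≢nothing : ∀ {C : QMACircuit} → just C ≢ nothing
      just≢nothing ()

    copies : Outputs D g (true ∷ []) → ∀ x → QMAMachine.circuitAt qmaMachine x ≡ QMAMachine.circuitAt M₀ x
    copies D-true x = Sum.[
      (λ (kills , _) → ⊥-elim (B.outputs-true⇒¬kills runtime₀ g w₁ w₂ c n₀ startup D-true (length x) kills)) ,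
      (λ (_ , same) → cong decodeQMA same) ]′ (result≡ x)

    vanishes : Outputs D g (false ∷ []) → ∃ λ L → ∀ x → L ≤ length x → QMAMachine.circuitAt qmaMachine x ≡ nothing
    vanishes D-false = let L , kills = B.outputs-false⇒kills runtime₀ g w₁ w₂ c n₀ startup D-false in L , λ x L≤ → Sum.[
      (λ (_ , empty) → cong decodeQMA empty) ,
      (λ (spared , _) → ⊥-elim (spared (kills (length x) L≤))) ]′ (result≡ x)

  diagonalise : ∃ λ M →
    (Outputs D (gödelNumber (QMAMachine.dtm M)) (true ∷ []) →
       ∀ x → QMAMachine.circuitAt M x ≡ QMAMachine.circuitAt M₀ x) ×
    (Outputs D (gödelNumber (QMAMachine.dtm M)) (false ∷ []) →
       ∃ λ L → ∀ x → L ≤ length x → QMAMachine.circuitAt M x ≡ nothing)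
  diagonalise =
    let w₁ , w₂ , c , n₀ , startup = selfReference
        g = gödelNumber (Diagonal.Machine.machine D dtm quine)
    in qmaMachine quine g w₁ w₂ c n₀ startup , copies quine g w₁ w₂ c n₀ startup , vanishes quine g w₁ w₂ c n₀ startup
    where open Quine D dtm using (quine; selfReference)

corollary6 :
    BQP ⊊ QMA →
    ¬ (∃ λ (D : DTM) → ∀ (M : QMAMachine) →
         (P M ∈ BQP → Outputs D (gödelNumber (QMAMachine.dtm M)) (true ∷ [])) ×
         (P M ∉ BQP → Outputs D (gödelNumber (QMAMachine.dtm M)) (false ∷ [])))
corollary6 (_ , A , (M₀ , decides) , A∉BQP) (D , decider) = P∈BQP P∉BQP
  where
  diagonal = Diagonalisation.diagonalise D M₀
  M = proj₁ diagonal
  P∉BQP : P M ∉ BQP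
  P∉BQP P∈ = A∉BQP (same-circuits M M₀ (proj₁ (proj₂ diagonal) (proj₁ (decider M) P∈)) A decides P∈)
  P∈BQP : ¬ ¬ P M ∈ BQP
  P∈BQP = let L , none = proj₂ (proj₂ diagonal) (proj₂ (decider M) P∉BQP) in finite-in-BQP M L none
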